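{- The characteristic polynomial of the Seidel matrix corresponding to a maximum affine equiangular set (with norm $3$ with respect to the switching root $\rho$) in $L$ is either $$(x+5)^{39}(x-13)^8(x-9)^8(x^2-19x+72)$$ or $$(x+5)^{39}(x-13)^6(x-9)^6(x-11)(x-12)(x^2-20x+87)^2.$$
   Context: Lattices. $A_n=\{x\in\mathbb{Z}^{n+1}: x_1+\cdots+x_{n+1}=0\}$ and $\alpha_n=(\frac1{n+1},\dots,\frac1{n+1},-\frac n{n+1})\in\mathbb{R}^{n+1}$ (so $\alpha_1=(\frac12,-\frac12)$). Let $\Lambda=A_5^3\oplus A_1^4\subset\mathbb{R}^{26}$; vectors of $\mathbb{R}^{26}$ are row vectors written $(v_1,\dots,v_7)$ with $v_1,v_2,v_3\in\mathbb{R}^6$ and $v_4,\dots,v_7\in\mathbb{R}^2$. Let $\beta_0=(\alpha_5,\alpha_5,\alpha_5,0,0,0,\alpha_1)$, $\beta_1=(3\alpha_5,0,0,0,\alpha_1,\alpha_1,\alpha_1)$, $\beta_2=(0,3\alpha_5,0,\alpha_1,0,\alpha_1,\alpha_1)$, $\beta_3=(0,0,3\alpha_5,\alpha_1,\alpha_1,0,\alpha_1)$. $L$ is the lattice generated by $\Lambda$ and $\beta_0,\beta_1,\beta_2,\beta_3$ (an integral lattice). Let $\rho=(0,0,0,0,0,0,2\alpha_1)$. Affine equiangular sets. A set $\omega$ of vectors is an affine equiangular set with norm $3$ with respect to the switching root $\rho$ if $(u,\rho)=1$ and $(u,u)=3$ for all $u\in\omega$, and $(u,v)\in\{0,1\}$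 for all distinct $u,v\in\omega$, where $(\cdot,\cdot)$ is the standard inner product. It is in $L$ if $\omega\subset L$, and it is maximum in $L$ if no such set in $L$ has larger cardinality. Seidel matrix. For an affine equiangular set $\omega=\{u_1,\dots,u_n\}$ with norm $3$ with respect to $\rho$, put $\widetilde{u}=(2u-\rho)/\sqrt2$ for $u\in\omega$; then $(\widetilde{u_i},\widetilde{u_i})=5$ and $(\widetilde{u_i},\widetilde{u_j})=\pm1$ for $i\ne j$. The Seidel matrix corresponding to $\omega$ is the $n\times n$ matrix $B^\top B-5I$, where $B=[\widetilde{u_1}^\top\ \widetilde{u_2}^\top\ \cdots\ \widetilde{u_n}^\top]$. -}

module Defs where

open import Algebra.Bundles.Raw using (RawRing)
import Algebra.Definitions.RawMonoid as RawMonoidDefs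
import Algebra.Definitions.RawSemiring as RawSemiringDefs
open import Data.Bool.Base using (if_then_else_)
open import Data.Fin.Base using (Fin; zero; suc; toℕ; punchIn)
open import Data.Fin.Properties using (_≟_)
open import Data.Integer.Base as ℤ using (+_)
open import Data.List.Base using (List; []; _∷_)
import Data.List.Base as List
open import Data.Nat.Base as ℕ using (ℕ; zero; suc)
open import Data.Product.Base using (∃-syntax; _×_)
open import Data.Rational.Base as ℚ using (ℚ; 0ℚ; 1ℚ; ½; _/_)
open import Data.Sum.Base using (_⊎_)
open import Data.Vec.Base as Vec using (Vec; _++_; _∷ʳ_; replicate; lookup)
open import Function.Bundles using (_⇔_)
open import Function.Definitions using (Injective)
open import Level using (Level; 0ℓ) renaming (suc to lsuc)
open import Relation.Binary.PropositionalEquality.Core using (_≡_; _≢_)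
open import Relation.Nullary.Decidable.Core using (does)
open import Relation.Unary using (Pred; _∈_; _⊆_; _∪_; ｛_｝)

private variable
  a ℓ : Level
  m n : ℕ

-- ℝ is replaced by ℚ throughout: every vector of L has rational coordinates.

V : ℕ → Set
V = Vec ℚ

infixl 6 _⊹_ _⊖_
infixl 7 _·_

_⊹_ : V n → V n → V n
_⊹_ = Vec.zipWith ℚ._+_

_·_ : ℚ → V n → V n
c · x = Vec.map (c ℚ.*_) x

neg : V n → V n
neg = Vec.map λ q → ℚ.- q

_⊖_ : V n → V n → V n
x ⊖ y = x ⊹ neg y

𝟎 : V n
𝟎 = replicate _ 0ℚ

open RawMonoidDefs ℚ.+-0-rawMonoid using () renaming (sum to sumℚ)

⟪_,_⟫ : V n → V n → ℚ
⟪ x , y ⟫ = sumℚ λ k → lookup x k ℚ.* lookup y k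

------------------------------------------------------------------------
-- Lattices

data Span (S : Pred (V n) 0ℓ) : Pred (V n) 0ℓ where
  gen   : ∀ {x} → x ∈ S → x ∈ Span S
  0-cl  : 𝟎 ∈ Span S
  +-cl  : ∀ {x y} → x ∈ Span S → y ∈ Span S → (x ⊹ y) ∈ Span S
  neg-cl : ∀ {x} → x ∈ Span S → neg x ∈ Span S

A : (n : ℕ) → Pred (V (suc n)) 0ℓ
A n x = ∃[ z ] x ≡ Vec.map (_/ 1) z × Vec.foldr′ ℤ._+_ (+ 0) z ≡ + 0

α : (n : ℕ) → V (suc n)
α n = replicate n (+ 1 / suc n) ∷ʳ ((ℤ.- (+ n)) / suc n)

infixr 6 _⊕_

_⊕_ : Pred (V m) 0ℓ → Pred (V n) 0ℓ → Pred (V (m ℕ.+ n)) 0ℓ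
_⊕_ {m} P Q x = Vec.take m x ∈ P × Vec.drop m x ∈ Q

Λ : Pred (V 26) 0ℓ
Λ = A 5 ⊕ A 5 ⊕ A 5 ⊕ A 1 ⊕ A 1 ⊕ A 1 ⊕ A 1

private
  o₅ 3α₅ : V 6
  o₅  = 𝟎
  3α₅ = (+ 3 / 1) · α 5
  o₁ : V 2
  o₁  = 𝟎

β₀ β₁ β₂ β₃ : V 26
β₀ = α 5 ++ α 5 ++ α 5 ++ o₁  ++ o₁  ++ o₁  ++ α 1
β₁ = 3α₅ ++ o₅  ++ o₅  ++ o₁  ++ α 1 ++ α 1 ++ α 1
β₂ = o₅  ++ 3α₅ ++ o₅  ++ α 1 ++ o₁  ++ α 1 ++ α 1
β₃ = o₅  ++ o₅  ++ 3α₅ ++ α 1 ++ α 1 ++ o₁  ++ α 1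

L : Pred (V 26) 0ℓ
L = Span (Λ ∪ ｛ β₀ ｝ ∪ ｛ β₁ ｝ ∪ ｛ β₂ ｝ ∪ ｛ β₃ ｝)

ρ : V 26
ρ = o₅ ++ o₅ ++ o₅ ++ o₁ ++ o₁ ++ o₁ ++ ((+ 2 / 1) · α 1)

------------------------------------------------------------------------
-- Affine equiangular sets

record AffineEquiangular (r : V n) (ω : Pred (V n) 0ℓ) : Set where
  field
    root     : ∀ {u} → u ∈ ω → ⟪ u , r ⟫ ≡ 1ℚ
    norm     : ∀ {u} → u ∈ ω → ⟪ u , u ⟫ ≡ + 3 / 1
    distinct : ∀ {u v} → u ∈ ω → v ∈ ω → u ≢ v →
               ⟪ u , v ⟫ ≡ 0ℚ ⊎ ⟪ u , v ⟫ ≡ 1ℚ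

AtLeast : ℕ → Pred (V n) 0ℓ → Set
AtLeast {n} k ω =
  ∃[ u ] Injective {A = Fin k} {B = V n} _≡_ _≡_ u × (∀ i → u i ∈ ω)

-- Cardinalities are compared through finite subsets, so that no finiteness
-- of the competing sets has to be assumed.
_≼_ : Pred (V n) 0ℓ → Pred (V n) 0ℓ → Set
ω′ ≼ ω = ∀ k → AtLeast k ω′ → AtLeast k ω

record MaximumIn (M : Pred (V n) 0ℓ) (r : V n) (ω : Pred (V n) 0ℓ) :
                 Set (lsuc 0ℓ) where
  field
    affineEquiangular : AffineEquiangular r ω
    inside            : ω ⊆ M
    maximum           : ∀ ω′ → AffineEquiangular r ω′ → ω′ ⊆ M → ω′ ≼ ω

record Enumerates (u : Fin m → V n) (ω : Pred (V n) 0ℓ) : Set where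
  field
    injective : Injective _≡_ _≡_ u
    image     : ∀ x → x ∈ ω ⇔ (∃[ i ] u i ≡ x)

------------------------------------------------------------------------
-- Matrices, polynomials and determinants

Matrix : Set a → ℕ → ℕ → Set a
Matrix R m n = Fin m → Fin n → R

_ᵀ : ∀ {R : Set a} → Matrix R m n → Matrix R n m
(M ᵀ) i j = M j i

module MatrixOps (R : RawRing a ℓ) where
  open RawRing R
  open RawSemiringDefs rawSemiring using (_^_; sum)

  infixl 7 _*ₘ_ _•ₘ_
  infixl 6 _-ₘ_

  _*ₘ_ : ∀ {l} → Matrix Carrier m n → Matrix Carrier n l → Matrix Carrier m l
  (M *ₘ N) i j = sum λ k → M i k * N k j

  _•ₘ_ : Carrier → Matrix Carrier m n → Matrix Carrier m n
  (c •ₘ M) i j = c * M i j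

  _-ₘ_ : Matrix Carrier m n → Matrix Carrier m n → Matrix Carrier m n
  (M -ₘ N) i j = M i j + - N i j

  Iₘ : Matrix Carrier n n
  Iₘ i j = if does (i ≟ j) then 1# else 0#

  -- Laplace expansion along the first row.
  det : Matrix Carrier n n → Carrier
  det {zero}  M = 1#
  det {suc n} M = sum λ j →
    (- 1#) ^ toℕ j * (M zero j * det λ i k → M (suc i) (punchIn j k))

module Polynomials (R : RawRing a ℓ) where
  private module R = RawRing R

  -- Coefficient lists, constant term first.  Trailing zeros are allowed,
  -- so polynomials are compared by _≋_ and not by _≡_.
  Poly : Set a
  Poly = List R.Carrier

  coeff : Poly → ℕ → R.Carrier
  coeff []      _       = R.0#
  coeff (c ∷ _) zero    = c
  coeff (_ ∷ p) (suc k) = coeff p k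

  infix 4 _≋_
  _≋_ : Poly → Poly → Set ℓ
  p ≋ q = ∀ k → coeff p k R.≈ coeff q k

  addP : Poly → Poly → Poly
  addP []      q       = q
  addP (c ∷ p) []      = c ∷ p
  addP (c ∷ p) (d ∷ q) = (c R.+ d) ∷ addP p q

  mulP : Poly → Poly → Poly
  mulP []      q = []
  mulP (c ∷ p) q = addP (List.map (c R.*_) q) (R.0# ∷ mulP p q)

  const : R.Carrier → Poly
  const c = c ∷ []

  X : Poly
  X = R.0# ∷ R.1# ∷ []

  polyRing : RawRing a ℓ
  polyRing = record
    { Carrier = Poly
    ; _≈_     = _≋_
    ; _+_     = addP
    ; _*_     = mulP
    ; -_      = List.map R.-_
    ; 0#      = []
    ; 1#      = const R.1#
    }

  module P = MatrixOps polyRing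

  charPoly : Matrix R.Carrier n n → Poly
  charPoly M = P.det ((X P.•ₘ P.Iₘ) P.-ₘ (λ i j → const (M i j)))

module ℚₘ = MatrixOps ℚ.+-*-rawRing

module ℚ[x] where
  open Polynomials ℚ.+-*-rawRing public
    using (Poly; coeff; _≋_; const; X; polyRing; charPoly)
  open RawRing polyRing public using (_+_; _*_; -_)
  open RawSemiringDefs (RawRing.rawSemiring polyRing) public using (_^_)

  infixl 6 _-_
  _-_ : Poly → Poly → Poly
  p - q = p + (- q)

  κ : ℕ → Poly
  κ c = const (+ c / 1)

-- With B the matrix whose columns are (2u − r)/√2 and D = √2 B, which is
-- rational, the Seidel matrix is BᵀB − 5I = ½ DᵀD − 5I.
seidel : V m → (Fin n → V m) → Matrix ℚ n n
seidel {m} {n} r u = (½ ℚₘ.•ₘ ((D ᵀ) ℚₘ.*ₘ D)) ℚₘ.-ₘ ((+ 5 / 1) ℚₘ.•ₘ ℚₘ.Iₘ)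
  where
  D : Matrix ℚ m n
  D k i = lookup ((+ 2 / 1) · u i ⊖ r) k

module Submission where

open import Algebra.Bundles using (CommutativeRing; CommutativeMonoid)
open import Algebra.Bundles.Raw using (RawRing)
import Algebra.Definitions.RawSemiring as RawSemiringDefs
open import Data.Bool.Base using (if_then_else_; true; false; Bool)
import Data.Bool.Properties as Bool
open import Data.Fin.Base as Fin using (Fin; toℕ; punchIn; _↑ˡ_; _↑ʳ_; fromℕ<; inject₁)
open import Data.Fin.Patterns
open import Data.Fin.Properties as Fin using (suc-injective; toℕ-fromℕ<)
open import Data.Fin.Subset as Subset using (Subset; ∣_∣; _∩_; ⁅_⁆)
open import Data.Integer.Base as ℤ using (ℤ; -[1+_]; 0ℤ; 1ℤ; -1ℤ)
import Data.Integer.DivMod as ℤ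
import Data.Integer.Properties as ℤ
open import Data.Integer.Tactic.RingSolver using (solve-∀)
open import Data.List.Base as List using (filter; cartesianProduct; allFin)
open import Data.List.Membership.Propositional.Properties using (∈-++⁺ˡ; ∈-++⁺ʳ; ∈-map⁺; ∈-cartesianProduct⁺)
import Data.List.Properties as List
open import Data.List.Relation.Binary.Permutation.Propositional as Perm using (_↭_)
open import Data.List.Relation.Binary.Permutation.Propositional.Properties using (↭-length)
import Data.List.Relation.Binary.Permutation.Setoid.Properties as Permₛ
open import Data.List.Relation.Unary.All as All using (All)
import Data.List.Relation.Unary.All.Properties as All
open import Data.List.Relation.Unary.AllPairs as AllPairs using (AllPairs)
import Data.List.Relation.Unary.AllPairs.Properties as AllPairs
open import Data.List.Relation.Unary.Any using (here)
import Data.List.Relation.Unary.Unique.DecPropositional as DecUnique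
open import Data.List.Relation.Unary.Unique.Propositional using (Unique)
import Data.List.Relation.Unary.Unique.Propositional.Properties as Unique
import Data.Maybe.Base as Maybe
open import Data.Nat.Base as ℕ using (ℕ; _≤_)
import Data.Nat.DivMod as ℕ
import Data.Nat.Properties as ℕ
open import Data.Product.Base using (_×_; _,_; proj₂; proj₁; ∃-syntax)
import Data.Product.Properties as Product
open import Data.Rational.Base as ℚ using (ℚ; 0ℚ; _/_; 1ℚ; ½)
import Data.Rational.Properties as ℚ
import Data.Rational.Unnormalised.Base as ℚᵘ
import Data.Rational.Unnormalised.Properties as ℚᵘ
open import Data.Sum.Base as Sum using (_⊎_; inj₁; inj₂)
open import Data.Unit.Base using (tt)
import Data.Unit.Polymorphic.Base as U
open import Data.Vec.Base as Vec using (Vec)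
import Data.Vec.Properties as Vec
open import Function.Base using (_∘_; case_of_)
open import Level using (0ℓ)
import Relation.Binary.Definitions as B
import Relation.Binary.PropositionalEquality.Core as ≡
open import Relation.Nullary.Decidable using (does; yes; no; Dec; toWitness; _×-dec_; T?; map′; _⊎-dec_; _→-dec_)
open import Relation.Nullary.Negation using (contradiction)
open import Relation.Unary using (Pred)

-- Geometry. For `u` in an affine equiangular set the vector `2u - ρ` has norm 10, and inner
-- products 0 and 1 between members become -2 and 2. Among the vectors of `L` having inner product 1
-- with `ρ`, norm 3 is the least possible (`base-minimal`), so those of norm 3 are the shortest
-- vectors of a few cosets of `Λ` and can be listed. Up to sign `2u - ρ` is one of two sorts of
-- vectors, all vanishing in the last A₁ block (`onLine`): a point, given by one index in each of
-- the three A₅ blocks, or a quad, given by a 3-subset in one A₅ block and signs in two of the first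
-- three A₁ blocks.
--
-- Combinatorics. Two points are compatible only if they agree in at most one index, so there are at
-- most 36 of them, and 36 points form a Latin square of order 6. The quads of one A₅ block are the
-- vertices of a graph on 40 vertices; an exhaustive search shows that its cliques have at most 7
-- vertices (`cliques-standard`). This bounds the set by 36 + 3 * 7 = 57, and an explicit family
-- attains the bound (`Ω-size`). Hence a maximum set consists of a full Latin square and three
-- 7-cliques.
--
-- Spectrum. All the vectors `2u - ρ` lie in the 18-dimensional span of the three A₅ blocks and the
-- first three A₁ blocks. The Seidel matrix is `FE - 5I`, where `E` lists 18 coordinates of the
-- vectors and `F` the same coordinates with weights. By `sylvester` the characteristic polynomial
-- of `FE` is that of the 18 by 18 second-moment matrix `EF` times the 39th power of the variable.
-- In a Latin square any two of the three indices are independent and uniformly distributed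
-- (`latin-sum`), so the points contribute 12 times the identity on the A₅ part. Each 7-clique has
-- an orthogonal frame of its A₅ block in which its moments are known up to one sign, its twist.
-- Added up, `EF` is block diagonal, with a scalar block 18 of size 6, a scalar block 14 of size 6,
-- and a 6 by 6 block `K₆` depending on the three twists. The shift by 5 produces the roots 13 and 9
-- of multiplicity 6 and the root -5 of multiplicity 39; `K₆ - 5I` has one of two characteristic
-- polynomials (`K₆-charPoly`), which gives the two cases.
--
-- The polynomial identity is derived from its values at the natural numbers, where `x + 5` is
-- invertible and Sylvester's identity needs no rational functions.

-- Determinants over a commutative ring, up to Sylvester's identity

module Determinant {c ℓ} (R : CommutativeRing c ℓ) where
  open import Data.Empty using (⊥-elim)
  open import Data.Fin.Base using (zero; suc; punchOut; splitAt)
  open import Data.Fin.Properties using (_≟_; punchInᵢ≢i; splitAt-↑ˡ; splitAt-↑ʳ; splitAt⁻¹-↑ˡ; splitAt⁻¹-↑ʳ; toℕ-↑ˡ; punchIn-punchOut; 0≢1+n; toℕ<n; toℕ-injective)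
  open import Data.Nat.Base using (zero; suc)
  open import Data.Sum.Base using ([_,_]′)
  open import Data.Vec.Functional using (updateAt)
  open import Data.Vec.Functional.Properties using (updateAt-updates; updateAt-minimal)
  open import Function.Base using (const)
  open import Relation.Binary.PropositionalEquality.Core using (_≡_; _≢_)
  open import Level using (_⊔_)
  open import Relation.Nullary.Decidable using (dec-true; dec-false)
  open import Defs using (Matrix; module MatrixOps)
  open CommutativeRing R hiding (zero)
  open MatrixOps rawRing
  open RawSemiringDefs (RawRing.rawSemiring rawRing) using (_^_)
  open import Algebra.Properties.Semiring.Sum semiring hiding (sum-permute)
  open import Algebra.Properties.Ring ring
  open import Algebra.Properties.CommutativeSemigroup *-commutativeSemigroup using (x∙yz≈y∙xz; interchange)
  open import Algebra.Properties.CommutativeSemigroup +-commutativeSemigroup using () renaming (interchange to +-interchange)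
  open import Relation.Binary.Reasoning.Setoid setoid

  private variable
    m n : ℕ

  infix 4 _≈ₘ_
  _≈ₘ_ : Matrix Carrier m n → Matrix Carrier m n → Set ℓ
  M ≈ₘ N = ∀ i j → M i j ≈ N i j

  sum-cong : (f g : Fin n → Carrier) → (∀ i → f i ≈ g i) → sum f ≈ sum g
  sum-cong f g = sum-cong-≋ {x = f} {y = g}

  sum-zero : (f : Fin n → Carrier) → (∀ i → f i ≈ 0#) → sum f ≈ 0#
  sum-zero {n} f f≈0 = trans (sum-cong f (λ _ → 0#) f≈0) (sum-replicate-zero n)

  sum-single : ∀ (r : Fin n) (f : Fin n → Carrier) → (∀ i → i ≢ r → f i ≈ 0#) → sum f ≈ f r
  sum-single {suc n} r f f≈0 = begin
    sum f                          ≈⟨ sum-remove {i = r} f ⟩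
    f r + sum (f ∘ punchIn r)      ≈⟨ +-congˡ (sum-zero (f ∘ punchIn r) λ i → f≈0 _ (punchInᵢ≢i r i)) ⟩
    f r + 0#                       ≈⟨ +-identityʳ _ ⟩
    f r                            ∎

  sum-↑ : ∀ m (f : Fin (m ℕ.+ n) → Carrier) → sum f ≈ sum (λ i → f (i ↑ˡ n)) + sum (λ j → f (m ↑ʳ j))
  sum-↑ zero    f = sym (+-identityˡ _)
  sum-↑ (suc m) f = trans (+-congˡ (sum-↑ m (f ∘ suc))) (sym (+-assoc _ _ _))

  Iₘ-diag : (i : Fin n) → Iₘ i i ≡ 1#
  Iₘ-diag i rewrite dec-true (i ≟ i) ≡.refl = ≡.refl

  Iₘ-off : {i j : Fin n} → i ≢ j → Iₘ i j ≡ 0#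
  Iₘ-off {i = i} {j} i≢j rewrite dec-false (i ≟ j) i≢j = ≡.refl

  sum-Iₘ : ∀ (i : Fin n) (f : Fin n → Carrier) → sum (λ k → Iₘ i k * f k) ≈ f i
  sum-Iₘ i f = begin
    sum (λ k → Iₘ i k * f k)
      ≈⟨ sum-single i (λ k → Iₘ i k * f k) (λ k k≢i → trans (*-congʳ (reflexive (Iₘ-off (k≢i ∘ ≡.sym)))) (zeroˡ _)) ⟩
    Iₘ i i * f i  ≈⟨ *-congʳ (reflexive (Iₘ-diag i)) ⟩
    1# * f i      ≈⟨ *-identityˡ _ ⟩
    f i           ∎

  sgn : Fin n → Carrier
  sgn j = (- 1#) ^ toℕ j

  minor : Matrix Carrier (suc m) (suc n) → Fin (suc n) → Matrix Carrier m n
  minor M j i k = M (suc i) (punchIn j k)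

  laplace : Matrix Carrier (suc n) (suc n) → Fin (suc n) → Carrier
  laplace M j = sgn j * (M zero j * det (minor M j))

  det-cong : {M N : Matrix Carrier n n} → M ≈ₘ N → det M ≈ det N
  det-cong {zero}  M≈N = refl
  det-cong {suc n} {M} {N} M≈N = sum-cong (laplace M) (laplace N) λ j →
    *-congˡ {sgn j} (*-cong (M≈N zero j) (det-cong λ i k → M≈N (suc i) (punchIn j k)))

  -- The first row enters the Laplace expansion linearly as it stands; a later row enters through
  -- the minors, where the recursion on `r` applies. Finite combinations of any length are allowed
  -- because `det-row` needs a combination of all the rows.
  det-linear : ∀ (r : Fin n) (C : Matrix Carrier n n) (c : Fin m → Carrier) (B : Fin m → Matrix Carrier n n) →
    (∀ k i → i ≢ r → ∀ j → B k i j ≈ C i j) → (∀ j → C r j ≈ sum λ k → c k * B k r j) →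
    det C ≈ sum λ k → c k * det (B k)
  det-linear {suc n} r C c B off at = begin
    det C
      ≈⟨ sum-cong (laplace C) _ (term r off at) ⟩
    sum (λ j → sum λ k → c k * laplace (B k) j)
      ≈⟨ ∑-comm (λ j k → c k * laplace (B k) j) ⟩
    sum (λ k → sum λ j → c k * laplace (B k) j)
      ≈⟨ sum-cong (λ k → c k * det (B k)) _ (λ k → *-distribˡ-sum (c k) (laplace (B k))) ⟨
    sum (λ k → c k * det (B k)) ∎
    where
    term : ∀ r → (∀ k i → i ≢ r → ∀ j → B k i j ≈ C i j) → (∀ j → C r j ≈ sum λ k → c k * B k r j) →
      ∀ j → laplace C j ≈ sum λ k → c k * laplace (B k) j
    term zero off at j = begin
      sgn j * (C zero j * det (minor C j))
        ≈⟨ *-congˡ (*-congʳ (at j)) ⟩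
      sgn j * (sum (λ k → c k * B k zero j) * det (minor C j))
        ≈⟨ *-congˡ (*-distribʳ-sum (det (minor C j)) λ k → c k * B k zero j) ⟩
      sgn j * sum (λ k → (c k * B k zero j) * det (minor C j))
        ≈⟨ *-distribˡ-sum (sgn j) (λ k → (c k * B k zero j) * det (minor C j)) ⟩
      sum (λ k → sgn j * ((c k * B k zero j) * det (minor C j)))
        ≈⟨ sum-cong _ _ (λ k → trans (*-congˡ (*-assoc _ _ _)) (trans (x∙yz≈y∙xz _ _ _)
             (*-congˡ (*-congˡ (*-congˡ (det-cong λ i l → sym (off k (suc i) (λ ()) (punchIn j l)))))))) ⟩
      sum (λ k → c k * laplace (B k) j) ∎
    term (suc r) off at j = begin
      sgn j * (C zero j * det (minor C j))
        ≈⟨ *-congˡ (*-congˡ (det-linear r (minor C j) c (λ k → minor (B k) j)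
             (λ k i i≢r l → off k (suc i) (i≢r ∘ suc-injective) (punchIn j l)) (at ∘ punchIn j))) ⟩
      sgn j * (C zero j * sum (λ k → c k * det (minor (B k) j)))
        ≈⟨ *-congˡ (*-distribˡ-sum (C zero j) λ k → c k * det (minor (B k) j)) ⟩
      sgn j * sum (λ k → C zero j * (c k * det (minor (B k) j)))
        ≈⟨ *-distribˡ-sum (sgn j) (λ k → C zero j * (c k * det (minor (B k) j))) ⟩
      sum (λ k → sgn j * (C zero j * (c k * det (minor (B k) j))))
        ≈⟨ sum-cong _ _ (λ k → trans (*-congˡ (trans (x∙yz≈y∙xz _ _ _) (*-congˡ (*-congʳ (sym (off k zero (λ ()) j))))))
             (x∙yz≈y∙xz _ _ _)) ⟩
      sum (λ k → c k * laplace (B k) j) ∎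

  infixl 6 _[_]≔_
  _[_]≔_ : Matrix Carrier m n → Fin m → (Fin n → Carrier) → Matrix Carrier m n
  M [ r ]≔ v = updateAt M r (const v)

  ≔-at : ∀ (M : Matrix Carrier m n) r {v} j → (M [ r ]≔ v) r j ≈ v j
  ≔-at M r j = reflexive (≡.cong (λ row → row j) (updateAt-updates r M))

  ≔-off : ∀ (M : Matrix Carrier m n) {r v} i → i ≢ r → ∀ j → (M [ r ]≔ v) i j ≈ M i j
  ≔-off M {r} i i≢r j = reflexive (≡.cong (λ row → row j) (updateAt-minimal i r M i≢r))

  det-add : ∀ (M : Matrix Carrier n n) r u v →
    det (M [ r ]≔ λ j → u j + v j) ≈ det (M [ r ]≔ u) + det (M [ r ]≔ v)
  det-add {n} M r u v = begin
    det (M [ r ]≔ λ j → u j + v j)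
      ≈⟨ det-linear {m = 2} r _ (λ _ → 1#) B off at ⟩
    1# * det (M [ r ]≔ u) + (1# * det (M [ r ]≔ v) + 0#)
      ≈⟨ +-cong (*-identityˡ _) (trans (+-identityʳ _) (*-identityˡ _)) ⟩
    det (M [ r ]≔ u) + det (M [ r ]≔ v) ∎
    where
    B : Fin 2 → Matrix Carrier n n
    B zero    = M [ r ]≔ u
    B (suc _) = M [ r ]≔ v
    off : ∀ k i → i ≢ r → ∀ j → B k i j ≈ (M [ r ]≔ λ j → u j + v j) i j
    off zero    i i≢r j = trans (≔-off M i i≢r j) (sym (≔-off M i i≢r j))
    off (suc _) i i≢r j = trans (≔-off M i i≢r j) (sym (≔-off M i i≢r j))
    at : ∀ j → (M [ r ]≔ λ j → u j + v j) r j ≈ sum λ k → 1# * B k r j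
    at j = trans (≔-at M r j) (sym (+-cong (trans (*-identityˡ _) (≔-at M r j))
      (trans (+-identityʳ _) (trans (*-identityˡ _) (≔-at M r j)))))

  -- F j k stands for the columns j and punchIn j k; the recursion pairs (j , k) with the same
  -- two columns in the other order.
  Antisymmetric : ∀ n → (Fin (suc n) → Fin n → Carrier) → Set ℓ
  Antisymmetric zero    F = U.⊤
  Antisymmetric (suc n) F =
    (∀ k → F zero k + F (suc k) zero ≈ 0#) × Antisymmetric n (λ j k → F (suc j) (suc k))

  Antisymmetric-cong : ∀ n {F G : Fin (suc n) → Fin n → Carrier} → (∀ j k → G j k ≈ F j k) →
    Antisymmetric n F → Antisymmetric n G
  Antisymmetric-cong zero    G≈F _         = _
  Antisymmetric-cong (suc n) G≈F (h , t) =
    (λ k → trans (+-cong (G≈F _ _) (G≈F _ _)) (h k)) , Antisymmetric-cong n (λ j k → G≈F _ _) t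

  sum-antisymmetric : ∀ n (F : Fin (suc n) → Fin n → Carrier) → Antisymmetric n F →
    sum (λ j → sum (F j)) ≈ 0#
  sum-antisymmetric zero    F _       = +-identityˡ 0#
  sum-antisymmetric (suc n) F (h , t) = begin
    sum (F zero) + sum (λ j → F (suc j) zero + sum (λ k → F (suc j) (suc k)))
      ≈⟨ +-congˡ (∑-distrib-+ (λ j → F (suc j) zero) (λ j → sum (λ k → F (suc j) (suc k)))) ⟩
    sum (F zero) + (sum (λ j → F (suc j) zero) + sum (λ j → sum (λ k → F (suc j) (suc k))))
      ≈⟨ +-congˡ (+-congˡ (sum-antisymmetric n (λ j k → F (suc j) (suc k)) t)) ⟩
    sum (F zero) + (sum (λ j → F (suc j) zero) + 0#)
      ≈⟨ +-congˡ (+-identityʳ _) ⟩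
    sum (F zero) + sum (λ j → F (suc j) zero)
      ≈⟨ ∑-distrib-+ (F zero) (λ k → F (suc k) zero) ⟨
    sum (λ k → F zero k + F (suc k) zero)
      ≈⟨ sum-zero (λ k → F zero k + F (suc k) zero) h ⟩
    0# ∎

  -- A term of the expansion along the first two rows when both are equal to `a`. `D` is the
  -- determinant of the other rows on a choice of columns; it is kept abstract so that the
  -- antisymmetry proof can strip off a column.
  laplace₂ : ∀ {m} (a : Fin (suc (suc m)) → Carrier) (D : (Fin m → Fin (suc (suc m))) → Carrier) →
    Fin (suc (suc m)) → Fin (suc m) → Carrier
  laplace₂ a D j k = (sgn j * sgn k) * ((a j * a (punchIn j k)) * D (punchIn j ∘ punchIn k))

  -- The terms for columns (0, k+1) and (k+1, 0) have the same product and opposite signs. The terms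
  -- avoiding column 0 are the same family for `a ∘ suc`, since moving both columns by one
  -- multiplies the sign by (-1)² = 1.
  laplace₂-antisymmetric : ∀ {m} a (D : (Fin m → Fin (suc (suc m))) → Carrier) →
    (∀ {ι κ} → (∀ x → ι x ≡ κ x) → D ι ≈ D κ) → Antisymmetric (suc m) (laplace₂ a D)
  laplace₂-antisymmetric {m} a D D-cong = pairs , rest a D D-cong
    where
    pairs : ∀ k → laplace₂ a D zero k + laplace₂ a D (suc k) zero ≈ 0#
    pairs k = begin
      (1# * sgn k) * ((a zero * a (suc k)) * D₀) + ((- 1# * sgn k) * 1#) * ((a (suc k) * a zero) * D₀)
        ≈⟨ +-cong (*-congʳ (*-identityˡ _))
             (*-cong (trans (*-identityʳ _) (-1*x≈-x _)) (*-congʳ (*-comm _ _))) ⟩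
      sgn k * X + - sgn k * X
        ≈⟨ +-congˡ (-‿distribˡ-* _ _) ⟨
      sgn k * X + - (sgn k * X)
        ≈⟨ -‿inverseʳ _ ⟩
      0# ∎
      where
      D₀ = D (suc ∘ punchIn k)
      X = (a zero * a (suc k)) * D₀
    lift : ∀ {m} → (Fin m → Fin (suc (suc m))) → Fin (suc m) → Fin (suc (suc (suc m)))
    lift ι zero    = zero
    lift ι (suc x) = suc (ι x)
    lift-punchIn : ∀ {m} (j : Fin (suc (suc m))) k x →
      punchIn (suc j) (punchIn (suc k) x) ≡ lift (punchIn j ∘ punchIn {m} k) x
    lift-punchIn j k zero    = ≡.refl
    lift-punchIn j k (suc x) = ≡.refl
    -1*-1 : ∀ x y → (- 1# * x) * (- 1# * y) ≈ x * y
    -1*-1 x y = begin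
      (- 1# * x) * (- 1# * y)  ≈⟨ *-cong (-1*x≈-x x) (-1*x≈-x y) ⟩
      - x * - y                ≈⟨ -‿distribˡ-* x (- y) ⟨
      - (x * - y)              ≈⟨ -‿cong (-‿distribʳ-* x y) ⟨
      - - (x * y)              ≈⟨ -‿involutive _ ⟩
      x * y                    ∎
    rest : ∀ {m} a (D : (Fin m → Fin (suc (suc m))) → Carrier) →
      (∀ {ι κ} → (∀ x → ι x ≡ κ x) → D ι ≈ D κ) → Antisymmetric m (λ j k → laplace₂ a D (suc j) (suc k))
    rest {zero}  a D D-cong = _
    rest {suc m} a D D-cong = Antisymmetric-cong (suc m) {laplace₂ (a ∘ suc) (D ∘ lift)}
      (λ j k → *-cong (-1*-1 (sgn j) (sgn k)) (*-congˡ {a (suc j) * a (suc (punchIn j k))} (D-cong (lift-punchIn j k))))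
      (laplace₂-antisymmetric (a ∘ suc) (D ∘ lift) λ ι≗κ → D-cong λ { zero → ≡.refl ; (suc x) → ≡.cong suc (ι≗κ x) })

  det-equal₀₁ : (M : Matrix Carrier (suc (suc n)) (suc (suc n))) →
    (∀ j → M zero j ≈ M (suc zero) j) → det M ≈ 0#
  det-equal₀₁ {n} M M₀≈M₁ = begin
    det M
      ≈⟨ sum-cong (laplace M) (λ j → sum (laplace₂ (M zero) D j)) expand ⟩
    sum (λ j → sum (laplace₂ (M zero) D j))
      ≈⟨ sum-antisymmetric (suc n) (laplace₂ (M zero) D) (laplace₂-antisymmetric (M zero) D
           λ ι≗κ → det-cong λ i x → reflexive (≡.cong (M (suc (suc i))) (ι≗κ x))) ⟩
    0# ∎
    where
    D : (Fin n → Fin (suc (suc n))) → Carrier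
    D ι = det λ i x → M (suc (suc i)) (ι x)
    expand : ∀ j → laplace M j ≈ sum (laplace₂ (M zero) D j)
    expand j = begin
      sgn j * (M zero j * sum (λ k → sgn k * (M (suc zero) (punchIn j k) * D (punchIn j ∘ punchIn k))))
        ≈⟨ *-assoc _ _ _ ⟨
      (sgn j * M zero j) * sum (λ k → sgn k * (M (suc zero) (punchIn j k) * D (punchIn j ∘ punchIn k)))
        ≈⟨ *-distribˡ-sum (sgn j * M zero j) (λ k → sgn k * (M (suc zero) (punchIn j k) * D (punchIn j ∘ punchIn k))) ⟩
      sum (λ k → (sgn j * M zero j) * (sgn k * (M (suc zero) (punchIn j k) * D (punchIn j ∘ punchIn k))))
        ≈⟨ sum-cong _ (laplace₂ (M zero) D j) (λ k → trans (interchange _ _ _ _) (*-congˡ (trans (*-congˡ (*-congʳ (sym (M₀≈M₁ _)))) (sym (*-assoc _ _ _))))) ⟩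
      sum (laplace₂ (M zero) D j) ∎

  Alternating : ℕ → Set (c ⊔ ℓ)
  Alternating n = ∀ (M : Matrix Carrier n n) p q → p ≢ q → (∀ j → M p j ≈ M q j) → det M ≈ 0#

  -- Polarization in the rows 1 and `s`: let `f u v` be the determinant after replacing them by `u`
  -- and `v`, and let `x`, `y` be the rows 0 and 1. Then `f x v` vanishes because rows 0 and 1
  -- agree, and `f u u` vanishes because every minor along row 0 has two equal rows. Expanding
  -- `f (y + x) (y + x)` leaves only `f y x`, which is `det M`.
  det-equal₀ : Alternating n → ∀ (M : Matrix Carrier (suc n) (suc n)) q →
    (∀ j → M zero j ≈ M (suc q) j) → det M ≈ 0#
  det-equal₀ alt M zero M₀≈Mq = det-equal₀₁ M M₀≈Mq
  det-equal₀ {suc n} alt M (suc q) M₀≈Mq = begin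
    det M          ≈⟨ det-cong agree ⟩
    f y x          ≈⟨ +-identityʳ _ ⟨
    f y x + 0#     ≈⟨ +-congˡ (f-repeat₀ x) ⟨
    f y x + f x x  ≈⟨ add₁ y x x ⟨
    f y+x x        ≈⟨ +-identityˡ _ ⟨
    0# + f y+x x   ≈⟨ +-congʳ (trans (add₁ y x y) (trans (+-cong (f-repeat y) (f-repeat₀ y)) (+-identityˡ 0#))) ⟨
    f y+x y + f y+x x ≈⟨ det-add (M [ suc zero ]≔ y+x) s y x ⟨
    f y+x y+x      ≈⟨ f-repeat y+x ⟩
    0#             ∎
    where
    s = suc (suc q)
    x = M zero
    y = M (suc zero)
    y+x = λ j → y j + x j
    f : (u v : Fin (suc (suc n)) → Carrier) → Carrier
    f u v = det ((M [ suc zero ]≔ u) [ s ]≔ v)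
    agree : M ≈ₘ ((M [ suc zero ]≔ y) [ s ]≔ x)
    agree i j with i ≟ s
    ... | yes ≡.refl = trans (sym (M₀≈Mq j)) (sym (≔-at (M [ suc zero ]≔ y) s j))
    ... | no i≢s with i ≟ suc zero
    ...   | yes ≡.refl = refl
    ...   | no i≢1 = sym (trans (≔-off (M [ suc zero ]≔ y) i i≢s j) (≔-off M i i≢1 j))
    f-repeat₀ : ∀ v → f x v ≈ 0#
    f-repeat₀ v = det-equal₀₁ ((M [ suc zero ]≔ x) [ s ]≔ v) λ j → refl
    f-repeat : ∀ u → f u u ≈ 0#
    f-repeat u = sum-zero (laplace ((M [ suc zero ]≔ u) [ s ]≔ u)) λ j → trans (*-congˡ {sgn j} (trans (*-congˡ
      (alt (minor ((M [ suc zero ]≔ u) [ s ]≔ u) j) zero (suc q) (λ ())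
        λ k → sym (≔-at (M [ suc zero ]≔ u) s (punchIn j k)))) (zeroʳ _))) (zeroʳ _)
    add₁ : ∀ u u′ v → f (λ j → u j + u′ j) v ≈ f u v + f u′ v
    add₁ u u′ v = trans (det-cong (commute (λ j → u j + u′ j)))
      (trans (det-add (M [ s ]≔ v) (suc zero) u u′) (sym (+-cong (det-cong (commute u)) (det-cong (commute u′)))))
      where
      commute : ∀ u → ((M [ suc zero ]≔ u) [ s ]≔ v) ≈ₘ ((M [ s ]≔ v) [ suc zero ]≔ u)
      commute u zero          j = refl
      commute u (suc zero)    j = refl
      commute u (suc (suc i)) j = refl

  det-alternating : Alternating n
  det-alternating M zero    zero    p≢q _ = ⊥-elim (p≢q ≡.refl)
  det-alternating M (suc p) (suc q) p≢q Mp≈Mq = sum-zero (laplace M) λ j →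
    trans (*-congˡ {sgn j} (trans (*-congˡ (det-alternating (minor M j) p q (p≢q ∘ ≡.cong suc) (Mp≈Mq ∘ punchIn j))) (zeroʳ _))) (zeroʳ _)
  det-alternating M zero    (suc q) p≢q Mp≈Mq = det-equal₀ det-alternating M q Mp≈Mq
  det-alternating M (suc p) zero    p≢q Mp≈Mq = det-equal₀ det-alternating M p (sym ∘ Mp≈Mq)

  -- Expanding row `r` linearly, each term with `k ≢ r` repeats row `k` and vanishes.
  det-row : ∀ (M C : Matrix Carrier n n) r (c : Fin n → Carrier) →
    (∀ i → i ≢ r → ∀ j → C i j ≈ M i j) → c r ≈ 1# → (∀ j → C r j ≈ sum λ k → c k * M k j) → det C ≈ det M
  det-row M C r c off c≈1 at = begin
    det C
      ≈⟨ det-linear r C c (λ k → M [ r ]≔ M k)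
           (λ k i i≢r j → trans (≔-off M i i≢r j) (sym (off i i≢r j)))
           (λ j → trans (at j) (sum-cong _ _ λ k → *-congˡ (sym (≔-at M r {M k} j)))) ⟩
    sum (λ k → c k * det (M [ r ]≔ M k))
      ≈⟨ sum-single r (λ k → c k * det (M [ r ]≔ M k)) (λ k k≢r → trans (*-congˡ (det-alternating (M [ r ]≔ M k) r k (k≢r ∘ ≡.sym)
           λ j → trans (≔-at M r j) (sym (≔-off M k k≢r j)))) (zeroʳ _)) ⟩
    c r * det (M [ r ]≔ M r)
      ≈⟨ *-cong c≈1 (det-cong unchanged) ⟩
    1# * det M
      ≈⟨ *-identityˡ _ ⟩
    det M ∎
    where
    unchanged : (M [ r ]≔ M r) ≈ₘ M
    unchanged i j with i ≟ r
    ... | yes ≡.refl = ≔-at M r j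
    ... | no i≢r     = ≔-off M i i≢r j

  -- Simultaneous row operations, carried out one row at a time through the matrices `H s`, whose
  -- first `s` rows are those of `C` and whose other rows are those of `M`. A row that may be added
  -- to another one is itself unchanged, so it does not matter whether it has been replaced already.
  det-rows : ∀ (T M C : Matrix Carrier n n) → C ≈ₘ (T *ₘ M) → (∀ i → T i i ≈ 1#) →
    (∀ i k → i ≢ k → T i k ≈ 0# ⊎ (∀ j → C k j ≈ M k j)) → det C ≈ det M
  det-rows {n} T M C C≈TM diag off =
    trans (det-cong λ i j → sym (H-< (toℕ<n i) j)) (steps n ℕ.≤-refl)
    where
    H : ℕ → Matrix Carrier n n
    H s i = if does (toℕ i ℕ.<? s) then C i else M i
    H-< : ∀ {s i} → toℕ i ℕ.< s → ∀ j → H s i j ≈ C i j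
    H-< {s} {i} i<s j rewrite dec-true (toℕ i ℕ.<? s) i<s = refl
    H-≮ : ∀ {s i} → toℕ i ℕ.≮ s → ∀ j → H s i j ≈ M i j
    H-≮ {s} {i} i≮s j rewrite dec-false (toℕ i ℕ.<? s) i≮s = refl
    steps : ∀ s → s ℕ.≤ n → det (H s) ≈ det M
    steps zero    _   = refl
    steps (suc s) s<n = trans (det-row (H s) (H (suc s)) r (T r) unaltered (diag r) altered) (steps s (ℕ.<⇒≤ s<n))
      where
      r = fromℕ< s<n
      r≡s : toℕ r ≡ s
      r≡s = toℕ-fromℕ< s<n
      unaltered : ∀ i → i ≢ r → ∀ j → H (suc s) i j ≈ H s i j
      unaltered i i≢r j with toℕ i ℕ.<? s
      ... | yes i<s = trans (H-< (ℕ.m≤n⇒m≤1+n i<s) j) (sym (H-< i<s j))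
      ... | no i≮s  = trans (H-≮ (λ i<1+s → i≢r (toℕ-injective
        (≡.trans (ℕ.≤-antisym (ℕ.s≤s⁻¹ i<1+s) (ℕ.≮⇒≥ i≮s)) (≡.sym r≡s)))) j) (sym (H-≮ i≮s j))
      source : ∀ k j → T r k * M k j ≈ T r k * H s k j
      source k j with r ≟ k
      ... | yes ≡.refl = *-congˡ (sym (H-≮ (λ r<s → ℕ.<-irrefl r≡s r<s) j))
      ... | no r≢k with off r k r≢k
      ...   | inj₁ T≈0 = trans (*-congʳ T≈0) (trans (zeroˡ _) (sym (trans (*-congʳ T≈0) (zeroˡ _))))
      ...   | inj₂ C≈M with toℕ k ℕ.<? s
      ...     | yes k<s = *-congˡ (trans (sym (C≈M j)) (sym (H-< k<s j)))
      ...     | no k≮s  = *-congˡ (sym (H-≮ k≮s j))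
      altered : ∀ j → H (suc s) r j ≈ sum λ k → T r k * H s k j
      altered j = trans (H-< (ℕ.≤-reflexive (≡.cong suc r≡s)) j)
        (trans (C≈TM r j) (sum-cong _ _ λ k → source k j))

  det-Iₘ : ∀ n → det (Iₘ {n}) ≈ 1#
  det-Iₘ zero    = refl
  det-Iₘ (suc n) = begin
    det (Iₘ {suc n})
      ≈⟨ sum-single {suc n} zero (laplace (Iₘ {suc n})) (λ { zero 0≢0 → ⊥-elim (0≢0 ≡.refl)
           ; (suc j) _ → trans (*-congˡ {sgn (suc j)} (zeroˡ _)) (zeroʳ _) }) ⟩
    1# * (1# * det (minor (Iₘ {suc n}) zero))
      ≈⟨ trans (*-identityˡ _) (*-identityˡ _) ⟩
    det (minor (Iₘ {suc n}) zero)
      ≈⟨ det-cong {n} (λ i j → reflexive (suc-Iₘ i j)) ⟩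
    det (Iₘ {n})
      ≈⟨ det-Iₘ n ⟩
    1# ∎
    where
    suc-Iₘ : ∀ i j → Iₘ {suc n} (suc i) (suc j) ≡ Iₘ i j
    suc-Iₘ i j with i ≟ j
    ... | yes _ = ≡.refl
    ... | no _  = ≡.refl

  det-• : ∀ a (M : Matrix Carrier n n) → det (a •ₘ M) ≈ a ^ n * det M
  det-• {zero}  a M = sym (*-identityˡ 1#)
  det-• {suc n} a M = begin
    det (a •ₘ M)
      ≈⟨ sum-cong (laplace (a •ₘ M)) (λ j → a ^ suc n * laplace M j) (λ j → begin
           sgn j * (a * M zero j * det (a •ₘ minor M j))
             ≈⟨ *-congˡ {sgn j} (*-congˡ (det-• a (minor M j))) ⟩
           sgn j * (a * M zero j * (a ^ n * det (minor M j)))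
             ≈⟨ *-congˡ {sgn j} (interchange _ _ _ _) ⟩
           sgn j * (a ^ suc n * (M zero j * det (minor M j)))
             ≈⟨ x∙yz≈y∙xz _ _ _ ⟩
           a ^ suc n * laplace M j ∎) ⟩
    sum (λ j → a ^ suc n * laplace M j)
      ≈⟨ *-distribˡ-sum (a ^ suc n) (laplace M) ⟨
    a ^ suc n * det M ∎

  punchIn-↑ˡ : ∀ (j : Fin (suc m)) n k → punchIn (j ↑ˡ n) (k ↑ˡ n) ≡ punchIn j k ↑ˡ n
  punchIn-↑ˡ zero    n k       = ≡.refl
  punchIn-↑ˡ (suc j) n zero    = ≡.refl
  punchIn-↑ˡ (suc j) n (suc k) = ≡.cong suc (punchIn-↑ˡ j n k)

  punchIn-↑ʳ : ∀ (j : Fin (suc m)) (k : Fin n) → punchIn (j ↑ˡ n) (m ↑ʳ k) ≡ suc m ↑ʳ k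
  punchIn-↑ʳ         zero    k = ≡.refl
  punchIn-↑ʳ {suc m} (suc j) k = ≡.cong suc (punchIn-↑ʳ j k)

  -- The first row vanishes on the right columns, and deleting it together with a left column leaves
  -- a matrix of the same form with the same lower right block.
  det-lowerBlock : ∀ m (M : Matrix Carrier (m ℕ.+ n) (m ℕ.+ n)) → (∀ i j → M (i ↑ˡ n) (m ↑ʳ j) ≈ 0#) →
    det M ≈ det (λ i j → M (i ↑ˡ n) (j ↑ˡ n)) * det (λ i j → M (m ↑ʳ i) (m ↑ʳ j))
  det-lowerBlock         zero    M _     = sym (*-identityˡ _)
  det-lowerBlock {n} (suc m) M upper = begin
    det M
      ≈⟨ sum-↑ (suc m) (laplace M) ⟩
    sum (λ j → laplace M (j ↑ˡ n)) + sum (λ j → laplace M (suc m ↑ʳ j))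
      ≈⟨ +-cong (sum-cong (λ j → laplace M (j ↑ˡ n)) (λ j → laplace P j * det S) left)
           (sum-zero (λ j → laplace M (suc m ↑ʳ j)) λ j → trans (*-congˡ {sgn (suc m ↑ʳ j)}
             (trans (*-congʳ (upper zero j)) (zeroˡ _))) (zeroʳ _)) ⟩
    sum (λ j → laplace P j * det S) + 0#
      ≈⟨ +-identityʳ _ ⟩
    sum (λ j → laplace P j * det S)
      ≈⟨ *-distribʳ-sum (det S) (laplace P) ⟨
    det P * det S ∎
    where
    P = λ i j → M (i ↑ˡ n) (j ↑ˡ n)
    S = λ i j → M (suc m ↑ʳ i) (suc m ↑ʳ j)
    left : ∀ j → laplace M (j ↑ˡ n) ≈ laplace P j * det S
    left j = begin
      laplace M (j ↑ˡ n)
        ≈⟨ *-cong (reflexive (≡.cong ((- 1#) ^_) (toℕ-↑ˡ j n))) (*-congˡ (begin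
             det (minor M (j ↑ˡ n))
               ≈⟨ det-lowerBlock m (minor M (j ↑ˡ n)) (λ i k →
                    trans (reflexive (≡.cong (M (suc (i ↑ˡ n))) (punchIn-↑ʳ j k))) (upper (suc i) k)) ⟩
             det (λ i k → minor M (j ↑ˡ n) (i ↑ˡ n) (k ↑ˡ n)) * det (λ i k → minor M (j ↑ˡ n) (m ↑ʳ i) (m ↑ʳ k))
               ≈⟨ *-cong (det-cong λ i k → reflexive (≡.cong (M (suc (i ↑ˡ n))) (punchIn-↑ˡ j n k)))
                    (det-cong λ i k → reflexive (≡.cong (M (suc (m ↑ʳ i))) (punchIn-↑ʳ j k))) ⟩
             det (minor P j) * det S ∎)) ⟩
      sgn j * (P zero j * (det (minor P j) * det S))
        ≈⟨ *-congˡ {sgn j} (*-assoc _ _ _) ⟨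
      sgn j * (P zero j * det (minor P j) * det S)
        ≈⟨ *-assoc _ _ _ ⟨
      laplace P j * det S ∎

  det-zeroColumn : ∀ (M : Matrix Carrier n n) c → (∀ i → M i c ≈ 0#) → det M ≈ 0#
  det-zeroColumn {suc n} M c M≈0 = sum-zero (laplace M) vanish
    where
    vanish : ∀ j → laplace M j ≈ 0#
    vanish j with j ≟ c
    ... | yes ≡.refl = trans (*-congˡ {sgn j} (trans (*-congʳ (M≈0 zero)) (zeroˡ _))) (zeroʳ _)
    ... | no j≢c     = trans (*-congˡ {sgn j} (trans (*-congˡ (det-zeroColumn (minor M j) (punchOut j≢c)
      λ i → trans (reflexive (≡.cong (M (suc i)) (punchIn-punchOut j≢c))) (M≈0 (suc i)))) (zeroʳ _))) (zeroʳ _)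

  det-upperBlock : ∀ m (M : Matrix Carrier (m ℕ.+ n) (m ℕ.+ n)) →
    (∀ i j → M (i ↑ˡ n) (j ↑ˡ n) ≈ Iₘ i j) → (∀ i j → M (m ↑ʳ i) (j ↑ˡ n) ≈ 0#) →
    det M ≈ det (λ i j → M (m ↑ʳ i) (m ↑ʳ j))
  det-upperBlock         zero    M _    _     = refl
  det-upperBlock {n} (suc m) M unit lower = begin
    det M
      ≈⟨ sum-single zero (laplace M) (λ { zero 0≢0 → ⊥-elim (0≢0 ≡.refl)
           ; (suc j) _ → trans (*-congˡ {sgn (suc j)} (trans (*-congˡ (column M unit lower j)) (zeroʳ _))) (zeroʳ _) }) ⟩
    1# * (M zero zero * det (minor M zero))
      ≈⟨ trans (*-identityˡ _) (trans (*-congʳ (unit zero zero)) (*-identityˡ _)) ⟩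
    det (minor M zero)
      ≈⟨ det-upperBlock m (minor M zero) (λ i j → trans (unit (suc i) (suc j)) (reflexive (suc-Iₘ i j))) (λ i j → lower i (suc j)) ⟩
    det (λ i j → M (suc m ↑ʳ i) (suc m ↑ʳ j)) ∎
    where
    suc-Iₘ : ∀ {m} (i j : Fin m) → Iₘ {suc m} (suc i) (suc j) ≡ Iₘ i j
    suc-Iₘ i j with i ≟ j
    ... | yes _ = ≡.refl
    ... | no _  = ≡.refl
    column : ∀ {m} (M : Matrix Carrier (suc m ℕ.+ n) (suc m ℕ.+ n)) →
      (∀ i j → M (i ↑ˡ n) (j ↑ˡ n) ≈ Iₘ i j) → (∀ i j → M (suc m ↑ʳ i) (j ↑ˡ n) ≈ 0#) →
      ∀ j → det (minor M (suc j)) ≈ 0#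
    column {m} M unit lower j = det-zeroColumn (minor M (suc j)) (punchOut (0≢1+n ∘ ≡.sym))
      λ i → trans (reflexive (≡.cong (M (suc i)) (punchIn-punchOut {i = suc j} (0≢1+n ∘ ≡.sym)))) (first i)
      where
      first : ∀ i → M (suc i) zero ≈ 0#
      first i with splitAt m i in eq
      ... | inj₁ k = trans (reflexive (≡.cong (λ i → M (suc i) zero) (≡.sym (splitAt⁻¹-↑ˡ eq)))) (unit (suc k) zero)
      ... | inj₂ k = trans (reflexive (≡.cong (λ i → M (suc i) zero) (≡.sym (splitAt⁻¹-↑ʳ eq)))) (lower k zero)

  block : Matrix Carrier m m → Matrix Carrier m n → Matrix Carrier n m → Matrix Carrier n n →
    Matrix Carrier (m ℕ.+ n) (m ℕ.+ n)
  block {m} P Q S T i j =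
    [ (λ i → [ P i , Q i ]′ (splitAt m j)) , (λ i → [ S i , T i ]′ (splitAt m j)) ]′ (splitAt m i)

  module _ (P : Matrix Carrier m m) (Q : Matrix Carrier m n) (S : Matrix Carrier n m) (T : Matrix Carrier n n) where
    block-ˡˡ : ∀ i j → block P Q S T (i ↑ˡ n) (j ↑ˡ n) ≡ P i j
    block-ˡˡ i j rewrite splitAt-↑ˡ m i n | splitAt-↑ˡ m j n = ≡.refl
    block-ˡʳ : ∀ i j → block P Q S T (i ↑ˡ n) (m ↑ʳ j) ≡ Q i j
    block-ˡʳ i j rewrite splitAt-↑ˡ m i n | splitAt-↑ʳ m n j = ≡.refl
    block-ʳˡ : ∀ i j → block P Q S T (m ↑ʳ i) (j ↑ˡ n) ≡ S i j
    block-ʳˡ i j rewrite splitAt-↑ʳ m n i | splitAt-↑ˡ m j n = ≡.refl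
    block-ʳʳ : ∀ i j → block P Q S T (m ↑ʳ i) (m ↑ʳ j) ≡ T i j
    block-ʳʳ i j rewrite splitAt-↑ʳ m n i | splitAt-↑ʳ m n j = ≡.refl

  ↑-elim : ∀ m {p} (P : Fin (m ℕ.+ n) → Set p) → (∀ i → P (i ↑ˡ n)) → (∀ i → P (m ↑ʳ i)) → ∀ i → P i
  ↑-elim m P l r i with splitAt m i in eq
  ... | inj₁ k = ≡.subst P (splitAt⁻¹-↑ˡ eq) (l k)
  ... | inj₂ k = ≡.subst P (splitAt⁻¹-↑ʳ eq) (r k)

  block-mult : ∀ {P P′ : Matrix Carrier m m} {Q Q′ : Matrix Carrier m n} {S S′ : Matrix Carrier n m} {T T′ : Matrix Carrier n n}
    {P″ Q″ S″ T″} →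
    (∀ i j → P″ i j ≈ (P *ₘ P′) i j + (Q *ₘ S′) i j) → (∀ i j → Q″ i j ≈ (P *ₘ Q′) i j + (Q *ₘ T′) i j) →
    (∀ i j → S″ i j ≈ (S *ₘ P′) i j + (T *ₘ S′) i j) → (∀ i j → T″ i j ≈ (S *ₘ Q′) i j + (T *ₘ T′) i j) →
    block P″ Q″ S″ T″ ≈ₘ block P Q S T *ₘ block P′ Q′ S′ T′
  block-mult {m} {n} {P} {P′} {Q} {Q′} {S} {S′} {T} {T′} {P″} {Q″} {S″} {T″} p q s t =
    ↑-elim m _
      (λ i → ↑-elim m _
        (λ j → entry (i ↑ˡ n) (j ↑ˡ n) (block-ˡˡ P″ Q″ S″ T″ i j) (p i j)
           (λ k → *-cong (reflexive (block-ˡˡ P Q S T i k)) (reflexive (block-ˡˡ P′ Q′ S′ T′ k j)))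
           (λ k → *-cong (reflexive (block-ˡʳ P Q S T i k)) (reflexive (block-ʳˡ P′ Q′ S′ T′ k j))))
        (λ j → entry (i ↑ˡ n) (m ↑ʳ j) (block-ˡʳ P″ Q″ S″ T″ i j) (q i j)
           (λ k → *-cong (reflexive (block-ˡˡ P Q S T i k)) (reflexive (block-ˡʳ P′ Q′ S′ T′ k j)))
           (λ k → *-cong (reflexive (block-ˡʳ P Q S T i k)) (reflexive (block-ʳʳ P′ Q′ S′ T′ k j)))))
      (λ i → ↑-elim m _
        (λ j → entry (m ↑ʳ i) (j ↑ˡ n) (block-ʳˡ P″ Q″ S″ T″ i j) (s i j)
           (λ k → *-cong (reflexive (block-ʳˡ P Q S T i k)) (reflexive (block-ˡˡ P′ Q′ S′ T′ k j)))
           (λ k → *-cong (reflexive (block-ʳʳ P Q S T i k)) (reflexive (block-ʳˡ P′ Q′ S′ T′ k j))))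
        (λ j → entry (m ↑ʳ i) (m ↑ʳ j) (block-ʳʳ P″ Q″ S″ T″ i j) (t i j)
           (λ k → *-cong (reflexive (block-ʳˡ P Q S T i k)) (reflexive (block-ˡʳ P′ Q′ S′ T′ k j)))
           (λ k → *-cong (reflexive (block-ʳʳ P Q S T i k)) (reflexive (block-ʳʳ P′ Q′ S′ T′ k j)))))
    where
    M = block P Q S T
    N = block P′ Q′ S′ T′
    entry : ∀ i j {x} {f : Fin m → Carrier} {g : Fin n → Carrier} → block P″ Q″ S″ T″ i j ≡ x → x ≈ sum f + sum g →
      (∀ k → M i (k ↑ˡ n) * N (k ↑ˡ n) j ≈ f k) → (∀ k → M i (m ↑ʳ k) * N (m ↑ʳ k) j ≈ g k) →
      block P″ Q″ S″ T″ i j ≈ (M *ₘ N) i j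
    entry i j {x} {f} {g} ij≡x x≈ f≈ g≈ = begin
      block P″ Q″ S″ T″ i j  ≡⟨ ij≡x ⟩
      x                      ≈⟨ x≈ ⟩
      sum f + sum g          ≈⟨ +-cong (sum-cong _ f f≈) (sum-cong _ g g≈) ⟨
      _                      ≈⟨ sum-↑ m (λ k → M i k * N k j) ⟨
      (M *ₘ N) i j           ∎

  0ₘ : Matrix Carrier m n
  0ₘ _ _ = 0#

  0ₘ-*ˡ : ∀ {l} (M : Matrix Carrier n l) i j → (0ₘ {m} *ₘ M) i j ≈ 0#
  0ₘ-*ˡ M i j = sum-zero (λ k → 0# * M k j) λ k → zeroˡ _

  Iₘ-sym : ∀ (i j : Fin n) → Iₘ i j ≡ Iₘ j i
  Iₘ-sym i j with i ≟ j
  ... | yes ≡.refl = ≡.sym (Iₘ-diag i)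
  ... | no i≢j     = ≡.sym (Iₘ-off (i≢j ∘ ≡.sym))

  Iₘ-*ˡ : ∀ (M : Matrix Carrier m n) i j → (Iₘ *ₘ M) i j ≈ M i j
  Iₘ-*ˡ M i j = sum-Iₘ i λ k → M k j

  Iₘ-*ʳ : ∀ (M : Matrix Carrier m n) i j → (M *ₘ Iₘ) i j ≈ M i j
  Iₘ-*ʳ M i j = trans (sum-cong (λ k → M i k * Iₘ k j) (λ k → Iₘ j k * M i k)
    (λ k → trans (*-comm _ _) (*-congʳ (reflexive (Iₘ-sym k j))))) (sum-Iₘ j (M i))

  *ₘ-• : ∀ {l} a (M : Matrix Carrier m n) (N : Matrix Carrier n l) i j → (M *ₘ (a •ₘ N)) i j ≈ a * (M *ₘ N) i j
  *ₘ-• a M N i j = trans (sum-cong _ (λ k → a * (M i k * N k j)) (λ k → x∙yz≈y∙xz _ _ _))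
    (sym (*-distribˡ-sum a λ k → M i k * N k j))

  •-*ₘ : ∀ {l} a (M : Matrix Carrier m n) (N : Matrix Carrier n l) i j → ((a •ₘ M) *ₘ N) i j ≈ a * (M *ₘ N) i j
  •-*ₘ a M N i j = trans (sum-cong _ (λ k → a * (M i k * N k j)) (λ k → *-assoc _ _ _))
    (sym (*-distribˡ-sum a λ k → M i k * N k j))

  neg-*ₘ : ∀ {l} (M : Matrix Carrier m n) (N : Matrix Carrier n l) i j →
    ((λ i k → - M i k) *ₘ N) i j ≈ - (M *ₘ N) i j
  neg-*ₘ M N i j = begin
    sum (λ k → - M i k * N k j)
      ≈⟨ sum-cong _ (λ k → - 1# * (M i k * N k j)) (λ k → trans (sym (-‿distribˡ-* _ _)) (sym (-1*x≈-x _))) ⟩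
    sum (λ k → - 1# * (M i k * N k j))
      ≈⟨ *-distribˡ-sum (- 1#) (λ k → M i k * N k j) ⟨
    - 1# * (M *ₘ N) i j
      ≈⟨ -1*x≈-x _ ⟩
    - (M *ₘ N) i j ∎

  -- Sylvester's identity: eliminate the block matrix [[1, E], [F, y]] by rows in the two possible ways.
  sylvester : ∀ {m n} (E : Matrix Carrier m n) (F : Matrix Carrier n m) y y⁻¹ → y⁻¹ * y ≈ 1# →
    det ((y •ₘ Iₘ) -ₘ (F *ₘ E)) ≈ y ^ n * det (Iₘ -ₘ (y⁻¹ •ₘ (E *ₘ F)))
  sylvester {m} {n} E F y y⁻¹ y⁻¹y≈1 = begin
    det ((y •ₘ Iₘ) -ₘ (F *ₘ E))
      ≈⟨ det-cong (λ i j → reflexive (block-ʳʳ Iₘ E 0ₘ S i j)) ⟨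
    det (λ i j → block Iₘ E 0ₘ S (m ↑ʳ i) (m ↑ʳ j))
      ≈⟨ det-upperBlock m (block Iₘ E 0ₘ S)
           (λ i j → reflexive (block-ˡˡ Iₘ E 0ₘ S i j)) (λ i j → reflexive (block-ʳˡ Iₘ E 0ₘ S i j)) ⟨
    det (block Iₘ E 0ₘ S)
      ≈⟨ det-rows (block Iₘ 0ₘ -F Iₘ) N (block Iₘ E 0ₘ S)
           (block-mult
             (λ i j → sym (trans (+-cong (Iₘ-*ˡ Iₘ i j) (0ₘ-*ˡ F i j)) (+-identityʳ _)))
             (λ i j → sym (trans (+-cong (Iₘ-*ˡ E i j) (0ₘ-*ˡ (y •ₘ Iₘ) i j)) (+-identityʳ _)))
             (λ i j → sym (trans (+-cong (Iₘ-*ʳ -F i j) (Iₘ-*ˡ F i j)) (-‿inverseˡ _)))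
             (λ i j → sym (trans (+-cong (neg-*ₘ F E i j) (Iₘ-*ˡ (y •ₘ Iₘ) i j)) (+-comm _ _))))
           diag
           (↑-elim m _
             (λ i → ↑-elim m _ (λ k i≢k → inj₁ (unitˡ i k i≢k))
               (λ k _ → inj₁ (reflexive (block-ˡʳ Iₘ 0ₘ -F Iₘ i k))))
             (λ i → ↑-elim m _ (λ k _ → inj₂ λ j → reflexive (block-rowˡ {Iₘ} {E} k j))
               (λ k i≢k → inj₁ (unitʳ i k i≢k)))) ⟩
    det N
      ≈⟨ det-rows (block Iₘ -E 0ₘ Iₘ) N (block P 0ₘ F (y •ₘ Iₘ))
           (block-mult
             (λ i j → sym (+-cong (Iₘ-*ˡ Iₘ i j) (trans (neg-*ₘ (y⁻¹ •ₘ E) F i j) (-‿cong (•-*ₘ y⁻¹ E F i j)))))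
             (λ i j → sym (trans (+-cong (Iₘ-*ˡ E i j) (cancel i j)) (-‿inverseʳ _)))
             (λ i j → sym (trans (+-cong (0ₘ-*ˡ Iₘ i j) (Iₘ-*ˡ F i j)) (+-identityˡ _)))
             (λ i j → sym (trans (+-cong (0ₘ-*ˡ E i j) (Iₘ-*ˡ (y •ₘ Iₘ) i j)) (+-identityˡ _))))
           diag
           (↑-elim m _
             (λ i → ↑-elim m _ (λ k i≢k → inj₁ (unitˡ i k i≢k))
               (λ k _ → inj₂ λ j → reflexive (block-rowʳ {S = F} {y •ₘ Iₘ} k j)))
             (λ i → ↑-elim m _ (λ k _ → inj₁ (reflexive (block-ʳˡ Iₘ -E 0ₘ Iₘ i k)))
               (λ k i≢k → inj₁ (unitʳ i k i≢k)))) ⟨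
    det (block P 0ₘ F (y •ₘ Iₘ))
      ≈⟨ det-lowerBlock m (block P 0ₘ F (y •ₘ Iₘ)) (λ i j → reflexive (block-ˡʳ P 0ₘ F (y •ₘ Iₘ) i j)) ⟩
    _ ≈⟨ *-cong (det-cong {m} λ i j → reflexive (block-ˡˡ P 0ₘ F (y •ₘ Iₘ) i j)) (det-cong {n} λ i j → reflexive (block-ʳʳ P 0ₘ F (y •ₘ Iₘ) i j)) ⟩
    det (Iₘ -ₘ (y⁻¹ •ₘ (E *ₘ F))) * det (y •ₘ Iₘ {n})
      ≈⟨ *-congˡ (trans (det-• y (Iₘ {n})) (trans (*-congˡ (det-Iₘ n)) (*-identityʳ _))) ⟩
    det (Iₘ -ₘ (y⁻¹ •ₘ (E *ₘ F))) * y ^ n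
      ≈⟨ *-comm _ _ ⟩
    y ^ n * det (Iₘ -ₘ (y⁻¹ •ₘ (E *ₘ F))) ∎
    where
    N = block Iₘ E F (y •ₘ Iₘ)
    S = (y •ₘ Iₘ) -ₘ (F *ₘ E)
    P = Iₘ -ₘ (y⁻¹ •ₘ (E *ₘ F))
    -F : Matrix Carrier n m
    -F i k = - F i k
    -E : Matrix Carrier m n
    -E i k = - (y⁻¹ * E i k)
    unitˡ : ∀ {A : Matrix Carrier m n} {B} i k → i ↑ˡ n ≢ k ↑ˡ n → block Iₘ A B Iₘ (i ↑ˡ n) (k ↑ˡ n) ≈ 0#
    unitˡ {A} {B} i k i≢k = reflexive (≡.trans (block-ˡˡ Iₘ A B Iₘ i k) (Iₘ-off (i≢k ∘ ≡.cong (_↑ˡ n))))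
    unitʳ : ∀ {A : Matrix Carrier m n} {B} i k → m ↑ʳ i ≢ m ↑ʳ k → block Iₘ A B Iₘ (m ↑ʳ i) (m ↑ʳ k) ≈ 0#
    unitʳ {A} {B} i k i≢k = reflexive (≡.trans (block-ʳʳ Iₘ A B Iₘ i k) (Iₘ-off (i≢k ∘ ≡.cong (m ↑ʳ_))))
    diag : ∀ {A : Matrix Carrier m n} {B} i → block Iₘ A B Iₘ i i ≈ 1#
    diag {A} {B} = ↑-elim m _
      (λ i → reflexive (≡.trans (block-ˡˡ Iₘ A B Iₘ i i) (Iₘ-diag i)))
      (λ i → reflexive (≡.trans (block-ʳʳ Iₘ A B Iₘ i i) (Iₘ-diag i)))
    block-rowˡ : ∀ {P : Matrix Carrier m m} {Q : Matrix Carrier m n} {S S′ T T′} (k : Fin m) j → block P Q S T (k ↑ˡ n) j ≡ block P Q S′ T′ (k ↑ˡ n) j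
    block-rowˡ k j rewrite splitAt-↑ˡ m k n = ≡.refl
    block-rowʳ : ∀ {P P′ Q Q′} {S : Matrix Carrier n m} {T : Matrix Carrier n n} (k : Fin n) j → block P Q S T (m ↑ʳ k) j ≡ block P′ Q′ S T (m ↑ʳ k) j
    block-rowʳ k j rewrite splitAt-↑ʳ m n k = ≡.refl
    cancel : ∀ i j → (-E *ₘ (y •ₘ Iₘ)) i j ≈ - E i j
    cancel i j = begin
      (-E *ₘ (y •ₘ Iₘ)) i j    ≈⟨ *ₘ-• y -E Iₘ i j ⟩
      y * (-E *ₘ Iₘ) i j       ≈⟨ *-congˡ (Iₘ-*ʳ -E i j) ⟩
      y * - (y⁻¹ * E i j)      ≈⟨ -‿distribʳ-* _ _ ⟨
      - (y * (y⁻¹ * E i j))    ≈⟨ -‿cong (*-assoc _ _ _) ⟨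
      - (y * y⁻¹ * E i j)      ≈⟨ -‿cong (*-congʳ (trans (*-comm _ _) y⁻¹y≈1)) ⟩
      - (1# * E i j)           ≈⟨ -‿cong (*-identityˡ _) ⟩
      - E i j                  ∎

-- Evaluation of polynomials, and equality from infinitely many values

module Evaluation {c ℓ} (R : CommutativeRing c ℓ) where
  open import Data.Fin.Base using (zero; suc)
  open import Data.Fin.Properties using (_≟_)
  open import Data.List.Base using (List; []; _∷_; length)
  open import Data.Nat.Base using (zero; suc)
  open import Function.Base using (const)
  open import Defs using (Matrix; module MatrixOps; module Polynomials)
  open CommutativeRing R hiding (zero)
  open Polynomials rawRing renaming (const to constP)
  open RawRing polyRing using () renaming (_+_ to _⊞_; _*_ to _⊠_; -_ to ⊟_; 0# to 0P; 1# to 1P)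
  open RawSemiringDefs (RawRing.rawSemiring rawRing) using (_^_; sum)
  open RawSemiringDefs (RawRing.rawSemiring polyRing) using () renaming (_^_ to _^P_; sum to sumP)
  open import Algebra.Properties.Ring ring
  open import Algebra.Properties.CommutativeSemigroup *-commutativeSemigroup using (x∙yz≈y∙xz)
  open import Algebra.Properties.CommutativeSemigroup +-commutativeSemigroup using () renaming (interchange to +-interchange)
  open import Relation.Binary.Reasoning.Setoid setoid
  open Determinant R using (det-cong)
  private module M = MatrixOps rawRing

  private variable
    n : ℕ

  eval : Poly → Carrier → Carrier
  eval []      x = 0#
  eval (a ∷ p) x = a + x * eval p x

  module _ (x : Carrier) where
    eval-+ : ∀ p q → eval (p ⊞ q) x ≈ eval p x + eval q x
    eval-+ []      q       = sym (+-identityˡ _)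
    eval-+ (a ∷ p) []      = sym (+-identityʳ _)
    eval-+ (a ∷ p) (b ∷ q) = begin
      a + b + x * eval (p ⊞ q) x              ≈⟨ +-congˡ (*-congˡ (eval-+ p q)) ⟩
      a + b + x * (eval p x + eval q x)       ≈⟨ +-congˡ (distribˡ _ _ _) ⟩
      a + b + (x * eval p x + x * eval q x)   ≈⟨ +-interchange _ _ _ _ ⟩
      (a + x * eval p x) + (b + x * eval q x) ∎

    eval-scale : ∀ a p → eval (List.map (a *_) p) x ≈ a * eval p x
    eval-scale a []      = sym (zeroʳ a)
    eval-scale a (b ∷ p) = begin
      a * b + x * eval (List.map (a *_) p) x  ≈⟨ +-congˡ (*-congˡ (eval-scale a p)) ⟩
      a * b + x * (a * eval p x)              ≈⟨ +-congˡ (x∙yz≈y∙xz _ _ _) ⟩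
      a * b + a * (x * eval p x)              ≈⟨ distribˡ _ _ _ ⟨
      a * (b + x * eval p x)                  ∎

    eval-* : ∀ p q → eval (p ⊠ q) x ≈ eval p x * eval q x
    eval-* []      q = sym (zeroˡ _)
    eval-* (a ∷ p) q = begin
      eval (List.map (a *_) q ⊞ (0# ∷ p ⊠ q)) x
        ≈⟨ eval-+ (List.map (a *_) q) _ ⟩
      eval (List.map (a *_) q) x + (0# + x * eval (p ⊠ q) x)
        ≈⟨ +-cong (eval-scale a q) (trans (+-identityˡ _) (*-congˡ (eval-* p q))) ⟩
      a * eval q x + x * (eval p x * eval q x)
        ≈⟨ +-congˡ (*-assoc _ _ _) ⟨
      a * eval q x + x * eval p x * eval q x
        ≈⟨ distribʳ _ _ _ ⟨
      (a + x * eval p x) * eval q x ∎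

    eval-neg : ∀ p → eval (⊟ p) x ≈ - eval p x
    eval-neg []      = sym -0#≈0#
    eval-neg (a ∷ p) = begin
      - a + x * eval (⊟ p) x   ≈⟨ +-congˡ (*-congˡ (eval-neg p)) ⟩
      - a + x * - eval p x     ≈⟨ +-congˡ (-‿distribʳ-* _ _) ⟨
      - a + - (x * eval p x)   ≈⟨ -‿+-comm _ _ ⟩
      - (a + x * eval p x)     ∎

    eval-const : ∀ a → eval (constP a) x ≈ a
    eval-const a = trans (+-congˡ (zeroʳ x)) (+-identityʳ a)

    eval-X : eval X x ≈ x
    eval-X = trans (+-identityˡ _) (trans (*-congˡ (eval-const 1#)) (*-identityʳ x))

    eval-^ : ∀ p k → eval (p ^P k) x ≈ eval p x ^ k
    eval-^ p zero    = eval-const 1#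
    eval-^ p (suc k) = trans (eval-* p (p ^P k)) (*-congˡ (eval-^ p k))

    eval-sum : (f : Fin n → Poly) → eval (sumP f) x ≈ sum (λ i → eval (f i) x)
    eval-sum {zero}  f = refl
    eval-sum {suc n} f = trans (eval-+ (f zero) _) (+-congˡ (eval-sum (f ∘ suc)))

    eval-det : (M : Matrix Poly n n) → eval (P.det M) x ≈ M.det (λ i j → eval (M i j) x)
    eval-det {zero}  M = eval-const 1#
    eval-det {suc n} M = trans (eval-sum terms) (Determinant.sum-cong R (λ j → eval (terms j) x) _ λ j → begin
      eval (((⊟ 1P) ^P toℕ j) ⊠ (M zero j ⊠ P.det (λ i k → M (suc i) (punchIn j k)))) x
        ≈⟨ eval-* ((⊟ 1P) ^P toℕ j) _ ⟩
      eval ((⊟ 1P) ^P toℕ j) x * eval (M zero j ⊠ P.det (λ i k → M (suc i) (punchIn j k))) x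
        ≈⟨ *-cong (trans (eval-^ (⊟ 1P) (toℕ j)) (^-cong (toℕ j) (eval-const (- 1#))))
             (trans (eval-* (M zero j) _) (*-congˡ (eval-det λ i k → M (suc i) (punchIn j k)))) ⟩
      _ ∎)
      where
      terms : Fin (suc n) → Poly
      terms j = ((⊟ 1P) ^P toℕ j) ⊠ (M zero j ⊠ P.det (λ i k → M (suc i) (punchIn j k)))
      ^-cong : ∀ {a b} k → a ≈ b → a ^ k ≈ b ^ k
      ^-cong zero    a≈b = refl
      ^-cong (suc k) a≈b = *-cong a≈b (^-cong k a≈b)

    eval-charPoly : (S : Matrix Carrier n n) → eval (charPoly S) x ≈ M.det ((x M.•ₘ M.Iₘ) M.-ₘ S)
    eval-charPoly {n} S = trans (eval-det {n} ((X P.•ₘ P.Iₘ) P.-ₘ (λ i j → constP (S i j)))) (det-cong entry)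
      where
      eval-I : ∀ i j → eval (P.Iₘ {n} i j) x ≈ M.Iₘ i j
      eval-I i j with i ≟ j
      ... | yes _ = eval-const 1#
      ... | no _  = refl
      entry : ∀ i j → eval ((X ⊠ P.Iₘ i j) ⊞ (⊟ constP (S i j))) x ≈ x * M.Iₘ i j + - S i j
      entry i j = trans (eval-+ (X ⊠ P.Iₘ i j) _) (+-cong
        (trans (eval-* X (P.Iₘ i j)) (*-cong eval-X (eval-I i j))) (eval-const (- S i j)))

  coeff-+ : ∀ p q k → coeff (p ⊞ q) k ≈ coeff p k + coeff q k
  coeff-+ []      q       k       = sym (+-identityˡ _)
  coeff-+ (a ∷ p) []      k       = sym (+-identityʳ _)
  coeff-+ (a ∷ p) (b ∷ q) zero    = refl
  coeff-+ (a ∷ p) (b ∷ q) (suc k) = coeff-+ p q k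

  coeff-scale : ∀ a p k → coeff (List.map (a *_) p) k ≈ a * coeff p k
  coeff-scale a []      k       = sym (zeroʳ a)
  coeff-scale a (b ∷ p) zero    = refl
  coeff-scale a (b ∷ p) (suc k) = coeff-scale a p k

  coeff-neg : ∀ p k → coeff (⊟ p) k ≈ - coeff p k
  coeff-neg []      k       = sym -0#≈0#
  coeff-neg (b ∷ p) zero    = refl
  coeff-neg (b ∷ p) (suc k) = coeff-neg p k

  ≋0⇒eval≈0 : ∀ p x → p ≋ [] → eval p x ≈ 0#
  ≋0⇒eval≈0 []      x p≋0 = refl
  ≋0⇒eval≈0 (a ∷ p) x p≋0 = trans (+-cong (p≋0 0) (trans (*-congˡ (≋0⇒eval≈0 p x (p≋0 ∘ suc))) (zeroʳ x))) (+-identityˡ _)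

  -- The quotient of p by X - a.
  quot : Poly → Carrier → Poly
  quot []      a = []
  quot (b ∷ p) a = p ⊞ List.map (a *_) (quot p a)

  eval-quot : ∀ p a x → eval p x - eval p a ≈ (x - a) * eval (quot p a) x
  eval-quot []      a x = trans (-‿inverseʳ 0#) (sym (zeroʳ _))
  eval-quot (b ∷ p) a x = begin
    (b + x * u) - (b + a * v)
      ≈⟨ +-congˡ (-‿+-comm _ _) ⟨
    (b + x * u) + (- b - a * v)
      ≈⟨ +-interchange _ _ _ _ ⟩
    (b - b) + (x * u - a * v)
      ≈⟨ trans (+-congʳ (-‿inverseʳ b)) (+-identityˡ _) ⟩
    x * u - a * v
      ≈⟨ +-congʳ (+-identityʳ _) ⟨
    x * u + 0# - a * v
      ≈⟨ +-congʳ (+-congˡ (-‿inverseˡ (a * u))) ⟨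
    x * u + (- (a * u) + a * u) - a * v
      ≈⟨ trans (+-congʳ (sym (+-assoc _ _ _))) (+-assoc _ _ _) ⟩
    (x * u - a * u) + (a * u - a * v)
      ≈⟨ +-cong ([y-z]x≈yx-zx u x a) (x[y-z]≈xy-xz a u v) ⟨
    (x - a) * u + a * (u - v)
      ≈⟨ +-congˡ (trans (*-congˡ (eval-quot p a x)) (x∙yz≈y∙xz _ _ _)) ⟩
    (x - a) * u + (x - a) * (a * eval (quot p a) x)
      ≈⟨ distribˡ _ _ _ ⟨
    (x - a) * (u + a * eval (quot p a) x)
      ≈⟨ *-congˡ (trans (eval-+ x p _) (+-congˡ (eval-scale x a (quot p a)))) ⟨
    (x - a) * eval (quot (b ∷ p) a) x ∎
    where
    u = eval p x
    v = eval p a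

  -- Horner's recursion between the coefficients of `p` and of its quotient. In `vanish` it shows
  -- that a zero quotient leaves only the constant term.
  coeff-quot : ∀ p a k → coeff (quot p a) k ≈ coeff p (suc k) + a * coeff (quot p a) (suc k)
  coeff-quot []      a k = sym (trans (+-identityˡ _) (zeroʳ a))
  coeff-quot (b ∷ p) a k = begin
    coeff (quot (b ∷ p) a) k
      ≈⟨ coeff-+ p _ k ⟩
    coeff p k + coeff (List.map (a *_) (quot p a)) k
      ≈⟨ +-congˡ (coeff-scale a (quot p a) k) ⟩
    coeff p k + a * coeff (quot p a) k
      ≈⟨ +-congˡ (*-congˡ (coeff-quot p a k)) ⟩
    coeff p k + a * (coeff p (suc k) + a * coeff (quot p a) (suc k))
      ≈⟨ +-congˡ (*-congˡ (trans (coeff-+ p _ (suc k)) (+-congˡ (coeff-scale a (quot p a) (suc k))))) ⟨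
    coeff p k + a * coeff (quot (b ∷ p) a) (suc k) ∎

  length-+ : ∀ p q d → length p ℕ.≤ d → length q ℕ.≤ d → length (p ⊞ q) ℕ.≤ d
  length-+ []      q       d       p≤d q≤d = q≤d
  length-+ (a ∷ p) []      d       p≤d q≤d = p≤d
  length-+ (a ∷ p) (b ∷ q) (suc d) p≤d q≤d = ℕ.s≤s (length-+ p q d (ℕ.s≤s⁻¹ p≤d) (ℕ.s≤s⁻¹ q≤d))

  length-quot : ∀ p a → length (quot p a) ℕ.≤ ℕ.pred (length p)
  length-quot []      a = ℕ.z≤n
  length-quot (b ∷ p) a = length-+ p _ _ ℕ.≤-refl (ℕ.≤-trans
    (ℕ.≤-reflexive (List.length-map (a *_) (quot p a))) (ℕ.≤-trans (length-quot p a) (ℕ.pred[n]≤n)))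

  module _ (a : ℕ → Carrier) (separated : ∀ {j k} z → j ℕ.< k → (a k - a j) * z ≈ 0# → z ≈ 0#) where
    -- Root counting, by induction on a bound `d` for the length. Division by `X - a N` leaves a
    -- quotient that vanishes at all later sample points, because `separated` makes their
    -- differences from `a N` cancellable. The quotient is therefore zero, hence so are the
    -- coefficients of `p`, and the value at `a N` then kills the constant term.
    vanish : ∀ d p → length p ℕ.≤ d → ∀ N → (∀ k → N ℕ.≤ k → eval p (a k) ≈ 0#) → p ≋ []
    vanish d       []      _    N p≈0 k = refl
    vanish (suc d) (b ∷ p) p≤d N p≈0 = b∷p≋0
      where
      q = quot (b ∷ p) (a N)
      q≋0 : q ≋ []
      q≋0 = vanish d q (ℕ.≤-trans (length-quot (b ∷ p) (a N)) (ℕ.s≤s⁻¹ p≤d)) (suc N) λ k N<k →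
        separated _ N<k (trans (sym (eval-quot (b ∷ p) (a N) (a k)))
          (trans (+-cong (p≈0 k (ℕ.<⇒≤ N<k)) (-‿cong (p≈0 N ℕ.≤-refl))) (-‿inverseʳ 0#)))
      p≋0 : p ≋ []
      p≋0 k = begin
        coeff p k                                 ≈⟨ +-identityʳ _ ⟨
        coeff p k + 0#                            ≈⟨ +-congˡ (trans (*-congˡ (q≋0 (suc k))) (zeroʳ _)) ⟨
        coeff p k + a N * coeff q (suc k)         ≈⟨ coeff-quot (b ∷ p) (a N) k ⟨
        coeff q k                                 ≈⟨ q≋0 k ⟩
        0#                                        ∎
      b∷p≋0 : (b ∷ p) ≋ []
      b∷p≋0 zero    = trans (sym (trans (+-congˡ (trans (*-congˡ (≋0⇒eval≈0 p (a N) p≋0)) (zeroʳ _))) (+-identityʳ b))) (p≈0 N ℕ.≤-refl)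
      b∷p≋0 (suc k) = p≋0 k

    eval-injective : ∀ p q → (∀ k → eval p (a k) ≈ eval q (a k)) → p ≋ q
    eval-injective p q p≈q k = x∙y⁻¹≈ε⇒x≈y _ _ (begin
      coeff p k - coeff q k      ≈⟨ +-congˡ (coeff-neg q k) ⟨
      coeff p k + coeff (⊟ q) k  ≈⟨ coeff-+ p (⊟ q) k ⟨
      coeff (p ⊞ (⊟ q)) k        ≈⟨ vanish _ (p ⊞ (⊟ q)) ℕ.≤-refl 0 (λ j _ → begin
        eval (p ⊞ (⊟ q)) (a j)          ≈⟨ eval-+ (a j) p (⊟ q) ⟩
        eval p (a j) + eval (⊟ q) (a j) ≈⟨ +-cong (p≈q j) (eval-neg (a j) q) ⟩
        eval q (a j) - eval q (a j)     ≈⟨ -‿inverseʳ _ ⟩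
        0#                              ∎) k ⟩
      0#                         ∎)

-- Sums over lists, lists without repetition, and enumeration of cliques

module Lists where
  open import Data.Bool.Base using (T)
  open import Data.Integer.Base using (+_)
  open import Data.List.Base using (List; []; _∷_; _++_; length; foldr)
  open import Data.List.Membership.Propositional using (_∈_)
  open import Data.List.Membership.Propositional.Properties using (∈-filter⁺; ∈-filter⁻)
  open import Data.List.Membership.Propositional.Properties.WithK using (unique∧set⇒bag)
  open import Data.List.Relation.Binary.BagAndSetEquality using (∼bag⇒↭)
  open import Data.List.Relation.Binary.Permutation.Propositional using (↭-trans; ↭-reflexive)
  open import Data.List.Relation.Binary.Sublist.Propositional using (_⊆_; []; _∷ʳ_; _∷_)
  open import Data.List.Relation.Binary.Sublist.Propositional.Properties using (length-mono-≤) renaming (filter⁺ to ⊆-filter⁺)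
  open import Data.List.Relation.Unary.All using ([]; _∷_)
  open import Data.List.Relation.Unary.AllPairs using ([]; _∷_)
  open import Data.Nat.Base using (zero; suc; z≤n; s≤s)
  open import Function.Bundles using (mk⇔)
  open import Relation.Binary.Definitions using (DecidableEquality)
  open import Relation.Binary.PropositionalEquality

  private variable
    A : Set

  sumBy : (A → ℤ) → List A → ℤ
  sumBy f = foldr (λ x s → f x ℤ.+ s) (+ 0)

  sumBy-cong : {f g : A → ℤ} → (∀ x → f x ≡ g x) → ∀ xs → sumBy f xs ≡ sumBy g xs
  sumBy-cong f≗g []       = refl
  sumBy-cong f≗g (x ∷ xs) = cong₂ ℤ._+_ (f≗g x) (sumBy-cong f≗g xs)

  sumBy-↭ : ∀ (f : A → ℤ) {xs ys} → xs ↭ ys → sumBy f xs ≡ sumBy f ys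
  sumBy-↭ f Perm.refl          = refl
  sumBy-↭ f (Perm.prep x p)    = cong (λ s → f x ℤ.+ s) (sumBy-↭ f p)
  sumBy-↭ f (Perm.swap {xs} {ys} x y p) = begin
    f x ℤ.+ (f y ℤ.+ sumBy f xs)  ≡⟨ cong (λ s → f x ℤ.+ (f y ℤ.+ s)) (sumBy-↭ f p) ⟩
    f x ℤ.+ (f y ℤ.+ sumBy f ys)  ≡⟨ ℤ.+-assoc (f x) (f y) _ ⟨
    f x ℤ.+ f y ℤ.+ sumBy f ys    ≡⟨ cong (λ s → s ℤ.+ sumBy f ys) (ℤ.+-comm (f x) (f y)) ⟩
    f y ℤ.+ f x ℤ.+ sumBy f ys    ≡⟨ ℤ.+-assoc (f y) (f x) _ ⟩
    f y ℤ.+ (f x ℤ.+ sumBy f ys)  ∎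
    where open ≡-Reasoning
  sumBy-↭ f (Perm.trans p q)   = trans (sumBy-↭ f p) (sumBy-↭ f q)

  module _ (_≟_ : DecidableEquality A) where
    open import Data.List.Membership.DecPropositional _≟_ using (_∈?_)

    unique-↭ : ∀ {xs ys} → Unique xs → Unique ys → (∀ {x} → x ∈ xs → x ∈ ys) → xs ↭ filter (_∈? xs) ys
    unique-↭ {xs} {ys} xs! ys! xs⊆ys = ∼bag⇒↭ (unique∧set⇒bag xs! (Unique.filter⁺ (_∈? xs) ys!)
      (mk⇔ (λ x∈xs → ∈-filter⁺ (_∈? xs) (xs⊆ys x∈xs) x∈xs) (proj₂ ∘ ∈-filter⁻ (_∈? xs) {xs = ys})))

    unique-length : ∀ {xs ys} → Unique xs → Unique ys → (∀ {x} → x ∈ xs → x ∈ ys) → length xs ≤ length ys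
    unique-length {xs} {ys} xs! ys! xs⊆ys = subst (_≤ length ys) (sym (↭-length (unique-↭ xs! ys! xs⊆ys)))
      (List.length-filter (_∈? xs) ys)

    unique-full : ∀ {xs ys} → Unique xs → Unique ys → (∀ {x} → x ∈ xs → x ∈ ys) → length xs ≡ length ys → xs ↭ ys
    unique-full {xs} {ys} xs! ys! xs⊆ys eq = ↭-trans p
      (↭-reflexive (List.filter-complete (_∈? xs) (trans (sym (↭-length p)) eq)))
      where p = unique-↭ xs! ys! xs⊆ys

  module _ {R : A → A → Set} (R? : B.Decidable R) where
    -- The cliques with at least k elements, k being lowered as elements are chosen; the first
    -- argument bounds the length of the list and only serves the termination checker.
    cliques : ℕ → ℕ → List A → List (List A)
    cliques n       k []       = if k ℕ.≡ᵇ 0 then [] ∷ [] else []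
    cliques zero    k (x ∷ xs) = []
    cliques (suc n) k (x ∷ xs) = if length xs ℕ.<ᵇ ℕ.pred k then []
      else List.map (x ∷_) (cliques n (ℕ.pred k) (filter (R? x) xs)) ++ cliques n k xs

    -- The pruning loses nothing: a sublist of `x ∷ xs` with at least `k` elements forces
    -- `pred k ≤ length xs`. Choosing `x` keeps the rest of the clique inside the filtered list, as
    -- all its members are related to `x`.
    cliques-complete : ∀ n k xs {ys} → length xs ≤ n → ys ⊆ xs → AllPairs R ys → k ≤ length ys →
      ys ∈ cliques n k xs
    cliques-complete n       .0 [] _ [] _ z≤n = here refl
    cliques-complete (suc n) k (x ∷ xs) {ys} (s≤s xs≤n) ys⊆ ys-clique k≤ys
      with length xs ℕ.<ᵇ ℕ.pred k in eq
    ... | true  = contradiction (ℕ.<ᵇ⇒< (length xs) (ℕ.pred k) (subst T (sym eq) _))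
      (ℕ.≤⇒≯ (ℕ.≤-trans (ℕ.pred-mono-≤ k≤ys) (ℕ.pred-mono-≤ (length-mono-≤ ys⊆))))
    ... | false with ys⊆ | ys-clique
    ...   | .x ∷ʳ ys⊆xs   | _ = ∈-++⁺ʳ _ (cliques-complete n k xs xs≤n ys⊆xs ys-clique k≤ys)
    ...   | refl ∷ ys⊆xs | x-ys ∷ ys-clique′ = ∈-++⁺ˡ (∈-map⁺ (x ∷_)
      (cliques-complete n (ℕ.pred k) _ (ℕ.≤-trans (List.length-filter (R? x) xs) xs≤n)
        (subst (_⊆ filter (R? x) xs) (List.filter-all (R? x) x-ys) (⊆-filter⁺ (R? x) (R? x) (λ { refl r → r }) ys⊆xs))
        ys-clique′ (ℕ.pred-mono-≤ k≤ys)))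

  sumBy-map : ∀ {B : Set} (h : A → B) (f : B → ℤ) xs → sumBy f (List.map h xs) ≡ sumBy (f ∘ h) xs
  sumBy-map h f []       = refl
  sumBy-map h f (x ∷ xs) = cong (λ s → f (h x) ℤ.+ s) (sumBy-map h f xs)

  sumBy-++ : ∀ (f : A → ℤ) xs ys → sumBy f (xs ++ ys) ≡ sumBy f xs ℤ.+ sumBy f ys
  sumBy-++ f []       ys = sym (ℤ.+-identityˡ _)
  sumBy-++ f (x ∷ xs) ys = trans (cong (λ s → f x ℤ.+ s) (sumBy-++ f xs ys)) (sym (ℤ.+-assoc (f x) _ _))

  sumBy-*ˡ : ∀ c (f : A → ℤ) xs → sumBy (λ x → c ℤ.* f x) xs ≡ c ℤ.* sumBy f xs
  sumBy-*ˡ c f []       = sym (ℤ.*-zeroʳ c)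
  sumBy-*ˡ c f (x ∷ xs) = trans (cong (λ s → c ℤ.* f x ℤ.+ s) (sumBy-*ˡ c f xs)) (sym (ℤ.*-distribˡ-+ c (f x) _))

  sumBy-0 : ∀ {f : A → ℤ} xs → (∀ x → f x ≡ + 0) → sumBy f xs ≡ + 0
  sumBy-0 []       f≡0 = refl
  sumBy-0 (x ∷ xs) f≡0 = trans (cong₂ ℤ._+_ (f≡0 x) (sumBy-0 xs f≡0)) refl

  sumBy-cartesianProduct : ∀ {B : Set} (f : A → ℤ) (g : B → ℤ) xs ys →
    sumBy (λ (x , y) → f x ℤ.* g y) (cartesianProduct xs ys) ≡ sumBy f xs ℤ.* sumBy g ys
  sumBy-cartesianProduct f g []       ys = sym (ℤ.*-zeroˡ (sumBy g ys))
  sumBy-cartesianProduct f g (x ∷ xs) ys = begin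
    sumBy fg (List.map (x ,_) ys ++ cartesianProduct xs ys)
      ≡⟨ sumBy-++ fg (List.map (x ,_) ys) _ ⟩
    sumBy fg (List.map (x ,_) ys) ℤ.+ sumBy fg (cartesianProduct xs ys)
      ≡⟨ cong₂ ℤ._+_ (trans (sumBy-map (x ,_) fg ys) (sumBy-*ˡ (f x) g ys)) (sumBy-cartesianProduct f g xs ys) ⟩
    f x ℤ.* sumBy g ys ℤ.+ sumBy f xs ℤ.* sumBy g ys
      ≡⟨ ℤ.*-distribʳ-+ (sumBy g ys) (f x) (sumBy f xs) ⟨
    (f x ℤ.+ sumBy f xs) ℤ.* sumBy g ys ∎
    where
    open ≡-Reasoning
    fg = λ (x , y) → f x ℤ.* g y

-- The graph of the quads of one block, and the moments of its 7-cliques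

module Vertices where
  open import Data.Bool.Base using (T; _∧_)
  open import Data.Fin.Base using (zero; suc)
  open import Data.Fin.Properties using (_≟_; all?)
  open import Data.Integer.Base using (+_; _+_; _*_; -_)
  open import Data.List.Base using (List; []; _∷_; _++_; length)
  open import Data.List.Relation.Unary.All using ([]; _∷_)
  open import Data.List.Relation.Unary.AllPairs using ([]; _∷_)
  open import Data.Nat.Base using (zero; suc)
  open import Data.Vec.Base using ([]; _∷_; lookup; tabulate)
  open import Relation.Binary.PropositionalEquality
  open import Algebra.Properties.Semiring.Sum ℤ.+-*-semiring using (sum)
  open Lists

  Vertex : Set
  Vertex = Bool × Subset 6

  subsets : ∀ n → ℕ → List (Subset n)
  subsets zero    zero    = [] ∷ []
  subsets zero    (suc k) = []
  subsets (suc n) zero    = List.map (false ∷_) (subsets n zero)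
  subsets (suc n) (suc k) = List.map (true ∷_) (subsets n k) ++ List.map (false ∷_) (subsets n (suc k))

  vertices : List Vertex
  vertices = cartesianProduct (true ∷ false ∷ []) (subsets 6 3)

  -- The Gram entry of two quads of one block is 12 |S ∩ S′| - 18 + 6 (1 + σ σ′). It is 6 or -6
  -- exactly for intersections of size 0 or 1 if the signs agree, and of size 1 or 2 if they differ.
  adjacent : Vertex → Vertex → Bool
  adjacent (true  , S) (true  , S′) = ∣ S ∩ S′ ∣ ℕ.≤ᵇ 1
  adjacent (false , S) (false , S′) = ∣ S ∩ S′ ∣ ℕ.≤ᵇ 1
  adjacent (_     , S) (_     , S′) = (1 ℕ.≤ᵇ ∣ S ∩ S′ ∣) ∧ (∣ S ∩ S′ ∣ ℕ.≤ᵇ 2)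

  dot : ∀ {n} → Vec ℤ n → Subset n → ℤ
  dot []      []          = 0ℤ
  dot (b ∷ v) (true  ∷ S) = b + dot v S
  dot (b ∷ v) (false ∷ S) = dot v S

  ±1 : Bool → ℤ
  ±1 true  = 1ℤ
  ±1 false = -1ℤ

  Basis : Set
  Basis = Vec (Vec ℤ 6) 5

  _⟨_,_⟩ : Basis → Fin 5 → Fin 6 → ℤ
  b ⟨ a , i ⟩ = lookup (lookup b a) i

  weight norm² : Fin 5 → ℤ
  weight = lookup (+ 3 ∷ + 1 ∷ + 3 ∷ + 1 ∷ + 2 ∷ [])
  norm²  = lookup (+ 4 ∷ + 12 ∷ + 4 ∷ + 12 ∷ + 6 ∷ [])

  -- An orthogonal basis of the sum-zero hyperplane with prescribed norms. Since
  -- `weight a * norm² a` is always 12, the matrix in `complete` is 12 times the orthogonal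
  -- projection onto that hyperplane, which is 12 I - 2 J with J the all-one matrix.
  record Frame (b : Basis) : Set where
    constructor frame
    field
      balanced   : ∀ a → sum (λ i → b ⟨ a , i ⟩) ≡ 0ℤ
      orthogonal : ∀ a a′ → sum (λ i → b ⟨ a , i ⟩ * b ⟨ a′ , i ⟩) ≡ (if does (a ≟ a′) then norm² a else 0ℤ)
      complete   : ∀ i j → sum (λ a → weight a * (b ⟨ a , i ⟩ * b ⟨ a , j ⟩)) ≡ (if does (i ≟ j) then + 10 else - (+ 2))

  frame? : ∀ b → Dec (Frame b)
  frame? b = map′ (λ (p , q , r) → frame p q r) (λ (frame p q r) → p , q , r)
    (all? (λ a → _ ℤ.≟ _) ×-dec all? (λ a → all? λ a′ → _ ℤ.≟ _) ×-dec all? (λ i → all? λ j → _ ℤ.≟ _))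

  features : Basis → Vertex → Vec ℤ 7
  features b (σ , S) = Vec.map (λ v → dot v S) b Vec.++ 1ℤ ∷ ±1 σ ∷ []

  -- The second moments of a 7-clique in its frame, in the order of `features`. The first four
  -- diagonal entries are 3, 3, 1, 1 times the norms of the frame vectors; the last two features are
  -- the constant 1 and the sign, so that `η` is the sum of the signs over the clique.
  moment : ℤ → Vec (Vec ℤ 7) 7
  moment η =
    (+ 12 ∷ + 0  ∷ + 0 ∷ + 0  ∷ + 0             ∷ + 0 ∷ + 0             ∷ []) ∷
    (+ 0  ∷ + 36 ∷ + 0 ∷ + 0  ∷ + 0             ∷ + 0 ∷ + 0             ∷ []) ∷
    (+ 0  ∷ + 0  ∷ + 4 ∷ + 0  ∷ + 0             ∷ + 0 ∷ + 0             ∷ []) ∷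
    (+ 0  ∷ + 0  ∷ + 0 ∷ + 12 ∷ + 0             ∷ + 0 ∷ + 0             ∷ []) ∷
    (+ 0  ∷ + 0  ∷ + 0 ∷ + 0  ∷ + 15            ∷ + 3 ∷ -[1+ 2 ] * η ∷ []) ∷
    (+ 0  ∷ + 0  ∷ + 0 ∷ + 0  ∷ + 3             ∷ + 7 ∷ η             ∷ []) ∷
    (+ 0  ∷ + 0  ∷ + 0 ∷ + 0  ∷ -[1+ 2 ] * η ∷ η   ∷ + 7           ∷ []) ∷ []

  Moments : Bool → List (Vec ℤ 7) → Set
  Moments η fs = ∀ r r′ → sumBy (λ f → lookup f r * lookup f r′) fs ≡ lookup (lookup (moment (±1 η)) r) r′

  moments? : ∀ η fs → Dec (Moments η fs)
  moments? η fs = all? λ r → all? λ r′ → _ ℤ.≟ _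

  record Standard (b : Basis) (η : Bool) (vs : List Vertex) : Set where
    constructor standard
    field
      isFrame : Frame b
      size    : length vs ≡ 7
      moments : Moments η (List.map (features b) vs)

  standard? : ∀ b η vs → Dec (Standard b η vs)
  standard? b η vs = map′ (λ (p , q , r) → standard p q r) (λ (standard p q r) → p , q , r)
    (frame? b ×-dec (length vs ℕ.≟ 7) ×-dec moments? η (List.map (features b) vs))

  position : (Fin 6 → Bool) → List (Fin 6) → ℕ
  position p []       = 0
  position p (x ∷ xs) = if p x then 0 else suc (position p xs)

  -- The frame adapted to a 7-clique. The vector `d` sums the ±1-indicators of the 3-subsets; in a
  -- standard clique it has three entries 1 and three entries -1. Each minus coordinate is paired
  -- with the plus coordinate with which it has correlation 1 over the clique. On the three
  -- resulting pairs the vectors (1, -1, 0) and (1, 1, -2) are taken once symmetrically and once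
  -- multiplied by `d`; `d` itself is the fifth vector.
  basisOf : List Vertex → Basis
  basisOf vs = rows d (filter (λ i → lookup d i ℤ.≟ 1ℤ) (List.allFin 6))
    where
    d : Vec ℤ 6
    d = tabulate λ i → sumBy (λ v → ±1 (lookup (proj₂ v) i)) vs
    mate : Fin 6 → Fin 6 → Bool
    mate k i = if does (lookup d k ℤ.≟ 1ℤ) then does (i ≟ k)
      else does (sumBy (λ v → ±1 (lookup (proj₂ v) i) * ±1 (lookup (proj₂ v) k)) vs ℤ.≟ 1ℤ)
    x y : ℕ → ℤ
    x 0 = + 1
    x 1 = - (+ 1)
    x _ = + 0
    y 2 = - (+ 2)
    y _ = + 1
    rows : Vec ℤ 6 → List (Fin 6) → Basis
    rows d plus = rows′ d (tabulate λ k → position (mate k) plus)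
      where
      rows′ : Vec ℤ 6 → Vec ℕ 6 → Basis
      rows′ d p = Vec.map x p ∷ Vec.map y p ∷ Vec.zipWith (λ e k → e * x k) d p ∷ Vec.zipWith (λ e k → e * y k) d p ∷ d ∷ []

  twistOf : List Vertex → Bool
  twistOf vs = does (sumBy (λ v → ±1 (proj₁ v)) vs ℤ.≟ 1ℤ)

  adjacent? : ∀ v v′ → Dec (T (adjacent v v′))
  adjacent? v v′ = T? (adjacent v v′)

  -- The exhaustive search: every clique of at least 7 of the 40 vertices is tested against its own
  -- frame and twist. As `Standard` includes the size 7, the search also rules out larger cliques.
  cliques-standard : All (λ vs → Standard (basisOf vs) (twistOf vs) vs) (cliques adjacent? 40 7 vertices)
  cliques-standard = toWitness {a? = All.all? (λ vs → standard? (basisOf vs) (twistOf vs) vs) (cliques adjacent? 40 7 vertices)} _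

-- Points and quads: Gram entries, Latin squares and cliques

module Lines where
  open import Data.Bool.Base using (T)
  open import Data.Fin.Properties using (_≟_; all?)
  open import Data.Fin.Subset using (⊥)
  open import Data.Fin.Subset.Properties using (∩-comm)
  open import Data.Integer.Base using (+_; _+_; _*_; -_)
  open import Data.List.Base using (List; []; _∷_; length)
  open import Data.List.Membership.Propositional using (_∈_)
  open import Data.List.Membership.Propositional.Properties using (∈-allFin)
  open import Data.List.Relation.Binary.Permutation.Propositional using (↭⇒↭ₛ)
  open import Data.List.Relation.Binary.Sublist.Propositional.Properties using (filter-⊆)
  open import Data.List.Relation.Unary.All using ([]; _∷_)
  open import Data.List.Relation.Unary.AllPairs using ([]; _∷_)
  open import Data.Vec.Base using ([]; _∷_; lookup)
  open import Relation.Binary.PropositionalEquality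
  open import Relation.Nullary.Decidable using (¬?)
  open import Relation.Nullary.Negation using (¬_)
  open import Algebra.Properties.Semiring.Sum ℤ.+-*-semiring using (sum; sum-cong-≗; *-distribˡ-sum; *-distribʳ-sum; ∑-comm; ∑-distrib-+)
  open import Defs using (module MatrixOps)
  open Lists
  open Vertices
  open Determinant ℤ.+-*-commutativeRing using (sum-Iₘ)
  open MatrixOps ℤ.+-*-rawRing using (Iₘ)

  -- Lines

  -- Labels for the lines spanned by the vectors `2u - ρ`: a point has an index in each A₅ block, a
  -- quad lives over the block `t` and has a sign and a subset, which `IsLine` restricts to size 3.
  data Line : Set where
    point : Fin 6 → Fin 6 → Fin 6 → Line
    quad  : Fin 3 → Vertex → Line

  part : Line → Fin 3 → Subset 6
  part (point i j k)    = lookup (⁅ i ⁆ ∷ ⁅ j ⁆ ∷ ⁅ k ⁆ ∷ [])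
  part (quad t (_ , S)) = λ t′ → if does (t ≟ t′) then S else ⊥

  -- The two blocks A₁ in which a line over the vertex (σ , S) of block t is nonzero carry 1 and σ, in this order.
  charge : Line → Fin 3 → ℤ
  charge (point _ _ _)     = λ _ → 0ℤ
  charge (quad 0F (σ , _)) = lookup (0ℤ ∷ 1ℤ ∷ ±1 σ ∷ [])
  charge (quad 1F (σ , _)) = lookup (1ℤ ∷ 0ℤ ∷ ±1 σ ∷ [])
  charge (quad 2F (σ , _)) = lookup (1ℤ ∷ ±1 σ ∷ 0ℤ ∷ [])

  data IsLine : Line → Set where
    point : ∀ i j k → IsLine (point i j k)
    quad  : ∀ t {v} → v ∈ vertices → IsLine (quad t v)

  -- Three times the inner product of `shape S` and `shape S′`, which makes it integral. With the
  -- same factor in `gram`, norm 10 becomes 30 and the inner products 2 and -2 become the 6 and -6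
  -- of `Adjacent`.
  blockGram : Subset 6 → Subset 6 → ℤ
  blockGram S S′ = + 12 * + ∣ S ∩ S′ ∣ + - + 2 * (+ ∣ S ∣ * + ∣ S′ ∣)

  gram : Line → Line → ℤ
  gram l l′ = sum (λ t → blockGram (part l t) (part l′ t)) + + 6 * sum (λ τ → charge l τ * charge l′ τ)

  Adjacent : Line → Line → Set
  Adjacent l l′ = gram l l′ ≡ + 6 ⊎ gram l l′ ≡ - + 6

  -- The coordinates of a line in a triple of frames

  data Row : Set where
    inBlock : Fin 3 → Fin 5 → Row
    inSign  : Fin 3 → Row

  coordinate : (Fin 3 → Basis) → Row → Line → ℤ
  coordinate b (inBlock t a) l = dot (lookup (b t) a) (part l t)
  coordinate b (inSign τ)    l = charge l τ

  scale : Row → ℤ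
  scale (inBlock t a) = weight a
  scale (inSign τ)    = + 6

  χ : ∀ {n} → Subset n → Fin n → ℤ
  χ S i = if lookup S i then 1ℤ else 0ℤ

  dot-sum : ∀ {n} (v : Vec ℤ n) S → dot v S ≡ sum (λ i → lookup v i * χ S i)
  dot-sum []      []          = refl
  dot-sum (b ∷ v) (true  ∷ S) = cong₂ _+_ (sym (ℤ.*-identityʳ b)) (dot-sum v S)
  dot-sum (b ∷ v) (false ∷ S) = trans (dot-sum v S) (trans (sym (ℤ.+-identityˡ _)) (cong (λ z → z + sum (λ i → lookup v i * χ S i)) (sym (ℤ.*-zeroʳ b))))

  ∣∣-sum : ∀ {n} (S : Subset n) → + ∣ S ∣ ≡ sum (χ S)
  ∣∣-sum []          = refl
  ∣∣-sum (true  ∷ S) = cong (λ z → 1ℤ + z) (∣∣-sum S)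
  ∣∣-sum (false ∷ S) = trans (∣∣-sum S) (sym (ℤ.+-identityˡ _))

  ∣∩∣-sum : ∀ {n} (S S′ : Subset n) → + ∣ S ∩ S′ ∣ ≡ sum (λ i → χ S i * χ S′ i)
  ∣∩∣-sum []          []           = refl
  ∣∩∣-sum (true  ∷ S) (true  ∷ S′) = cong (λ z → 1ℤ + z) (∣∩∣-sum S S′)
  ∣∩∣-sum (true  ∷ S) (false ∷ S′) = trans (∣∩∣-sum S S′) (sym (ℤ.+-identityˡ _))
  ∣∩∣-sum (false ∷ S) (true  ∷ S′) = trans (∣∩∣-sum S S′) (sym (ℤ.+-identityˡ _))
  ∣∩∣-sum (false ∷ S) (false ∷ S′) = trans (∣∩∣-sum S S′) (sym (ℤ.+-identityˡ _))

  sum-*-sum : ∀ {m n} (f : Fin m → ℤ) (g : Fin n → ℤ) → sum f * sum g ≡ sum (λ i → sum λ j → f i * g j)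
  sum-*-sum f g = trans (*-distribʳ-sum (sum g) f) (sum-cong-≗ λ i → *-distribˡ-sum (f i) g)

  -- The weighted squares of the frame coordinates form the quadratic form 12 I - 2 J, by
  -- `complete`; the rest is its value on two indicator vectors.
  frame-gram : ∀ {b} → Frame b → ∀ S S′ →
    sum (λ a → weight a * (dot (lookup b a) S * dot (lookup b a) S′)) ≡ blockGram S S′
  frame-gram {b} fr S S′ = begin
    sum (λ a → weight a * (dot (lookup b a) S * dot (lookup b a) S′))
      ≡⟨ sum-cong-≗ (λ a → trans
           (cong (weight a *_) (trans (cong₂ _*_ (dot-sum (lookup b a) S) (dot-sum (lookup b a) S′))
             (sum-*-sum (λ i → b ⟨ a , i ⟩ * χ S i) (λ j → b ⟨ a , j ⟩ * χ S′ j))))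
           (trans (*-distribˡ-sum (weight a) (λ i → sum λ j → b ⟨ a , i ⟩ * χ S i * (b ⟨ a , j ⟩ * χ S′ j)))
             (sum-cong-≗ λ i → trans (*-distribˡ-sum (weight a) (λ j → b ⟨ a , i ⟩ * χ S i * (b ⟨ a , j ⟩ * χ S′ j)))
               (sum-cong-≗ λ j → rearrange (weight a) (b ⟨ a , i ⟩) (χ S i) (b ⟨ a , j ⟩) (χ S′ j))))) ⟩
    sum (λ a → sum λ i → sum λ j → χ S i * χ S′ j * (weight a * (b ⟨ a , i ⟩ * b ⟨ a , j ⟩)))
      ≡⟨ ∑-comm (λ a i → sum λ j → χ S i * χ S′ j * (weight a * (b ⟨ a , i ⟩ * b ⟨ a , j ⟩))) ⟩
    sum (λ i → sum λ a → sum λ j → χ S i * χ S′ j * (weight a * (b ⟨ a , i ⟩ * b ⟨ a , j ⟩)))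
      ≡⟨ sum-cong-≗ (λ i → ∑-comm (λ a j → χ S i * χ S′ j * (weight a * (b ⟨ a , i ⟩ * b ⟨ a , j ⟩)))) ⟩
    sum (λ i → sum λ j → sum λ a → χ S i * χ S′ j * (weight a * (b ⟨ a , i ⟩ * b ⟨ a , j ⟩)))
      ≡⟨ sum-cong-≗ (λ i → sum-cong-≗ λ j → trans
           (sym (*-distribˡ-sum (χ S i * χ S′ j) λ a → weight a * (b ⟨ a , i ⟩ * b ⟨ a , j ⟩)))
           (cong (χ S i * χ S′ j *_) (trans (complete i j) (delta i j)))) ⟩
    sum (λ i → sum λ j → χ S i * χ S′ j * (+ 12 * Iₘ i j + - + 2))
      ≡⟨ sum-cong-≗ (λ i → inner i) ⟩
    sum (λ i → + 12 * (χ S i * χ S′ i) + - + 2 * sum (χ S′) * χ S i)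
      ≡⟨ ∑-distrib-+ (λ i → + 12 * (χ S i * χ S′ i)) (λ i → - + 2 * sum (χ S′) * χ S i) ⟩
    sum (λ i → + 12 * (χ S i * χ S′ i)) + sum (λ i → - + 2 * sum (χ S′) * χ S i)
      ≡⟨ cong₂ _+_ (sym (*-distribˡ-sum (+ 12) λ i → χ S i * χ S′ i)) (sym (*-distribˡ-sum (- + 2 * sum (χ S′)) (χ S))) ⟩
    + 12 * sum (λ i → χ S i * χ S′ i) + - + 2 * sum (χ S′) * sum (χ S)
      ≡⟨ cong₂ (λ x y → + 12 * x + y) (sym (∣∩∣-sum S S′)) (trans
           (cong₂ (λ x y → - + 2 * x * y) (sym (∣∣-sum S′)) (sym (∣∣-sum S)))
           (commute (- + 2) (+ ∣ S ∣) (+ ∣ S′ ∣))) ⟩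
    blockGram S S′ ∎
    where
    open ≡-Reasoning
    open Frame fr
    rearrange : ∀ w x s y s′ → w * (x * s * (y * s′)) ≡ s * s′ * (w * (x * y))
    rearrange = solve-∀
    commute : ∀ c s s′ → c * s′ * s ≡ c * (s * s′)
    commute = solve-∀
    delta : ∀ (i j : Fin 6) → (if does (i ≟ j) then + 10 else - + 2) ≡ + 12 * Iₘ i j + - + 2
    delta i j with i ≟ j
    ... | yes _ = refl
    ... | no _  = refl
    inner : ∀ i → sum (λ j → χ S i * χ S′ j * (+ 12 * Iₘ i j + - + 2)) ≡ + 12 * (χ S i * χ S′ i) + - + 2 * sum (χ S′) * χ S i
    inner i = begin
      sum (λ j → χ S i * χ S′ j * (+ 12 * Iₘ i j + - + 2))
        ≡⟨ sum-cong-≗ (λ j → expand (χ S i) (χ S′ j) (Iₘ i j)) ⟩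
      sum (λ j → + 12 * χ S i * (Iₘ i j * χ S′ j) + - + 2 * χ S i * χ S′ j)
        ≡⟨ ∑-distrib-+ (λ j → + 12 * χ S i * (Iₘ i j * χ S′ j)) (λ j → - + 2 * χ S i * χ S′ j) ⟩
      sum (λ j → + 12 * χ S i * (Iₘ i j * χ S′ j)) + sum (λ j → - + 2 * χ S i * χ S′ j)
        ≡⟨ cong₂ _+_ (sym (*-distribˡ-sum (+ 12 * χ S i) λ j → Iₘ i j * χ S′ j)) (sym (*-distribˡ-sum (- + 2 * χ S i) (χ S′))) ⟩
      + 12 * χ S i * sum (λ j → Iₘ i j * χ S′ j) + - + 2 * χ S i * sum (χ S′)
        ≡⟨ cong (λ x → + 12 * χ S i * x + - + 2 * χ S i * sum (χ S′)) (sum-Iₘ i (χ S′)) ⟩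
      + 12 * χ S i * χ S′ i + - + 2 * χ S i * sum (χ S′)
        ≡⟨ cong₂ _+_ (ℤ.*-assoc (+ 12) (χ S i) (χ S′ i)) (sym (commute′ (- + 2) (sum (χ S′)) (χ S i))) ⟩
      + 12 * (χ S i * χ S′ i) + - + 2 * sum (χ S′) * χ S i ∎
      where
      expand : ∀ s s′ d → s * s′ * (+ 12 * d + - + 2) ≡ + 12 * s * (d * s′) + - + 2 * s * s′
      expand = solve-∀
      commute′ : ∀ c x y → c * x * y ≡ c * y * x
      commute′ = solve-∀

  -- Latin squares

  Triple : Set
  Triple = Fin 6 × Fin 6 × Fin 6

  entry : Triple → Fin 3 → Fin 6
  entry (i , j , k) = lookup (i ∷ j ∷ k ∷ [])

  Separated : Triple → Triple → Set
  Separated c c′ = ∀ t s → t ≢ s → (entry c t , entry c s) ≢ (entry c′ t , entry c′ s)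

  pairs : List (Fin 6 × Fin 6)
  pairs = cartesianProduct (allFin 6) (allFin 6)

  module _ {cs : List Triple} (cs-separated : AllPairs Separated cs) {t s : Fin 3} (t≢s : t ≢ s) where
    private
      project : Triple → Fin 6 × Fin 6
      project c = entry c t , entry c s

      projections-unique : Unique (List.map project cs)
      projections-unique = AllPairs.map⁺ (AllPairs.map (λ sep → sep t s t≢s) cs-separated)

      pairs-unique : Unique pairs
      pairs-unique = Unique.cartesianProduct⁺ (Unique.allFin⁺ 6) (Unique.allFin⁺ 6)

      ∈-pairs : ∀ {x} → x ∈ pairs
      ∈-pairs = ∈-cartesianProduct⁺ (∈-allFin _) (∈-allFin _)

      _≟²_ = Product.≡-dec (_≟_ {6}) (_≟_ {6})

    -- Separation makes the projection to the coordinates `t` and `s` injective, and there are 36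
    -- pairs of indices.
    separated-length : length cs ≤ 36
    separated-length = subst (_≤ 36) (List.length-map project cs)
      (unique-length _≟²_ projections-unique pairs-unique (λ _ → ∈-pairs))

    -- With 36 triples the projection to two coordinates hits every pair exactly once, so the sum is
    -- a sum over a product set and factors.
    latin-sum : length cs ≡ 36 → ∀ (f g : Fin 6 → ℤ) → sumBy (λ c → f (entry c t) * g (entry c s)) cs ≡ sum f * sum g
    latin-sum cs≡36 f g = begin
      sumBy (λ c → f (entry c t) * g (entry c s)) cs
        ≡⟨ sumBy-map project fg cs ⟨
      sumBy fg (List.map project cs)
        ≡⟨ sumBy-↭ fg (unique-full _≟²_ projections-unique pairs-unique (λ _ → ∈-pairs) (trans (List.length-map project cs) cs≡36)) ⟩
      sumBy fg pairs
        ≡⟨ sumBy-cartesianProduct f g (allFin 6) (allFin 6) ⟩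
      sum f * sum g ∎
      where
      open ≡-Reasoning
      fg : Fin 6 × Fin 6 → ℤ
      fg (i , j) = f i * g j

  singleton-gram : ∀ i j → blockGram ⁅ i ⁆ ⁅ j ⁆ ≡ (if does (i ≟ j) then + 10 else - + 2)
  singleton-gram = toWitness {a? = all? λ i → all? λ j → _ ℤ.≟ _} tt

  point-gram : ∀ i j k i′ j′ k′ → gram (point i j k) (point i′ j′ k′) ≡
    (if does (i ≟ i′) then + 10 else - + 2) + ((if does (j ≟ j′) then + 10 else - + 2) + (if does (k ≟ k′) then + 10 else - + 2))
  point-gram i j k i′ j′ k′ = trans
    (cong₂ (λ x y → x + y + 0ℤ) (singleton-gram i i′)
      (cong₂ (λ x y → x + (y + 0ℤ)) (singleton-gram j j′) (singleton-gram k k′)))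
    (trans (ℤ.+-identityʳ _) (cong (λ z → (if does (i ≟ i′) then + 10 else - + 2) + ((if does (j ≟ j′) then + 10 else - + 2) + z)) (ℤ.+-identityʳ _)))

  separated-unless : ∀ {c c′} u → (∀ t → t ≢ u → entry c t ≢ entry c′ t) → Separated c c′
  separated-unless u differ t s t≢s eq with t ≟ u
  ... | no t≢u   = differ t t≢u (Product.,-injectiveˡ eq)
  ... | yes refl = differ s (t≢s ∘ sym) (Product.,-injectiveʳ eq)

  -- The Gram entry of two points is -6 plus 12 for every common coordinate. The values 6 and -6
  -- thus allow at most one agreement.
  adjacent⇒separated : ∀ i j k i′ j′ k′ → Adjacent (point i j k) (point i′ j′ k′) → Separated (i , j , k) (i′ , j′ , k′)
  adjacent⇒separated i j k i′ j′ k′ adj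
    with adj′ ← Sum.map (trans (sym (point-gram i j k i′ j′ k′))) (trans (sym (point-gram i j k i′ j′ k′))) adj
    with i ≟ i′ | j ≟ j′ | k ≟ k′
  ... | _     | no j≢ | no k≢ = separated-unless 0F λ { 0F t≢u → contradiction refl t≢u ; 1F _ → j≢ ; 2F _ → k≢ }
  ... | no i≢ | yes _ | no k≢ = separated-unless 1F λ { 1F t≢u → contradiction refl t≢u ; 0F _ → i≢ ; 2F _ → k≢ }
  ... | no i≢ | no j≢ | yes _ = separated-unless 2F λ { 2F t≢u → contradiction refl t≢u ; 0F _ → i≢ ; 1F _ → j≢ }
  ... | no i≢ | yes _ | yes _ = case adj′ of λ { (inj₁ ()) ; (inj₂ ()) }
  ... | yes _ | no j≢ | yes _ = case adj′ of λ { (inj₁ ()) ; (inj₂ ()) }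
  ... | yes _ | yes _ | no k≢ = case adj′ of λ { (inj₁ ()) ; (inj₂ ()) }
  ... | yes _ | yes _ | yes _ = case adj′ of λ { (inj₁ ()) ; (inj₂ ()) }

  quad-gram : ∀ t {v v′} → v ∈ vertices → v′ ∈ vertices → Adjacent (quad t v) (quad t v′) → T (adjacent v v′)
  quad-gram t v∈ v′∈ = All.lookup (All.lookup (checked t) v∈) v′∈
    where
    Checked : Fin 3 → Vertex → Vertex → Set
    Checked t v v′ = Adjacent (quad t v) (quad t v′) → T (adjacent v v′)
    checked : ∀ t → All (λ v → All (Checked t v) vertices) vertices
    checked = toWitness {a? = all? λ t → All.all? (λ v → All.all? (λ v′ →
      (gram (quad t v) (quad t v′) ℤ.≟ + 6 ⊎-dec gram (quad t v) (quad t v′) ℤ.≟ - + 6) →-dec T? (adjacent v v′)) vertices) vertices} tt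

  -- Cliques of quads

  adjacent-sym : ∀ {v v′} → T (adjacent v v′) → T (adjacent v′ v)
  adjacent-sym {true  , S} {true  , S′} h rewrite ∩-comm S S′ = h
  adjacent-sym {false , S} {false , S′} h rewrite ∩-comm S S′ = h
  adjacent-sym {true  , S} {false , S′} h rewrite ∩-comm S S′ = h
  adjacent-sym {false , S} {true  , S′} h rewrite ∩-comm S S′ = h

  _≟ᵛ_ : (v v′ : Vertex) → Dec (v ≡ v′)
  _≟ᵛ_ = Product.≡-dec Bool._≟_ (Vec.≡-dec Bool._≟_)

  vertices-unique : Unique vertices
  vertices-unique = toWitness {a? = DecUnique.unique? _≟ᵛ_ vertices} tt

  adjacent⇒≢ : ∀ {v v′} → v ∈ vertices → T (adjacent v v′) → v ≢ v′
  adjacent⇒≢ v∈ adj refl = All.lookup irreflexive v∈ adj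
    where
    irreflexive : All (λ v → ¬ T (adjacent v v)) vertices
    irreflexive = toWitness {a? = All.all? (λ v → ¬? (T? (adjacent v v))) vertices} tt

  clique-unique : ∀ {vs} → All (_∈ vertices) vs → AllPairs (λ v v′ → T (adjacent v v′)) vs → Unique vs
  clique-unique []          []       = []
  clique-unique (v∈ ∷ vs∈) (h ∷ hs) = All.map (adjacent⇒≢ v∈) h ∷ clique-unique vs∈ hs

  IsStandard : List Vertex → Set
  IsStandard vs = ∃[ b ] ∃[ η ] Frame b × length vs ≡ 7 ×
    (∀ r r′ → sumBy (λ v → lookup (features b v) r * lookup (features b v) r′) vs ≡ lookup (lookup (moment (±1 η)) r) r′)

  standard-↭ : ∀ {b η vs ws} → vs ↭ ws → Standard b η ws → IsStandard vs
  standard-↭ {b} {η} {vs} {ws} vs↭ws (standard isFrame size moments) =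
    b , η , isFrame , trans (↭-length vs↭ws) size , λ r r′ →
      trans (sumBy-↭ (λ v → lookup (features b v) r * lookup (features b v) r′) vs↭ws)
        (trans (sym (sumBy-map (features b) (λ f → lookup f r * lookup f r′) ws)) (moments r r′))

  -- The enumeration produces only sublists of `vertices`, in their order. The given clique is
  -- therefore replaced by the permuted list `sel`; being standard is insensitive to the order.
  clique-standard : ∀ {vs} → All (_∈ vertices) vs → AllPairs (λ v v′ → T (adjacent v v′)) vs → 7 ≤ length vs →
    IsStandard vs
  clique-standard {vs} vs∈ clique 7≤vs = standard-↭ vs↭sel
    (All.lookup cliques-standard (cliques-complete adjacent? 40 7 vertices ℕ.≤-refl
      (filter-⊆ (_∈? vs) vertices) sel-clique (subst (7 ≤_) (↭-length vs↭sel) 7≤vs)))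
    where
    open import Data.List.Membership.DecPropositional _≟ᵛ_ using (_∈?_)
    sel = filter (_∈? vs) vertices
    vs↭sel : vs ↭ sel
    vs↭sel = unique-↭ _≟ᵛ_ (clique-unique vs∈ clique) vertices-unique (All.lookup vs∈)
    sel-clique : AllPairs (λ v v′ → T (adjacent v v′)) sel
    sel-clique = Permₛ.AllPairs-resp-↭ (setoid Vertex) (λ {v} {v′} → adjacent-sym {v} {v′})
      ((λ { refl h → h }) , (λ { refl h → h })) (↭⇒↭ₛ vs↭sel) clique

  clique-length : ∀ {vs} → All (_∈ vertices) vs → AllPairs (λ v v′ → T (adjacent v v′)) vs → length vs ≤ 7
  clique-length {vs} vs∈ clique with ℕ.≤-total (length vs) 7
  ... | inj₁ vs≤7 = vs≤7
  ... | inj₂ 7≤vs = ℕ.≤-reflexive (proj₁ (proj₂ (proj₂ (proj₂ (clique-standard vs∈ clique 7≤vs)))))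

-- The second moments of a family of 57 lines

module Spectra where
  open import Data.Bool.Base using (T)
  open import Data.Fin.Base using (zero; suc)
  open import Data.Fin.Properties using (_≟_)
  open import Data.Fin.Subset using (⊥)
  open import Data.Integer.Base using (+_; _+_; _*_)
  open import Data.List.Base using (List; []; _∷_; length)
  open import Data.List.Membership.Propositional using (_∈_)
  open import Data.List.Relation.Unary.All using ([]; _∷_)
  open import Data.List.Relation.Unary.AllPairs using ([]; _∷_)
  open import Data.Maybe.Base using (Maybe; just; nothing; maybe′)
  open import Data.Nat.Base using (zero; suc)
  open import Data.Vec.Base using ([]; _∷_; lookup)
  open import Relation.Binary.PropositionalEquality
  open import Algebra.Properties.Semiring.Sum ℤ.+-*-semiring using (sum; sum-cong-≗; *-distribˡ-sum; *-distribʳ-sum; ∑-comm; ∑-distrib-+)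
  open Lists
  open Vertices
  open Lines

  points : List Line → List Triple
  points []                   = []
  points (point i j k ∷ ls) = (i , j , k) ∷ points ls
  points (quad _ _ ∷ ls)    = points ls

  quads : Fin 3 → List Line → List Vertex
  quads t []                 = []
  quads t (point _ _ _ ∷ ls) = quads t ls
  quads t (quad t′ v ∷ ls)   = if does (t ≟ t′) then v ∷ quads t ls else quads t ls

  All-points : ∀ {P : Line → Set} {Q : Triple → Set} → (∀ {i j k} → P (point i j k) → Q (i , j , k)) →
    ∀ {ls} → All P ls → All Q (points ls)
  All-points h {[]}               []       = []
  All-points h {point _ _ _ ∷ ls} (p ∷ ps) = h p ∷ All-points h ps
  All-points h {quad _ _ ∷ ls}    (p ∷ ps) = All-points h ps

  All-quads : ∀ {P : Line → Set} {Q : Vertex → Set} t → (∀ {v} → P (quad t v) → Q v) →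
    ∀ {ls} → All P ls → All Q (quads t ls)
  All-quads t h {[]}               []       = []
  All-quads t h {point _ _ _ ∷ ls} (p ∷ ps) = All-quads t h ps
  All-quads t h {quad t′ _ ∷ ls}   (p ∷ ps) with t ≟ t′
  ... | yes refl = h p ∷ All-quads t h ps
  ... | no _     = All-quads t h ps

  points-separated : ∀ {ls} → AllPairs Adjacent ls → AllPairs Separated (points ls)
  points-separated {[]}               []       = []
  points-separated {point i j k ∷ ls} (h ∷ hs) = All-points (adjacent⇒separated i j k _ _ _) h ∷ points-separated hs
  points-separated {quad _ _ ∷ ls}    (h ∷ hs) = points-separated hs

  quads-∈ : ∀ t {ls} → All IsLine ls → All (_∈ vertices) (quads t ls)
  quads-∈ t = All-quads t λ { (quad t v∈) → v∈ }

  quads-clique : ∀ t {ls} → All IsLine ls → AllPairs Adjacent ls → AllPairs (λ v v′ → T (adjacent v v′)) (quads t ls)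
  quads-clique t {[]}               []       []       = []
  quads-clique t {point i j k ∷ ls} (_ ∷ ps) (h ∷ hs) = quads-clique t ps hs
  quads-clique t {quad t′ v ∷ ls}   (quad _ v∈ ∷ ps) (h ∷ hs) with t ≟ t′
  ... | yes refl = All-quads t (λ { (quad t v′∈ , adj) → quad-gram t v∈ v′∈ adj }) (All.zip (ps , h)) ∷ quads-clique t ps hs
  ... | no _     = quads-clique t ps hs

  sumBy-split : ∀ (f : Line → ℤ) ls → sumBy f ls ≡
    sumBy (λ (i , j , k) → f (point i j k)) (points ls) + sum (λ t → sumBy (f ∘ quad t) (quads t ls))
  sumBy-split f []                 = refl
  sumBy-split f (point i j k ∷ ls) = trans (cong (λ s → f (point i j k) + s) (sumBy-split f ls)) (sym (ℤ.+-assoc (f (point i j k)) _ _))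
  sumBy-split f (quad t v ∷ ls)    = trans (cong (λ s → f (quad t v) + s) (sumBy-split f ls)) (insert t)
    where
    p = sumBy (λ (i , j , k) → f (point i j k)) (points ls)
    q : Fin 3 → ℤ
    q t = sumBy (f ∘ quad t) (quads t ls)
    insert : ∀ t → f (quad t v) + (p + sum q) ≡ p + sum (λ t′ → sumBy (f ∘ quad t′) (quads t′ (quad t v ∷ ls)))
    insert 0F = lemma (f (quad 0F v)) p (q 0F) (q 1F) (q 2F)
      where
      lemma : ∀ x p a b c → x + (p + (a + (b + (c + 0ℤ)))) ≡ p + ((x + a) + (b + (c + 0ℤ)))
      lemma = solve-∀
    insert 1F = lemma (f (quad 1F v)) p (q 0F) (q 1F) (q 2F)
      where
      lemma : ∀ x p a b c → x + (p + (a + (b + (c + 0ℤ)))) ≡ p + (a + ((x + b) + (c + 0ℤ)))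
      lemma = solve-∀
    insert 2F = lemma (f (quad 2F v)) p (q 0F) (q 1F) (q 2F)
      where
      lemma : ∀ x p a b c → x + (p + (a + (b + (c + 0ℤ)))) ≡ p + (a + (b + ((x + c) + 0ℤ)))
      lemma = solve-∀

  length-split : ∀ ls → length ls ≡ length (points ls) ℕ.+
    (length (quads 0F ls) ℕ.+ (length (quads 1F ls) ℕ.+ length (quads 2F ls)))
  length-split []                 = refl
  length-split (point i j k ∷ ls) = cong suc (length-split ls)
  length-split (quad 0F v ∷ ls)   = trans (cong suc (length-split ls)) (sym (ℕ.+-suc _ _))
  length-split (quad 1F v ∷ ls)   = trans (cong suc (length-split ls))
    (trans (sym (ℕ.+-suc _ _)) (cong (length (points ls) ℕ.+_) (sym (ℕ.+-suc _ _))))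
  length-split (quad 2F v ∷ ls)   = trans (cong suc (length-split ls)) (trans (sym (ℕ.+-suc _ _))
    (cong (length (points ls) ℕ.+_) (trans (sym (ℕ.+-suc _ _)) (cong (length (quads 0F ls) ℕ.+_) (sym (ℕ.+-suc _ _))))))

  -- The feature of a vertex of block t that the coordinate r of the line quad t v is equal to, if that coordinate is not 0.
  featureAt : Fin 3 → Row → Maybe (Fin 7)
  featureAt t  (inBlock t′ a) = if does (t ≟ t′) then just (a ↑ˡ 2) else nothing
  featureAt 0F (inSign τ)     = lookup (nothing ∷ just 5F ∷ just 6F ∷ []) τ
  featureAt 1F (inSign τ)     = lookup (just 5F ∷ nothing ∷ just 6F ∷ []) τ
  featureAt 2F (inSign τ)     = lookup (just 5F ∷ just 6F ∷ nothing ∷ []) τ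

  dot-⊥ : ∀ {n} (v : Vec ℤ n) → dot v ⊥ ≡ 0ℤ
  dot-⊥ []      = refl
  dot-⊥ (_ ∷ v) = dot-⊥ v

  dot-⁅⁆ : ∀ {n} (v : Vec ℤ n) i → dot v ⁅ i ⁆ ≡ lookup v i
  dot-⁅⁆ (b ∷ v) zero    = trans (cong (λ z → b + z) (dot-⊥ v)) (ℤ.+-identityʳ b)
  dot-⁅⁆ (_ ∷ v) (suc i) = dot-⁅⁆ v i

  sign-feature : ∀ b v i → lookup (1ℤ ∷ ±1 (proj₁ v) ∷ []) i ≡ lookup (features b v) (5 ↑ʳ i)
  sign-feature b v i = sym (Vec.lookup-++ʳ (Vec.map (λ w → dot w (proj₂ v)) b) _ i)

  coordinate-quad : ∀ b r t v → coordinate b r (quad t v) ≡ maybe′ (lookup (features (b t) v)) 0ℤ (featureAt t r)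
  coordinate-quad b (inBlock t′ a) t v with t ≟ t′
  ... | yes refl = sym (trans (Vec.lookup-++ˡ (Vec.map (λ w → dot w (proj₂ v)) (b t)) (1ℤ ∷ ±1 (proj₁ v) ∷ []) a) (Vec.lookup-map a _ (b t)))
  ... | no _     = dot-⊥ (lookup (b t′) a)
  coordinate-quad b (inSign 0F) 0F v = refl
  coordinate-quad b (inSign 1F) 0F v = sign-feature (b 0F) v 0F
  coordinate-quad b (inSign 2F) 0F v = sign-feature (b 0F) v 1F
  coordinate-quad b (inSign 0F) 1F v = sign-feature (b 1F) v 0F
  coordinate-quad b (inSign 1F) 1F v = refl
  coordinate-quad b (inSign 2F) 1F v = sign-feature (b 1F) v 1F
  coordinate-quad b (inSign 0F) 2F v = sign-feature (b 2F) v 0F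
  coordinate-quad b (inSign 1F) 2F v = sign-feature (b 2F) v 1F
  coordinate-quad b (inSign 2F) 2F v = refl

  quadMoment : Bool → Maybe (Fin 7) → Maybe (Fin 7) → ℤ
  quadMoment η (just r) (just r′) = lookup (lookup (moment (±1 η)) r) r′
  quadMoment η _        _         = 0ℤ

  pointMoment : Row → Row → ℤ
  pointMoment (inBlock t a) (inBlock t′ a′) = if does (t ≟ t′) then (if does (a ≟ a′) then + 6 * norm² a else 0ℤ) else 0ℤ
  pointMoment _             _               = 0ℤ

  lineMoment : (Fin 3 → Bool) → Row → Row → ℤ
  lineMoment η r r′ = pointMoment r r′ + sum (λ t → quadMoment (η t) (featureAt t r) (featureAt t r′))

  module _ {cs} (cs-separated : AllPairs Separated cs) (cs≡36 : length cs ≡ 36)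
    {b : Fin 3 → Basis} (frames : ∀ t → Frame (b t)) where
    private
      coord : Row → Triple → ℤ
      coord r (i , j , k) = coordinate b r (point i j k)

      coord-inBlock : ∀ t a c → coord (inBlock t a) c ≡ b t ⟨ a , entry c t ⟩
      coord-inBlock 0F a (i , j , k) = dot-⁅⁆ (lookup (b 0F) a) i
      coord-inBlock 1F a (i , j , k) = dot-⁅⁆ (lookup (b 1F) a) j
      coord-inBlock 2F a (i , j , k) = dot-⁅⁆ (lookup (b 2F) a) k

      other : ∀ (t : Fin 3) → ∃[ s ] t ≢ s
      other 0F = 1F , λ ()
      other 1F = 0F , λ ()
      other 2F = 0F , λ ()

    -- For coordinates of two different blocks the sum factors and `balanced` makes both factors
    -- zero. Within a block the second function is the constant 1 on some other coordinate, which
    -- contributes the factor 6.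
    point-moments : ∀ r r′ → sumBy (λ c → coord r c * coord r′ c) cs ≡ pointMoment r r′
    point-moments (inSign τ)    _           = sumBy-0 cs λ _ → refl
    point-moments (inBlock t a) (inSign τ′) = sumBy-0 cs λ c → ℤ.*-zeroʳ (coord (inBlock t a) c)
    point-moments (inBlock t a) (inBlock t′ a′) with t ≟ t′
    ... | no t≢t′ = begin
      sumBy (λ c → coord (inBlock t a) c * coord (inBlock t′ a′) c) cs
        ≡⟨ sumBy-cong (λ c → cong₂ _*_ (coord-inBlock t a c) (coord-inBlock t′ a′ c)) cs ⟩
      sumBy (λ c → b t ⟨ a , entry c t ⟩ * b t′ ⟨ a′ , entry c t′ ⟩) cs
        ≡⟨ latin-sum cs-separated t≢t′ cs≡36 (λ i → b t ⟨ a , i ⟩) (λ i → b t′ ⟨ a′ , i ⟩) ⟩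
      sum (λ i → b t ⟨ a , i ⟩) * sum (λ i → b t′ ⟨ a′ , i ⟩)
        ≡⟨ cong (_* sum (λ i → b t′ ⟨ a′ , i ⟩)) (Frame.balanced (frames t) a) ⟩
      0ℤ * sum (λ i → b t′ ⟨ a′ , i ⟩)
        ≡⟨ ℤ.*-zeroˡ (sum (λ i → b t′ ⟨ a′ , i ⟩)) ⟩
      0ℤ ∎
      where open ≡-Reasoning
    ... | yes refl = begin
      sumBy (λ c → coord (inBlock t a) c * coord (inBlock t a′) c) cs
        ≡⟨ sumBy-cong (λ c → trans (cong₂ _*_ (coord-inBlock t a c) (coord-inBlock t a′ c)) (sym (ℤ.*-identityʳ _))) cs ⟩
      sumBy (λ c → b t ⟨ a , entry c t ⟩ * b t ⟨ a′ , entry c t ⟩ * 1ℤ) cs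
        ≡⟨ latin-sum cs-separated (proj₂ (other t)) cs≡36 (λ i → b t ⟨ a , i ⟩ * b t ⟨ a′ , i ⟩) (λ _ → 1ℤ) ⟩
      sum (λ i → b t ⟨ a , i ⟩ * b t ⟨ a′ , i ⟩) * + 6
        ≡⟨ cong (_* + 6) (Frame.orthogonal (frames t) a a′) ⟩
      (if does (a ≟ a′) then norm² a else 0ℤ) * + 6
        ≡⟨ push (does (a ≟ a′)) ⟩
      (if does (a ≟ a′) then + 6 * norm² a else 0ℤ) ∎
      where
      open ≡-Reasoning
      push : ∀ c → (if c then norm² a else 0ℤ) * + 6 ≡ (if c then + 6 * norm² a else 0ℤ)
      push true  = ℤ.*-comm (norm² a) (+ 6)
      push false = refl

  -- All that the characteristic polynomial depends on: the number of lines and the moments in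
  -- suitable frames, known up to three twists.
  record Spectral (ls : List Line) : Set where
    field
      basis   : Fin 3 → Basis
      twist   : Fin 3 → Bool
      frames  : ∀ t → Frame (basis t)
      size    : length ls ≡ 57
      moments : ∀ r r′ → sumBy (λ l → coordinate basis r l * coordinate basis r′ l) ls ≡ lineMoment twist r r′

  -- The upper bounds add up to exactly 57, so none of the inequalities can be strict.
  summands-maximal : ∀ {p q₀ q₁ q₂} → p ≤ 36 → q₀ ≤ 7 → q₁ ≤ 7 → q₂ ≤ 7 → 57 ≤ p ℕ.+ (q₀ ℕ.+ (q₁ ℕ.+ q₂)) →
    p ≡ 36 × q₀ ≡ 7 × q₁ ≡ 7 × q₂ ≡ 7
  summands-maximal {p} {q₀} {q₁} {q₂} p≤ q₀≤ q₁≤ q₂≤ 57≤ =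
    ℕ.≤-antisym p≤ (ℕ.+-cancelʳ-≤ 21 36 p (ℕ.≤-trans 57≤ (ℕ.+-monoʳ-≤ p (ℕ.+-mono-≤ q₀≤ (ℕ.+-mono-≤ q₁≤ q₂≤))))) ,
    ℕ.≤-antisym q₀≤ (ℕ.+-cancelˡ-≤ 50 7 q₀ (ℕ.≤-trans 57≤ (ℕ.≤-trans (ℕ.+-mono-≤ p≤ (ℕ.+-monoʳ-≤ q₀ (ℕ.+-mono-≤ q₁≤ q₂≤)))
      (ℕ.≤-reflexive (trans (cong (36 ℕ.+_) (ℕ.+-comm q₀ 14)) (refl)))))) ,
    ℕ.≤-antisym q₁≤ (ℕ.+-cancelˡ-≤ 50 7 q₁ (ℕ.≤-trans 57≤ (ℕ.≤-trans (ℕ.+-mono-≤ p≤ (ℕ.+-mono-≤ q₀≤ (ℕ.+-monoʳ-≤ q₁ q₂≤)))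
      (ℕ.≤-reflexive (cong (43 ℕ.+_) (ℕ.+-comm q₁ 7)))))) ,
    ℕ.≤-antisym q₂≤ (ℕ.+-cancelˡ-≤ 50 7 q₂ (ℕ.≤-trans 57≤ (ℕ.+-mono-≤ p≤ (ℕ.+-mono-≤ q₀≤ (ℕ.+-monoˡ-≤ q₂ q₁≤)))))

  spectral : ∀ {ls} → All IsLine ls → AllPairs Adjacent ls → 57 ≤ length ls → Spectral ls
  spectral {ls} valid adj 57≤ls = record
    { basis   = basis
    ; twist   = twist
    ; frames  = λ t → proj₁ (proj₂ (proj₂ (quads-standard t)))
    ; size    = trans (length-split ls) (cong₂ ℕ._+_ ps≡36 (cong₂ ℕ._+_ (qs≡7 0F) (cong₂ ℕ._+_ (qs≡7 1F) (qs≡7 2F))))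
    ; moments = λ r r′ → trans (sumBy-split (λ l → coordinate basis r l * coordinate basis r′ l) ls)
        (cong₂ _+_ (point-moments separated ps≡36 (λ t → proj₁ (proj₂ (proj₂ (quads-standard t)))) r r′)
          (sum-cong-≗ λ t → quad-moments t r r′))
    }
    where
    separated = points-separated adj
    maximal = summands-maximal (separated-length separated {0F} {1F} (λ ()))
      (clique-length (quads-∈ 0F valid) (quads-clique 0F valid adj))
      (clique-length (quads-∈ 1F valid) (quads-clique 1F valid adj))
      (clique-length (quads-∈ 2F valid) (quads-clique 2F valid adj))
      (subst (57 ≤_) (length-split ls) 57≤ls)
    ps≡36 : length (points ls) ≡ 36
    ps≡36 = proj₁ maximal
    qs≡7 : ∀ t → length (quads t ls) ≡ 7
    qs≡7 0F = proj₁ (proj₂ maximal)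
    qs≡7 1F = proj₁ (proj₂ (proj₂ maximal))
    qs≡7 2F = proj₂ (proj₂ (proj₂ maximal))
    quads-standard : ∀ t → IsStandard (quads t ls)
    quads-standard t = clique-standard (quads-∈ t valid) (quads-clique t valid adj) (ℕ.≤-reflexive (sym (qs≡7 t)))
    basis : Fin 3 → Basis
    basis t = proj₁ (quads-standard t)
    twist : Fin 3 → Bool
    twist t = proj₁ (proj₂ (quads-standard t))
    quad-moments : ∀ t r r′ → sumBy (λ v → coordinate basis r (quad t v) * coordinate basis r′ (quad t v)) (quads t ls) ≡
      quadMoment (twist t) (featureAt t r) (featureAt t r′)
    quad-moments t r r′ = trans
      (sumBy-cong (λ v → cong₂ _*_ (coordinate-quad basis r t v) (coordinate-quad basis r′ t v)) (quads t ls))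
      (select (featureAt t r) (featureAt t r′))
      where
      value : Maybe (Fin 7) → Vertex → ℤ
      value x v = maybe′ (lookup (features (basis t) v)) 0ℤ x
      select : ∀ x x′ → sumBy (λ v → value x v * value x′ v) (quads t ls) ≡ quadMoment (twist t) x x′
      select (just x) (just x′) = proj₂ (proj₂ (proj₂ (proj₂ (quads-standard t)))) x x′
      select (just x) nothing   = sumBy-0 (quads t ls) λ v → ℤ.*-zeroʳ (value (just x) v)
      select nothing  _         = sumBy-0 (quads t ls) λ v → refl

-- The vectors of the lines and their inner products

module Vectors where
  open import Data.Fin.Base using (suc)
  open import Data.Integer.Base using (+_)
  open import Data.Nat.Base using (suc)
  open import Data.Rational.Base using (_+_; _*_; -_; toℚᵘ)
  open import Data.Rational.Unnormalised.Base using (ℚᵘ; mkℚᵘ; *≡*; _≃_)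
  open import Data.Vec.Base using ([]; _∷_; _++_)
  open import Relation.Binary.PropositionalEquality
  open import Algebra.Properties.Semiring.Sum ℤ.+-*-semiring using () renaming (sum to sumℤ)
  open import Algebra.Definitions.RawMonoid ℚ.+-0-rawMonoid using (sum)
  open import Defs using (V; 𝟎; ⟪_,_⟫)
  open Vertices
  open Lines

  ι : ℤ → ℚ
  ι z = z / 1

  toℚᵘ-ι : ∀ z → toℚᵘ (ι z) ≃ mkℚᵘ z 0
  toℚᵘ-ι z = ℚ.toℚᵘ-fromℚᵘ (mkℚᵘ z 0)

  ι-+ : ∀ x y → ι (x ℤ.+ y) ≡ ι x + ι y
  ι-+ x y = ℚ.toℚᵘ-injective (begin
    toℚᵘ (ι (x ℤ.+ y))             ≈⟨ toℚᵘ-ι (x ℤ.+ y) ⟩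
    mkℚᵘ (x ℤ.+ y) 0               ≈⟨ *≡* (lemma x y) ⟩
    mkℚᵘ x 0 ℚᵘ.+ mkℚᵘ y 0         ≈⟨ ℚᵘ.+-cong (toℚᵘ-ι x) (toℚᵘ-ι y) ⟨
    toℚᵘ (ι x) ℚᵘ.+ toℚᵘ (ι y)     ≈⟨ ℚ.toℚᵘ-homo-+ (ι x) (ι y) ⟨
    toℚᵘ (ι x + ι y)               ∎)
    where
    open ℚᵘ.≃-Reasoning
    lemma : ∀ x y → (x ℤ.+ y) ℤ.* (1ℤ ℤ.* 1ℤ) ≡ (x ℤ.* 1ℤ ℤ.+ y ℤ.* 1ℤ) ℤ.* 1ℤ
    lemma = solve-∀

  ι-* : ∀ x y → ι (x ℤ.* y) ≡ ι x * ι y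
  ι-* x y = ℚ.toℚᵘ-injective (begin
    toℚᵘ (ι (x ℤ.* y))             ≈⟨ toℚᵘ-ι (x ℤ.* y) ⟩
    mkℚᵘ x 0 ℚᵘ.* mkℚᵘ y 0         ≈⟨ ℚᵘ.*-cong (toℚᵘ-ι x) (toℚᵘ-ι y) ⟨
    toℚᵘ (ι x) ℚᵘ.* toℚᵘ (ι y)     ≈⟨ ℚ.toℚᵘ-homo-* (ι x) (ι y) ⟨
    toℚᵘ (ι x * ι y)               ∎)
    where open ℚᵘ.≃-Reasoning

  ι-neg : ∀ x → ι (ℤ.- x) ≡ - ι x
  ι-neg x = ℚ.toℚᵘ-injective (begin
    toℚᵘ (ι (ℤ.- x))               ≈⟨ toℚᵘ-ι (ℤ.- x) ⟩
    ℚᵘ.- mkℚᵘ x 0                  ≈⟨ ℚᵘ.-‿cong (toℚᵘ-ι x) ⟨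
    ℚᵘ.- toℚᵘ (ι x)                ≈⟨ ℚ.toℚᵘ-homo‿- (ι x) ⟨
    toℚᵘ (- ι x)                   ∎)
    where open ℚᵘ.≃-Reasoning

  ι-injective : ∀ {x y} → ι x ≡ ι y → x ≡ y
  ι-injective {x} {y} eq with *≡* p ← ℚᵘ.≃-trans (ℚᵘ.≃-sym (toℚᵘ-ι x)) (ℚᵘ.≃-trans (ℚᵘ.≃-reflexive (cong toℚᵘ eq)) (toℚᵘ-ι y)) =
    trans (sym (ℤ.*-identityʳ x)) (trans p (ℤ.*-identityʳ y))

  ⟪++⟫ : ∀ {m n} (x x′ : V m) (y y′ : V n) → ⟪ x ++ y , x′ ++ y′ ⟫ ≡ ⟪ x , x′ ⟫ + ⟪ y , y′ ⟫
  ⟪++⟫ []      []        y y′ = sym (ℚ.+-identityˡ _)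
  ⟪++⟫ (a ∷ x) (a′ ∷ x′) y y′ = trans (cong (λ z → a * a′ + z) (⟪++⟫ x x′ y y′)) (sym (ℚ.+-assoc (a * a′) _ _))

  ⅓ 1/9 : ℚ
  ⅓ = + 1 / 3
  1/9 = + 1 / 9

  side : Bool → ℤ
  side s = if s then 1ℤ else 0ℤ

  -- The orthogonal projection of twice the indicator vector of S onto the span of A₅.
  shape : Subset 6 → V 6
  shape S = Vec.map (λ s → ι (+ 6 ℤ.* side s ℤ.- + ∣ S ∣) * ⅓) S

  ∣∷∣ : ∀ {n} s (S : Subset n) → + ∣ s ∷ S ∣ ≡ side s ℤ.+ + ∣ S ∣
  ∣∷∣ true  S = refl
  ∣∷∣ false S = sym (ℤ.+-identityˡ _)

  ∣∷∩∷∣ : ∀ {n} s s′ (S S′ : Subset n) → + ∣ (s ∷ S) ∩ (s′ ∷ S′) ∣ ≡ side s ℤ.* side s′ ℤ.+ + ∣ S ∩ S′ ∣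
  ∣∷∩∷∣ true  true  S S′ = refl
  ∣∷∩∷∣ true  false S S′ = sym (ℤ.+-identityˡ _)
  ∣∷∩∷∣ false true  S S′ = sym (ℤ.+-identityˡ _)
  ∣∷∩∷∣ false false S S′ = sym (ℤ.+-identityˡ _)

  scaled-* : ∀ x y c d → ι x * c * (ι y * d) ≡ ι (x ℤ.* y) * (c * d)
  scaled-* x y c d = trans (interchange (ι x) c (ι y) d) (cong (_* (c * d)) (sym (ι-* x y)))
    where open import Algebra.Properties.CommutativeSemigroup (CommutativeMonoid.commutativeSemigroup ℚ.*-1-commutativeMonoid) using (interchange)

  scaled-+ : ∀ x y c → ι x * c + ι y * c ≡ ι (x ℤ.+ y) * c
  scaled-+ x y c = trans (sym (ℚ.*-distribʳ-+ c (ι x) (ι y))) (cong (_* c) (sym (ι-+ x y)))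

  shape-⟪⟫ : ∀ S S′ → ⟪ shape S , shape S′ ⟫ ≡ ι (blockGram S S′) * ⅓
  shape-⟪⟫ S S′ = begin
    ⟪ shape S , shape S′ ⟫
      ≡⟨ general (+ ∣ S ∣) (+ ∣ S′ ∣) S S′ ⟩
    ι (+ 36 ℤ.* + ∣ S ∩ S′ ∣ ℤ.- + 6 ℤ.* + ∣ S′ ∣ ℤ.* + ∣ S ∣ ℤ.- + 6 ℤ.* + ∣ S ∣ ℤ.* + ∣ S′ ∣ ℤ.+ + 6 ℤ.* (+ ∣ S ∣ ℤ.* + ∣ S′ ∣)) * 1/9
      ≡⟨ cong (λ z → ι z * 1/9) (regroup (+ ∣ S ∩ S′ ∣) (+ ∣ S ∣) (+ ∣ S′ ∣)) ⟩
    ι (blockGram S S′ ℤ.* + 3) * 1/9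
      ≡⟨ cong (_* 1/9) (ι-* (blockGram S S′) (+ 3)) ⟩
    ι (blockGram S S′) * ι (+ 3) * 1/9
      ≡⟨ ℚ.*-assoc (ι (blockGram S S′)) (ι (+ 3)) 1/9 ⟩
    ι (blockGram S S′) * ⅓ ∎
    where
    open ≡-Reasoning
    regroup : ∀ i s s′ → + 36 ℤ.* i ℤ.- + 6 ℤ.* s′ ℤ.* s ℤ.- + 6 ℤ.* s ℤ.* s′ ℤ.+ + 6 ℤ.* (s ℤ.* s′) ≡ (+ 12 ℤ.* i ℤ.+ ℤ.- + 2 ℤ.* (s ℤ.* s′)) ℤ.* + 3
    regroup = solve-∀
    step : ∀ s s′ i c c′ n k k′ → (+ 6 ℤ.* s ℤ.- k) ℤ.* (+ 6 ℤ.* s′ ℤ.- k′) ℤ.+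
      (+ 36 ℤ.* i ℤ.- + 6 ℤ.* k′ ℤ.* c ℤ.- + 6 ℤ.* k ℤ.* c′ ℤ.+ n ℤ.* (k ℤ.* k′)) ≡
      + 36 ℤ.* (s ℤ.* s′ ℤ.+ i) ℤ.- + 6 ℤ.* k′ ℤ.* (s ℤ.+ c) ℤ.- + 6 ℤ.* k ℤ.* (s′ ℤ.+ c′) ℤ.+ (1ℤ ℤ.+ n) ℤ.* (k ℤ.* k′)
    step = solve-∀
    -- The sizes subtracted in the entries are replaced by free parameters, because the induction
    -- shortens `S` and `S′` while the subtracted numbers stay fixed.
    general : ∀ {n} k k′ (S S′ : Subset n) →
      ⟪ Vec.map (λ s → ι (+ 6 ℤ.* side s ℤ.- k) * ⅓) S , Vec.map (λ s → ι (+ 6 ℤ.* side s ℤ.- k′) * ⅓) S′ ⟫ ≡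
      ι (+ 36 ℤ.* + ∣ S ∩ S′ ∣ ℤ.- + 6 ℤ.* k′ ℤ.* + ∣ S ∣ ℤ.- + 6 ℤ.* k ℤ.* + ∣ S′ ∣ ℤ.+ + n ℤ.* (k ℤ.* k′)) * 1/9
    general k k′ [] [] = sym (trans (cong (λ z → ι z * 1/9) (vanish k k′)) refl)
      where
      vanish : ∀ k k′ → + 36 ℤ.* 0ℤ ℤ.- + 6 ℤ.* k′ ℤ.* 0ℤ ℤ.- + 6 ℤ.* k ℤ.* 0ℤ ℤ.+ 0ℤ ℤ.* (k ℤ.* k′) ≡ 0ℤ
      vanish = solve-∀
    general {suc n} k k′ (s ∷ S) (s′ ∷ S′) = begin
      ι (+ 6 ℤ.* side s ℤ.- k) * ⅓ * (ι (+ 6 ℤ.* side s′ ℤ.- k′) * ⅓) + ⟪ Vec.map (λ s → ι (+ 6 ℤ.* side s ℤ.- k) * ⅓) S , Vec.map (λ s → ι (+ 6 ℤ.* side s ℤ.- k′) * ⅓) S′ ⟫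
        ≡⟨ cong₂ _+_ (scaled-* (+ 6 ℤ.* side s ℤ.- k) (+ 6 ℤ.* side s′ ℤ.- k′) ⅓ ⅓) (general k k′ S S′) ⟩
      _
        ≡⟨ scaled-+ ((+ 6 ℤ.* side s ℤ.- k) ℤ.* (+ 6 ℤ.* side s′ ℤ.- k′)) _ 1/9 ⟩
      _
        ≡⟨ cong (λ z → ι z * 1/9) (step (side s) (side s′) (+ ∣ S ∩ S′ ∣) (+ ∣ S ∣) (+ ∣ S′ ∣) (+ n) k k′) ⟩
      _
        ≡⟨ cong (λ z → ι z * 1/9) (cong (λ z → z ℤ.+ + suc n ℤ.* (k ℤ.* k′)) (cong₂ ℤ._-_
             (cong₂ (λ i c → + 36 ℤ.* i ℤ.- + 6 ℤ.* k′ ℤ.* c) (sym (∣∷∩∷∣ s s′ S S′)) (sym (∣∷∣ s S)))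
             (cong (λ c → + 6 ℤ.* k ℤ.* c) (sym (∣∷∣ s′ S′))))) ⟩
      _ ∎

  signs : ℤ → V 2
  signs m = ι m ∷ ι (ℤ.- m) ∷ []

  signs-⟪⟫ : ∀ m m′ → ⟪ signs m , signs m′ ⟫ ≡ ι (+ 6 ℤ.* (m ℤ.* m′)) * ⅓
  signs-⟪⟫ m m′ = begin
    ι m * ι m′ + (ι (ℤ.- m) * ι (ℤ.- m′) + 0ℚ)
      ≡⟨ cong₂ _+_ (sym (ι-* m m′)) (trans (ℚ.+-identityʳ _) (sym (ι-* (ℤ.- m) (ℤ.- m′)))) ⟩
    ι (m ℤ.* m′) + ι (ℤ.- m ℤ.* ℤ.- m′)
      ≡⟨ ι-+ (m ℤ.* m′) (ℤ.- m ℤ.* ℤ.- m′) ⟨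
    ι (m ℤ.* m′ ℤ.+ ℤ.- m ℤ.* ℤ.- m′)
      ≡⟨ cong ι (double m m′) ⟩
    ι (+ 2 ℤ.* (m ℤ.* m′))
      ≡⟨ trans (ι-* (+ 2) (m ℤ.* m′)) (ℚ.*-comm (ι (+ 2)) (ι (m ℤ.* m′))) ⟩
    ι (m ℤ.* m′) * ι (+ 2)
      ≡⟨ ℚ.*-assoc (ι (m ℤ.* m′)) (ι (+ 6)) ⅓ ⟨
    ι (m ℤ.* m′) * ι (+ 6) * ⅓
      ≡⟨ cong (_* ⅓) (trans (ℚ.*-comm (ι (m ℤ.* m′)) (ι (+ 6))) (sym (ι-* (+ 6) (m ℤ.* m′)))) ⟩
    ι (+ 6 ℤ.* (m ℤ.* m′)) * ⅓ ∎
    where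
    open ≡-Reasoning
    double : ∀ m m′ → m ℤ.* m′ ℤ.+ ℤ.- m ℤ.* ℤ.- m′ ≡ + 2 ℤ.* (m ℤ.* m′)
    double = solve-∀

  vector : (Fin 3 → Subset 6) → (Fin 3 → ℤ) → V 2 → V 26
  vector S m e = shape (S 0F) ++ shape (S 1F) ++ shape (S 2F) ++ signs (m 0F) ++ signs (m 1F) ++ signs (m 2F) ++ e

  lineVector : Line → V 26
  lineVector l = vector (part l) (charge l) 𝟎

  vector-⟪⟫ : ∀ S S′ m m′ e e′ → ⟪ vector S m e , vector S′ m′ e′ ⟫ ≡
    ⟪ shape (S 0F) , shape (S′ 0F) ⟫ + (⟪ shape (S 1F) , shape (S′ 1F) ⟫ + (⟪ shape (S 2F) , shape (S′ 2F) ⟫ +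
      (⟪ signs (m 0F) , signs (m′ 0F) ⟫ + (⟪ signs (m 1F) , signs (m′ 1F) ⟫ + (⟪ signs (m 2F) , signs (m′ 2F) ⟫ + ⟪ e , e′ ⟫)))))
  vector-⟪⟫ S S′ m m′ e e′ =
    split (shape (S 0F)) (shape (S′ 0F)) y₁ y₁′ (split (shape (S 1F)) (shape (S′ 1F)) y₂ y₂′ (split (shape (S 2F)) (shape (S′ 2F)) y₃ y₃′
      (split (signs (m 0F)) (signs (m′ 0F)) y₄ y₄′ (split (signs (m 1F)) (signs (m′ 1F)) y₅ y₅′ (split (signs (m 2F)) (signs (m′ 2F)) e e′ refl)))))
    where
    y₅ = signs (m 2F) ++ e
    y₅′ = signs (m′ 2F) ++ e′
    y₄ = signs (m 1F) ++ y₅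
    y₄′ = signs (m′ 1F) ++ y₅′
    y₃ = signs (m 0F) ++ y₄
    y₃′ = signs (m′ 0F) ++ y₄′
    y₂ = shape (S 2F) ++ y₃
    y₂′ = shape (S′ 2F) ++ y₃′
    y₁ = shape (S 1F) ++ y₂
    y₁′ = shape (S′ 1F) ++ y₂′
    split : ∀ {m n} (x x′ : V m) (y y′ : V n) {z} → ⟪ y , y′ ⟫ ≡ z → ⟪ x ++ y , x′ ++ y′ ⟫ ≡ ⟪ x , x′ ⟫ + z
    split x x′ y y′ eq = trans (⟪++⟫ x x′ y y′) (cong (λ z → ⟪ x , x′ ⟫ + z) eq)

  line-⟪⟫ : ∀ l l′ → ⟪ lineVector l , lineVector l′ ⟫ ≡ ι (gram l l′) * ⅓
  line-⟪⟫ l l′ = begin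
    ⟪ lineVector l , lineVector l′ ⟫
      ≡⟨ vector-⟪⟫ (part l) (part l′) (charge l) (charge l′) 𝟎 𝟎 ⟩
    _
      ≡⟨ cong₂ _+_ (shape-⟪⟫ (part l 0F) (part l′ 0F)) (cong₂ _+_ (shape-⟪⟫ (part l 1F) (part l′ 1F)) (cong₂ _+_ (shape-⟪⟫ (part l 2F) (part l′ 2F))
           (cong₂ _+_ (signs-⟪⟫ (charge l 0F) (charge l′ 0F)) (cong₂ _+_ (signs-⟪⟫ (charge l 1F) (charge l′ 1F))
             (cong (λ z → z + ⟪ 𝟎 {2} , 𝟎 ⟫) (signs-⟪⟫ (charge l 2F) (charge l′ 2F))))))) ⟩
    g 0F + (g 1F + (g 2F + (c 0F + (c 1F + (c 2F + 0ℚ)))))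
      ≡⟨ cong (λ z → g 0F + (g 1F + (g 2F + (c 0F + (c 1F + z))))) (ℚ.+-identityʳ (c 2F)) ⟩
    g 0F + (g 1F + (g 2F + (c 0F + (c 1F + c 2F))))
      ≡⟨ trans (cong (λ z → g 0F + (g 1F + (g 2F + z))) (trans (cong (λ z → c 0F + z) (scaled-+ (c′ 1F) (c′ 2F) ⅓)) (scaled-+ (c′ 0F) _ ⅓)))
          (trans (cong (λ z → g 0F + (g 1F + z)) (scaled-+ (g′ 2F) _ ⅓)) (trans (cong (λ z → g 0F + z) (scaled-+ (g′ 1F) _ ⅓)) (scaled-+ (g′ 0F) _ ⅓))) ⟩
    ι (g′ 0F ℤ.+ (g′ 1F ℤ.+ (g′ 2F ℤ.+ (c′ 0F ℤ.+ (c′ 1F ℤ.+ c′ 2F))))) * ⅓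
      ≡⟨ cong (λ z → ι z * ⅓) (regroup (g′ 0F) (g′ 1F) (g′ 2F) (m 0F) (m 1F) (m 2F)) ⟩
    ι (gram l l′) * ⅓ ∎
    where
    open ≡-Reasoning
    g′ c′ m : Fin 3 → ℤ
    g′ t = blockGram (part l t) (part l′ t)
    m τ = charge l τ ℤ.* charge l′ τ
    c′ τ = + 6 ℤ.* m τ
    g c : Fin 3 → ℚ
    g t = ι (g′ t) * ⅓
    c τ = ι (c′ τ) * ⅓
    regroup : ∀ a b c x y z → a ℤ.+ (b ℤ.+ (c ℤ.+ (+ 6 ℤ.* x ℤ.+ (+ 6 ℤ.* y ℤ.+ + 6 ℤ.* z)))) ≡
      (a ℤ.+ (b ℤ.+ (c ℤ.+ 0ℤ))) ℤ.+ + 6 ℤ.* (x ℤ.+ (y ℤ.+ (z ℤ.+ 0ℤ)))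
    regroup = solve-∀

-- From the Gram matrix to the 18 by 18 second-moment matrix

module SylvesterReduction where
  open import Data.Fin.Base using (zero; suc)
  open import Data.Fin.Properties using (_≟_; ↑ˡ-injective; ↑ʳ-injective)
  open import Data.Integer.Base using (+_)
  open import Data.List.Base using (List; []; _∷_)
  open import Data.Nat.Base using (zero; suc)
  open import Data.Rational.Base using (_+_; _*_; -_)
  open import Data.Rational.Solver using (module +-*-Solver)
  open import Data.Vec.Base using ([]; _∷_; lookup)
  open import Relation.Binary.PropositionalEquality
  open import Algebra.Properties.Semiring.Sum ℤ.+-*-semiring using () renaming (sum to sumℤ; sum-cong-≗ to sumℤ-cong; *-distribˡ-sum to *-distribˡ-sumℤ)
  open import Algebra.Properties.Semiring.Sum (CommutativeRing.semiring ℚ.+-*-commutativeRing) using (sum; sum-cong-≗; *-distribˡ-sum; *-distribʳ-sum)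
  open import Algebra.Properties.CommutativeSemigroup (CommutativeMonoid.commutativeSemigroup ℚ.*-1-commutativeMonoid) using (interchange; x∙yz≈y∙xz)
  open import Defs
  open Lists
  open Vertices
  open Lines
  open Spectra
  open Vectors
  open Determinant ℚ.+-*-commutativeRing using (det-cong; det-•; det-Iₘ; det-lowerBlock; sylvester; Iₘ-diag; Iₘ-off)
  open ℚₘ
  open import Algebra.Definitions.RawSemiring (RawRing.rawSemiring ℚ.+-*-rawRing) using (_^_)
  open Evaluation ℚ.+-*-commutativeRing

  ι-sum : ∀ {n} (f : Fin n → ℤ) → ι (sumℤ f) ≡ sum (ι ∘ f)
  ι-sum {zero}  f = refl
  ι-sum {suc n} f = trans (ι-+ (f zero) _) (cong (λ z → ι (f zero) + z) (ι-sum (f ∘ suc)))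

  scaled-sum : ∀ {n} (f : Fin n → ℤ) c → sum (λ i → ι (f i) * c) ≡ ι (sumℤ f) * c
  scaled-sum f c = trans (sym (*-distribʳ-sum c (ι ∘ f))) (cong (_* c) (sym (ι-sum f)))

  ⟪··⟫ : ∀ {n} c d (x y : V n) → ⟪ c · x , d · y ⟫ ≡ c * d * ⟪ x , y ⟫
  ⟪··⟫ c d x y = trans
    (sum-cong-≗ λ k → trans (cong₂ _*_ (Vec.lookup-map k (c *_) x) (Vec.lookup-map k (d *_) y)) (interchange c (lookup x k) d (lookup y k)))
    (sym (*-distribˡ-sum (c * d) λ k → lookup x k * lookup y k))

  -- The rows of eigenvalue 18, those of eigenvalue 14, and the remaining six.
  row : Fin 18 → Row
  row = lookup
    ( inBlock 0F 0F ∷ inBlock 0F 1F ∷ inBlock 1F 0F ∷ inBlock 1F 1F ∷ inBlock 2F 0F ∷ inBlock 2F 1F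
    ∷ inBlock 0F 2F ∷ inBlock 0F 3F ∷ inBlock 1F 2F ∷ inBlock 1F 3F ∷ inBlock 2F 2F ∷ inBlock 2F 3F
    ∷ inBlock 0F 4F ∷ inBlock 1F 4F ∷ inBlock 2F 4F ∷ inSign 0F ∷ inSign 1F ∷ inSign 2F ∷ [])

  sum-row : ∀ (f : Row → ℤ) → sumℤ (f ∘ row) ≡ sumℤ (λ t → sumℤ λ a → f (inBlock t a)) ℤ.+ sumℤ (f ∘ inSign)
  sum-row f = regroup (f (inBlock 0F 0F)) (f (inBlock 0F 1F)) (f (inBlock 1F 0F)) (f (inBlock 1F 1F)) (f (inBlock 2F 0F)) (f (inBlock 2F 1F))
      (f (inBlock 0F 2F)) (f (inBlock 0F 3F)) (f (inBlock 1F 2F)) (f (inBlock 1F 3F)) (f (inBlock 2F 2F)) (f (inBlock 2F 3F))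
      (f (inBlock 0F 4F)) (f (inBlock 1F 4F)) (f (inBlock 2F 4F)) (sumℤ (f ∘ inSign))
    where
    regroup : ∀ a b c d e g h i j k l m n o p s → a ℤ.+ (b ℤ.+ (c ℤ.+ (d ℤ.+ (e ℤ.+ (g ℤ.+ (h ℤ.+ (i ℤ.+ (j ℤ.+ (k ℤ.+ (l ℤ.+ (m ℤ.+ (n ℤ.+ (o ℤ.+ (p ℤ.+ s)))))))))))))) ≡
      ((a ℤ.+ (b ℤ.+ (h ℤ.+ (i ℤ.+ (n ℤ.+ 0ℤ))))) ℤ.+ ((c ℤ.+ (d ℤ.+ (j ℤ.+ (k ℤ.+ (o ℤ.+ 0ℤ))))) ℤ.+ ((e ℤ.+ (g ℤ.+ (l ℤ.+ (m ℤ.+ (p ℤ.+ 0ℤ))))) ℤ.+ 0ℤ))) ℤ.+ s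
    regroup = solve-∀

  frames-gram : ∀ {b} → (∀ t → Frame (b t)) → ∀ l l′ →
    sumℤ (λ r → scale (row r) ℤ.* (coordinate b (row r) l ℤ.* coordinate b (row r) l′)) ≡ gram l l′
  frames-gram {b} frames l l′ = trans (sum-row λ r → scale r ℤ.* (coordinate b r l ℤ.* coordinate b r l′))
    (cong₂ ℤ._+_ (sumℤ-cong λ t → frame-gram (frames t) (part l t) (part l′ t))
      (sym (*-distribˡ-sumℤ (+ 6) λ τ → charge l τ ℤ.* charge l′ τ)))

  ±1² : ∀ s → ±1 s ℤ.* ±1 s ≡ 1ℤ
  ±1² true  = refl
  ±1² false = refl

  1/6 : ℚ
  1/6 = + 1 / 6

  sumBy-tabulate : ∀ {A : Set} {n} (f : A → ℤ) (g : Fin n → A) → sumBy f (List.tabulate g) ≡ sumℤ (f ∘ g)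
  sumBy-tabulate {n = zero}  f g = refl
  sumBy-tabulate {n = suc n} f g = cong (λ z → f (g zero) ℤ.+ z) (sumBy-tabulate f (g ∘ suc))

  -- Six times the matrix `E *ₘ F`. It is not symmetric, because all weights are put into `F`.
  spectrum : (Fin 3 → Bool) → Matrix ℤ 18 18
  spectrum η r r′ = scale (row r′) ℤ.* lineMoment η (row r) (row r′)

  ⟪⟫-scaled : ∀ {n} {x y x′ y′ : V n} c d → x ≡ c · x′ → y ≡ d · y′ → ⟪ x , y ⟫ ≡ c * d * ⟪ x′ , y′ ⟫
  ⟪⟫-scaled {x′ = x′} {y′} c d refl refl = ⟪··⟫ c d x′ y′

  det-shift : ∀ {n} (K : Matrix ℚ n n) x c → det ((x •ₘ Iₘ) -ₘ (K -ₘ (c •ₘ Iₘ))) ≡ det (((x + c) •ₘ Iₘ) -ₘ K)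
  det-shift {n} K x c = det-cong {n} λ i j → regroup x (Iₘ i j) (K i j) c
    where
    open +-*-Solver
    regroup : ∀ x i f c → x * i + - (f + - (c * i)) ≡ (x + c) * i + - f
    regroup = solve 4 (λ x i f c → x :* i :+ :- (f :+ :- (c :* i)) := (x :+ c) :* i :+ :- f) refl

  -- The last factor is the determinant of a matrix small enough to be computed.
  det-spectrum : ∀ {a b c n} (E : Matrix ℚ (a ℕ.+ (b ℕ.+ c)) n) (F : Matrix ℚ n (a ℕ.+ (b ℕ.+ c))) (K : Matrix ℚ (a ℕ.+ (b ℕ.+ c)) (a ℕ.+ (b ℕ.+ c)))
    (K₃ : Matrix ℚ c c) (y y⁻¹ e₁ e₂ : ℚ) → y⁻¹ * y ≡ 1ℚ →
    (∀ i j → (E *ₘ F) i j ≡ K i j) →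
    (∀ (i j : Fin a) → K (i ↑ˡ (b ℕ.+ c)) (j ↑ˡ (b ℕ.+ c)) ≡ e₁ * Iₘ i j) → (∀ (i : Fin a) j → K (i ↑ˡ (b ℕ.+ c)) (a ↑ʳ j) ≡ 0ℚ) →
    (∀ (i j : Fin b) → K (a ↑ʳ (i ↑ˡ c)) (a ↑ʳ (j ↑ˡ c)) ≡ e₂ * Iₘ i j) → (∀ (i : Fin b) j → K (a ↑ʳ (i ↑ˡ c)) (a ↑ʳ (b ↑ʳ j)) ≡ 0ℚ) →
    (∀ i j → K (a ↑ʳ (b ↑ʳ i)) (a ↑ʳ (b ↑ʳ j)) ≡ K₃ i j) →
    y ^ (a ℕ.+ (b ℕ.+ c)) * det ((y •ₘ Iₘ) -ₘ (F *ₘ E)) ≡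
      y ^ n * ((y + - e₁) ^ a * ((y + - e₂) ^ b * det ((y •ₘ Iₘ) -ₘ K₃)))
  det-spectrum {a} {b} {c} {n} E F K K₃ y y⁻¹ e₁ e₂ y⁻¹y≡1 EF≡K k₁₁ k₁₂ k₂₂ k₂₃ k₃₃ = begin
    y ^ d * det ((y •ₘ Iₘ) -ₘ (F *ₘ E))
      ≡⟨ cong (y ^ d *_) (sylvester E F y y⁻¹ y⁻¹y≡1) ⟩
    y ^ d * (y ^ n * det (Iₘ -ₘ (y⁻¹ •ₘ (E *ₘ F))))
      ≡⟨ x∙yz≈y∙xz (y ^ d) (y ^ n) _ ⟩
    y ^ n * (y ^ d * det (Iₘ -ₘ (y⁻¹ •ₘ (E *ₘ F))))
      ≡⟨ cong (y ^ n *_) (det-• y (Iₘ -ₘ (y⁻¹ •ₘ (E *ₘ F)))) ⟨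
    y ^ n * det (y •ₘ (Iₘ -ₘ (y⁻¹ •ₘ (E *ₘ F))))
      ≡⟨ cong (y ^ n *_) (det-cong {d} λ i j → trans (cancel (Iₘ i j) ((E *ₘ F) i j)) (cong (λ z → y * Iₘ i j + - z) (EF≡K i j))) ⟩
    y ^ n * det M
      ≡⟨ cong (y ^ n *_) (det-lowerBlock a M λ i j → off (↑ˡ≢↑ʳ i j) (k₁₂ i j)) ⟩
    y ^ n * (det M₁ * det M′)
      ≡⟨ cong (y ^ n *_) (cong₂ _*_
           (scalar M₁ e₁ λ i j → cong₂ (λ z w → y * z + - w) (Iₘ-injective {a} (_↑ˡ (b ℕ.+ c)) (↑ˡ-injective (b ℕ.+ c) _ _) i j) (k₁₁ i j))
           (det-lowerBlock b M′ λ i j → off (↑ˡ≢↑ʳ i j ∘ ↑ʳ-injective a _ _) (k₂₃ i j))) ⟩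
    y ^ n * ((y + - e₁) ^ a * (det M₂ * det M₃))
      ≡⟨ cong (λ z → y ^ n * ((y + - e₁) ^ a * z)) (cong₂ _*_
           (scalar M₂ e₂ λ i j → cong₂ (λ z w → y * z + - w)
             (Iₘ-injective {b} (λ i → a ↑ʳ (i ↑ˡ c)) (↑ˡ-injective c _ _ ∘ ↑ʳ-injective a _ _) i j) (k₂₂ i j))
           (det-cong {c} λ i j → cong₂ (λ z w → y * z + - w)
             (Iₘ-injective {c} (λ i → a ↑ʳ (b ↑ʳ i)) (↑ʳ-injective b _ _ ∘ ↑ʳ-injective a _ _) i j) (k₃₃ i j))) ⟩
    y ^ n * ((y + - e₁) ^ a * ((y + - e₂) ^ b * det ((y •ₘ Iₘ) -ₘ K₃))) ∎
    where
    open ≡-Reasoning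
    d = a ℕ.+ (b ℕ.+ c)
    M : Matrix ℚ d d
    M = (y •ₘ Iₘ) -ₘ K
    M′ : Matrix ℚ (b ℕ.+ c) (b ℕ.+ c)
    M′ i j = M (a ↑ʳ i) (a ↑ʳ j)
    M₁ : Matrix ℚ a a
    M₁ i j = M (i ↑ˡ (b ℕ.+ c)) (j ↑ˡ (b ℕ.+ c))
    M₂ : Matrix ℚ b b
    M₂ i j = M′ (i ↑ˡ c) (j ↑ˡ c)
    M₃ : Matrix ℚ c c
    M₃ i j = M′ (b ↑ʳ i) (b ↑ʳ j)
    cancel : ∀ i k → y * (i + - (y⁻¹ * k)) ≡ y * i + - k
    cancel i k = begin
      y * (i + - (y⁻¹ * k))       ≡⟨ solve 4 (λ y i x k → y :* (i :+ :- (x :* k)) := y :* i :+ :- (x :* y :* k)) refl y i y⁻¹ k ⟩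
      y * i + - (y⁻¹ * y * k)     ≡⟨ cong (λ z → y * i + - (z * k)) y⁻¹y≡1 ⟩
      y * i + - (1ℚ * k)          ≡⟨ cong (λ z → y * i + - z) (ℚ.*-identityˡ k) ⟩
      y * i + - k                 ∎
      where open +-*-Solver
    off : ∀ {i j} → i ≢ j → K i j ≡ 0ℚ → M i j ≡ 0ℚ
    off i≢j k≡0 = trans (cong₂ (λ z w → y * z + - w) (Iₘ-off i≢j) k≡0) (trans (ℚ.+-identityʳ _) (ℚ.*-zeroʳ y))
    ↑ˡ≢↑ʳ : ∀ {m n} (i : Fin m) (j : Fin n) → i ↑ˡ n ≢ m ↑ʳ j
    ↑ˡ≢↑ʳ (suc i) j eq = ↑ˡ≢↑ʳ i j (suc-injective eq)
    Iₘ-injective : ∀ {m n} (f : Fin m → Fin n) → (∀ {i j} → f i ≡ f j → i ≡ j) → ∀ i j → Iₘ (f i) (f j) ≡ Iₘ i j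
    Iₘ-injective f f-inj i j with i ≟ j
    ... | yes refl = Iₘ-diag (f i)
    ... | no i≢j   = Iₘ-off (i≢j ∘ f-inj)
    scalar : ∀ {m} (N : Matrix ℚ m m) e → (∀ i j → N i j ≡ y * Iₘ i j + - (e * Iₘ i j)) → det N ≡ (y + - e) ^ m
    scalar {m} N e N≡ = trans (det-cong {m} {N} {(y + - e) •ₘ Iₘ} λ i j → trans (N≡ i j) (factor e (Iₘ i j)))
      (trans (det-• (y + - e) (Iₘ {m})) (trans (cong ((y + - e) ^ m *_) (det-Iₘ m)) (ℚ.*-identityʳ _)))
      where
      factor : ∀ e i → y * i + - (e * i) ≡ (y + - e) * i
      factor e i = solve 3 (λ y e i → y :* i :+ :- (e :* i) := (y :+ :- e) :* i) refl y e i
        where open +-*-Solver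

  -- Sylvester's identity combined with the block form of `K`. A power of `x + e` stays on each
  -- side, which avoids a truncated difference in the exponent; it is cancelled in
  -- `spectrum-factors`.
  charPoly-spectrum : ∀ {a b c n} (E : Matrix ℚ (a ℕ.+ (b ℕ.+ c)) n) (F : Matrix ℚ n (a ℕ.+ (b ℕ.+ c))) (K : Matrix ℚ (a ℕ.+ (b ℕ.+ c)) (a ℕ.+ (b ℕ.+ c)))
    (K₃ : Matrix ℚ c c) (G : Matrix ℚ n n) (e₁ e₂ e : ℚ) →
    (∀ i j → G i j ≡ (F *ₘ E) i j) → (∀ i j → (E *ₘ F) i j ≡ K i j) →
    (∀ (i j : Fin a) → K (i ↑ˡ (b ℕ.+ c)) (j ↑ˡ (b ℕ.+ c)) ≡ e₁ * Iₘ i j) → (∀ (i : Fin a) j → K (i ↑ˡ (b ℕ.+ c)) (a ↑ʳ j) ≡ 0ℚ) →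
    (∀ (i j : Fin b) → K (a ↑ʳ (i ↑ˡ c)) (a ↑ʳ (j ↑ˡ c)) ≡ e₂ * Iₘ i j) → (∀ (i : Fin b) j → K (a ↑ʳ (i ↑ˡ c)) (a ↑ʳ (b ↑ʳ j)) ≡ 0ℚ) →
    (∀ i j → K (a ↑ʳ (b ↑ʳ i)) (a ↑ʳ (b ↑ʳ j)) ≡ K₃ i j) →
    ∀ x y⁻¹ → y⁻¹ * (x + e) ≡ 1ℚ →
    (x + e) ^ (a ℕ.+ (b ℕ.+ c)) * eval (ℚ[x].charPoly (G -ₘ (e •ₘ Iₘ))) x ≡
      (x + e) ^ n * ((x + e + - e₁) ^ a * ((x + e + - e₂) ^ b * eval (ℚ[x].charPoly (K₃ -ₘ (e •ₘ Iₘ))) x))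
  charPoly-spectrum {a} {b} {c} {n} E F K K₃ G e₁ e₂ e G≡FE EF≡K k₁₁ k₁₂ k₂₂ k₂₃ k₃₃ x y⁻¹ y⁻¹y≡1 = begin
    y ^ d * eval (ℚ[x].charPoly (G -ₘ (e •ₘ Iₘ))) x
      ≡⟨ cong (y ^ d *_) (trans (eval-charPoly x (G -ₘ (e •ₘ Iₘ)))
           (trans (det-shift G x e) (det-cong {n} λ i j → cong (λ z → y * Iₘ i j + - z) (G≡FE i j)))) ⟩
    y ^ d * det ((y •ₘ Iₘ) -ₘ (F *ₘ E))
      ≡⟨ det-spectrum E F K K₃ y y⁻¹ e₁ e₂ y⁻¹y≡1 EF≡K k₁₁ k₁₂ k₂₂ k₂₃ k₃₃ ⟩
    y ^ n * ((y + - e₁) ^ a * ((y + - e₂) ^ b * det ((y •ₘ Iₘ) -ₘ K₃)))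
      ≡⟨ cong (λ z → y ^ n * ((y + - e₁) ^ a * ((y + - e₂) ^ b * z)))
           (trans (eval-charPoly x (K₃ -ₘ (e •ₘ Iₘ))) (det-shift K₃ x e)) ⟨
    y ^ n * ((y + - e₁) ^ a * ((y + - e₂) ^ b * eval (ℚ[x].charPoly (K₃ -ₘ (e •ₘ Iₘ))) x)) ∎
    where
    open ≡-Reasoning
    d = a ℕ.+ (b ℕ.+ c)
    y = x + e

  module _ {n} (w : Fin n → V 26) (s : Fin n → Bool) (l : Fin n → Line)
    (columns : ∀ i → w i ≡ ι (±1 (s i)) · lineVector (l i))
    (spec : Spectral (List.tabulate l)) where
    open Spectral spec

    private
      coord : Fin 18 → Fin n → ℤ
      coord r i = ±1 (s i) ℤ.* coordinate basis (row r) (l i)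

    E : Matrix ℚ 18 n
    E r i = ι (coord r i)

    F : Matrix ℚ n 18
    F i r = ι (scale (row r) ℤ.* coord r i) * 1/6

    -- The Gram entry of two columns, up to their signs, is `gram` divided by 3, and `frames-gram`
    -- expands it in the 18 coordinates. The factor `1/6` is the ½ of the Seidel matrix times this
    -- ⅓.
    FE : ∀ i j → ½ * ⟪ w i , w j ⟫ ≡ (F *ₘ E) i j
    FE i j = begin
      ½ * ⟪ w i , w j ⟫
        ≡⟨ cong (½ *_) (⟪⟫-scaled (ι (±1 (s i))) (ι (±1 (s j))) (columns i) (columns j)) ⟩
      ½ * (ι (±1 (s i)) * ι (±1 (s j)) * ⟪ lineVector (l i) , lineVector (l j) ⟫)
        ≡⟨ cong (½ *_) (cong₂ _*_ (sym (ι-* (±1 (s i)) (±1 (s j)))) (line-⟪⟫ (l i) (l j))) ⟩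
      ½ * (ι (±1 (s i) ℤ.* ±1 (s j)) * (ι (gram (l i) (l j)) * ⅓))
        ≡⟨ cong (½ *_) (trans (sym (ℚ.*-assoc (ι (±1 (s i) ℤ.* ±1 (s j))) _ ⅓)) (cong (_* ⅓) (sym (ι-* (±1 (s i) ℤ.* ±1 (s j)) (gram (l i) (l j)))))) ⟩
      ½ * (ι (±1 (s i) ℤ.* ±1 (s j) ℤ.* gram (l i) (l j)) * ⅓)
        ≡⟨ x∙yz≈y∙xz ½ (ι (±1 (s i) ℤ.* ±1 (s j) ℤ.* gram (l i) (l j))) ⅓ ⟩
      ι (±1 (s i) ℤ.* ±1 (s j) ℤ.* gram (l i) (l j)) * 1/6
        ≡⟨ cong (λ z → ι z * 1/6) (trans (cong (±1 (s i) ℤ.* ±1 (s j) ℤ.*_) (sym (frames-gram frames (l i) (l j))))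
             (trans (*-distribˡ-sumℤ (±1 (s i) ℤ.* ±1 (s j)) (λ r → scale (row r) ℤ.* (coordinate basis (row r) (l i) ℤ.* coordinate basis (row r) (l j))))
               (sumℤ-cong λ r → rearrange (±1 (s i)) (±1 (s j)) (scale (row r)) (coordinate basis (row r) (l i)) (coordinate basis (row r) (l j))))) ⟩
      ι (sumℤ λ r → scale (row r) ℤ.* coord r i ℤ.* coord r j) * 1/6
        ≡⟨ scaled-sum (λ r → scale (row r) ℤ.* coord r i ℤ.* coord r j) 1/6 ⟨
      sum (λ r → ι (scale (row r) ℤ.* coord r i ℤ.* coord r j) * 1/6)
        ≡⟨ sum-cong-≗ (λ r → trans (cong (λ z → ι z * 1/6) (ℤ.*-comm (scale (row r) ℤ.* coord r i) (coord r j)))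
             (trans (cong (_* 1/6) (ι-* (coord r j) (scale (row r) ℤ.* coord r i)))
               (trans (ℚ.*-assoc (E r j) _ 1/6) (ℚ.*-comm (E r j) (F i r))))) ⟩
      (F *ₘ E) i j ∎
      where
      open ≡-Reasoning
      rearrange : ∀ s s′ w c c′ → s ℤ.* s′ ℤ.* (w ℤ.* (c ℤ.* c′)) ≡ w ℤ.* (s ℤ.* c) ℤ.* (s′ ℤ.* c′)
      rearrange = solve-∀

    -- In a sum over the columns each sign occurs squared, so only the moments of the unsigned lines
    -- remain.
    EF : ∀ r r′ → (E *ₘ F) r r′ ≡ ι (spectrum twist r r′) * 1/6
    EF r r′ = begin
      sum (λ i → ι (coord r i) * (ι (scale (row r′) ℤ.* coord r′ i) * 1/6))
        ≡⟨ sum-cong-≗ (λ i → trans (sym (ℚ.*-assoc (ι (coord r i)) _ 1/6))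
             (trans (cong (_* 1/6) (sym (ι-* (coord r i) (scale (row r′) ℤ.* coord r′ i))))
               (cong (λ z → ι z * 1/6) (trans (rearrange (±1 (s i)) (scale (row r′)) (coordinate basis (row r) (l i)) (coordinate basis (row r′) (l i)))
                 (trans (cong (ℤ._* _) (±1² (s i))) (ℤ.*-identityˡ _)))))) ⟩
      sum (λ i → ι (scale (row r′) ℤ.* (coordinate basis (row r) (l i) ℤ.* coordinate basis (row r′) (l i))) * 1/6)
        ≡⟨ scaled-sum (λ i → scale (row r′) ℤ.* (coordinate basis (row r) (l i) ℤ.* coordinate basis (row r′) (l i))) 1/6 ⟩
      ι (sumℤ λ i → scale (row r′) ℤ.* (coordinate basis (row r) (l i) ℤ.* coordinate basis (row r′) (l i))) * 1/6
        ≡⟨ cong (λ z → ι z * 1/6) (trans (sym (*-distribˡ-sumℤ (scale (row r′)) λ i → coordinate basis (row r) (l i) ℤ.* coordinate basis (row r′) (l i)))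
             (cong (scale (row r′) ℤ.*_) (trans (sym (sumBy-tabulate (λ m → coordinate basis (row r) m ℤ.* coordinate basis (row r′) m) l)) (moments (row r) (row r′))))) ⟩
      ι (spectrum twist r r′) * 1/6 ∎
      where
      open ≡-Reasoning
      rearrange : ∀ s w c c′ → s ℤ.* c ℤ.* (w ℤ.* (s ℤ.* c′)) ≡ s ℤ.* s ℤ.* (w ℤ.* (c ℤ.* c′))
      rearrange = solve-∀

-- The blocks of the second-moment matrix and the characteristic polynomial of the last one

module IntegerDeterminants where
  open import Data.Fin.Properties using (all?)
  open import Data.Integer.Base using (+_)
  open import Data.List.Base using (List; []; _∷_)
  open import Data.Vec.Base using ([]; _∷_; lookup)
  open import Relation.Binary.PropositionalEquality
  open import Algebra.Properties.CommutativeSemigroup (CommutativeMonoid.commutativeSemigroup ℚ.*-1-commutativeMonoid) using (x∙yz≈y∙xz; interchange)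
  open import Algebra.Definitions.RawSemiring (RawRing.rawSemiring ℚ.+-*-rawRing) using () renaming (_^_ to _^ℚ_)
  open import Defs
  open Lists
  open Vertices
  open Lines
  open Spectra
  open Vectors
  open SylvesterReduction
  open ℚ[x]
  open Evaluation ℚ.+-*-commutativeRing

  twists : Bool → Bool → Bool → Fin 3 → Bool
  twists a b c = lookup (a ∷ b ∷ c ∷ [])

  K₁₈ : Bool → Bool → Bool → Matrix ℚ 18 18
  K₁₈ a b c r r′ = ι (spectrum (twists a b c) r r′) ℚ.* 1/6

  -- The block for the fifth frame vectors of the three A₅ blocks followed by the three A₁
  -- coordinates. On the diagonal, 17 is 12 from the Latin square plus 5 from the clique, and 14 is
  -- 7 + 7, since each A₁ block is used by the quads of two A₅ blocks. The entries are integers,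
  -- which permits the determinant to be computed over ℤ.
  K₆ : Bool → Bool → Bool → Matrix ℤ 6 6
  K₆ a b c i j = lookup (lookup rows i) j
    where
    x = ±1 a
    y = ±1 b
    z = ±1 c
    -3· : ℤ → ℤ
    -3· i = -[1+ 2 ] ℤ.* i
    rows : Vec (Vec ℤ 6) 6
    rows =
      (+ 17      ∷ + 0       ∷ + 0       ∷ + 0  ∷ + 3   ∷ -3· x ∷ []) ∷
      (+ 0       ∷ + 17      ∷ + 0       ∷ + 3  ∷ + 0   ∷ -3· y ∷ []) ∷
      (+ 0       ∷ + 0       ∷ + 17      ∷ + 3  ∷ -3· z ∷ + 0   ∷ []) ∷
      (+ 0       ∷ + 1       ∷ + 1       ∷ + 14 ∷ z     ∷ y     ∷ []) ∷
      (+ 1       ∷ + 0       ∷ ℤ.- z     ∷ z    ∷ + 14  ∷ x     ∷ []) ∷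
      (ℤ.- x     ∷ ℤ.- y     ∷ + 0       ∷ y    ∷ x     ∷ + 14  ∷ []) ∷ []

  record Blocks (K : Matrix ℚ 18 18) (K₃ : Matrix ℚ 6 6) : Set where
    constructor blocks
    field
      k₁₁ : ∀ (i j : Fin 6) → K (i ↑ˡ 12) (j ↑ˡ 12) ≡ + 18 / 1 ℚ.* ℚₘ.Iₘ i j
      k₁₂ : ∀ (i : Fin 6) j → K (i ↑ˡ 12) (6 ↑ʳ j) ≡ 0ℚ
      k₂₂ : ∀ (i j : Fin 6) → K (6 ↑ʳ (i ↑ˡ 6)) (6 ↑ʳ (j ↑ˡ 6)) ≡ + 14 / 1 ℚ.* ℚₘ.Iₘ i j
      k₂₃ : ∀ (i j : Fin 6) → K (6 ↑ʳ (i ↑ˡ 6)) (6 ↑ʳ (6 ↑ʳ j)) ≡ 0ℚ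
      k₃₃ : ∀ i j → K (6 ↑ʳ (6 ↑ʳ i)) (6 ↑ʳ (6 ↑ʳ j)) ≡ K₃ i j

  module _ (a b c : Bool) where
    private
      K = K₁₈ a b c
    blocks? : Dec (Blocks K λ i j → ι (K₆ a b c i j))
    blocks? = map′ (λ (p , q , r , s , t) → blocks p q r s t) (λ (blocks p q r s t) → p , q , r , s , t)
      ( all? (λ i → all? λ j → K (i ↑ˡ 12) (j ↑ˡ 12) ℚ.≟ + 18 / 1 ℚ.* ℚₘ.Iₘ i j)
      ×-dec all? (λ i → all? λ j → K (i ↑ˡ 12) (6 ↑ʳ j) ℚ.≟ 0ℚ)
      ×-dec all? (λ i → all? λ j → K (6 ↑ʳ (i ↑ˡ 6)) (6 ↑ʳ (j ↑ˡ 6)) ℚ.≟ + 14 / 1 ℚ.* ℚₘ.Iₘ i j)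
      ×-dec all? (λ i → all? λ j → K (6 ↑ʳ (i ↑ˡ 6)) (6 ↑ʳ (6 ↑ʳ j)) ℚ.≟ 0ℚ)
      ×-dec all? (λ i → all? λ j → K (6 ↑ʳ (6 ↑ʳ i)) (6 ↑ʳ (6 ↑ʳ j)) ℚ.≟ ι (K₆ a b c i j)))

  K₁₈-blocks : ∀ a b c → Blocks (K₁₈ a b c) (λ i j → ι (K₆ a b c i j))
  K₁₈-blocks true  true  true  = toWitness {a? = blocks? true  true  true } tt
  K₁₈-blocks true  true  false = toWitness {a? = blocks? true  true  false} tt
  K₁₈-blocks true  false true  = toWitness {a? = blocks? true  false true } tt
  K₁₈-blocks true  false false = toWitness {a? = blocks? true  false false} tt
  K₁₈-blocks false true  true  = toWitness {a? = blocks? false true  true } tt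
  K₁₈-blocks false true  false = toWitness {a? = blocks? false true  false} tt
  K₁₈-blocks false false true  = toWitness {a? = blocks? false false true } tt
  K₁₈-blocks false false false = toWitness {a? = blocks? false false false} tt

  module ℤₘ = MatrixOps ℤ.+-*-rawRing
  module ℤ[x] where
    open Polynomials ℤ.+-*-rawRing public
    open Evaluation ℤ.+-*-commutativeRing public

  -- The coefficients of (x - 13)² (x - 9)² (x² - 19 x + 72) and (x - 11) (x - 12) (x² - 20 x + 87)².
  coefficients₁ coefficients₂ : List ℤ
  coefficients₁ = + 985608 ∷ ℤ.- + 630747 ∷ + 163197 ∷ ℤ.- + 21958 ∷ + 1626 ∷ ℤ.- + 63 ∷ + 1 ∷ []
  coefficients₂ = + 999108 ∷ ℤ.- + 633447 ∷ + 163377 ∷ ℤ.- + 21962 ∷ + 1626 ∷ ℤ.- + 63 ∷ + 1 ∷ []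

  K₆-charPoly? : ∀ a b c p → Dec (ℤ[x].charPoly (K₆ a b c ℤₘ.-ₘ (+ 5 ℤₘ.•ₘ ℤₘ.Iₘ)) ≡ p)
  K₆-charPoly? a b c = List.≡-dec ℤ._≟_ _

  -- Only the product of the twists matters: changing the sign of the last coordinate reverses the
  -- first two twists, and similarly for the other pairs. The second polynomial belongs to product
  -- 1, the first to product -1.
  K₆-charPoly : ∀ a b c → let p = ℤ[x].charPoly (K₆ a b c ℤₘ.-ₘ (+ 5 ℤₘ.•ₘ ℤₘ.Iₘ)) in
    p ≡ coefficients₁ ⊎ p ≡ coefficients₂
  K₆-charPoly true  true  true  = inj₂ (toWitness {a? = K₆-charPoly? true  true  true  coefficients₂} tt)
  K₆-charPoly true  true  false = inj₁ (toWitness {a? = K₆-charPoly? true  true  false coefficients₁} tt)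
  K₆-charPoly true  false true  = inj₁ (toWitness {a? = K₆-charPoly? true  false true  coefficients₁} tt)
  K₆-charPoly true  false false = inj₂ (toWitness {a? = K₆-charPoly? true  false false coefficients₂} tt)
  K₆-charPoly false true  true  = inj₁ (toWitness {a? = K₆-charPoly? false true  true  coefficients₁} tt)
  K₆-charPoly false true  false = inj₂ (toWitness {a? = K₆-charPoly? false true  false coefficients₂} tt)
  K₆-charPoly false false true  = inj₂ (toWitness {a? = K₆-charPoly? false false true  coefficients₂} tt)
  K₆-charPoly false false false = inj₁ (toWitness {a? = K₆-charPoly? false false false coefficients₁} tt)

  factors₁-coefficients : (X - κ 13) ^ 2 * (X - κ 9) ^ 2 * (X ^ 2 - κ 19 * X + κ 72) ≡ List.map ι coefficients₁
  factors₁-coefficients = toWitness {a? = List.≡-dec ℚ._≟_ _ _} tt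

  factors₂-coefficients : (X - κ 11) * (X - κ 12) * (X ^ 2 - κ 20 * X + κ 87) ^ 2 ≡ List.map ι coefficients₂
  factors₂-coefficients = toWitness {a? = List.≡-dec ℚ._≟_ _ _} tt

-- Transfer from integers to rationals, and evaluation of factored polynomials

module RationalPolynomials where
  open import Data.Fin.Base using (zero; suc)
  open import Data.Fin.Properties using (_≟_)
  open import Data.Integer.Base using (+_)
  open import Data.List.Base using (List; []; _∷_)
  open import Data.Nat.Base using (zero; suc)
  open import Data.Rational.Base using (1/_)
  open import Data.Rational.Solver using (module +-*-Solver)
  open import Data.Vec.Base using ([]; _∷_)
  open import Relation.Binary.PropositionalEquality
  open import Algebra.Properties.CommutativeSemigroup (CommutativeMonoid.commutativeSemigroup ℚ.*-1-commutativeMonoid) using (x∙yz≈y∙xz; interchange)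
  import Algebra.Properties.Semiring.Exp (CommutativeRing.semiring ℚ.+-*-commutativeRing) as Exp
  open import Algebra.Definitions.RawSemiring (RawRing.rawSemiring ℚ.+-*-rawRing) using () renaming (_^_ to _^ℚ_)
  open import Algebra.Definitions.RawSemiring (RawRing.rawSemiring ℤ.+-*-rawRing) using () renaming (_^_ to _^ℤ_)
  open import Defs
  open Lists
  open Vertices
  open Lines
  open Spectra
  open Vectors
  open SylvesterReduction
  open IntegerDeterminants
  open ℚ[x]
  open Evaluation ℚ.+-*-commutativeRing

  ι-^ : ∀ x k → ι (x ^ℤ k) ≡ ι x ^ℚ k
  ι-^ x zero    = refl
  ι-^ x (suc k) = trans (ι-* x (x ^ℤ k)) (cong (ι x ℚ.*_) (ι-^ x k))

  ι-det : ∀ {n} (M : Matrix ℤ n n) → ι (ℤₘ.det M) ≡ ℚₘ.det (λ i j → ι (M i j))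
  ι-det {zero}  M = refl
  ι-det {suc n} M = trans (ι-sum term) (Determinant.sum-cong ℚ.+-*-commutativeRing (ι ∘ term) _ λ j →
    trans (ι-* (-1ℤ ^ℤ toℕ j) _) (cong₂ ℚ._*_ (ι-^ -1ℤ (toℕ j))
      (trans (ι-* (M zero j) _) (cong (ι (M zero j) ℚ.*_) (ι-det λ i k → M (suc i) (punchIn j k))))))
    where
    term : Fin (suc n) → ℤ
    term j = (-1ℤ ^ℤ toℕ j) ℤ.* (M zero j ℤ.* ℤₘ.det λ i k → M (suc i) (punchIn j k))

  ι-Iₘ : ∀ {n} (i j : Fin n) → ι (ℤₘ.Iₘ i j) ≡ ℚₘ.Iₘ i j
  ι-Iₘ i j with does (i ≟ j)
  ... | true  = refl
  ... | false = refl

  ι-eval : ∀ p x → eval (List.map ι p) (ι x) ≡ ι (ℤ[x].eval p x)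
  ι-eval []      x = refl
  ι-eval (a ∷ p) x = sym (trans (ι-+ a _) (cong (ι a ℚ.+_) (trans (ι-* x _) (cong (ι x ℚ.*_) (sym (ι-eval p x))))))

  ι-charPoly : ∀ {n} (K : Matrix ℤ n n) e x →
    eval (charPoly ((λ i j → ι (K i j)) ℚₘ.-ₘ (ι e ℚₘ.•ₘ ℚₘ.Iₘ))) (ι x) ≡ ι (ℤ[x].eval (ℤ[x].charPoly (K ℤₘ.-ₘ (e ℤₘ.•ₘ ℤₘ.Iₘ))) x)
  ι-charPoly {n} K e x = trans (eval-charPoly (ι x) ((λ i j → ι (K i j)) ℚₘ.-ₘ (ι e ℚₘ.•ₘ ℚₘ.Iₘ)))
    (trans (Determinant.det-cong ℚ.+-*-commutativeRing {n} entries)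
      (trans (sym (ι-det ((x ℤₘ.•ₘ ℤₘ.Iₘ) ℤₘ.-ₘ (K ℤₘ.-ₘ (e ℤₘ.•ₘ ℤₘ.Iₘ)))))
        (cong ι (sym (ℤ[x].eval-charPoly x (K ℤₘ.-ₘ (e ℤₘ.•ₘ ℤₘ.Iₘ)))))))
    where
    entries : ∀ i j → ι x ℚ.* ℚₘ.Iₘ i j ℚ.+ ℚ.- (ι (K i j) ℚ.+ ℚ.- (ι e ℚ.* ℚₘ.Iₘ i j)) ≡
      ι (x ℤ.* ℤₘ.Iₘ i j ℤ.+ ℤ.- (K i j ℤ.+ ℤ.- (e ℤ.* ℤₘ.Iₘ i j)))
    entries i j = sym (trans (ι-+ (x ℤ.* I) _) (cong₂ ℚ._+_ (scaled x)
      (trans (ι-neg (K i j ℤ.+ ℤ.- (e ℤ.* I))) (cong ℚ.-_ (trans (ι-+ (K i j) _)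
        (cong (ι (K i j) ℚ.+_) (trans (ι-neg (e ℤ.* I)) (cong ℚ.-_ (scaled e)))))))))
      where
      I = ℤₘ.Iₘ i j
      scaled : ∀ z → ι (z ℤ.* I) ≡ ι z ℚ.* ℚₘ.Iₘ i j
      scaled z = trans (ι-* z I) (cong (ι z ℚ.*_) (ι-Iₘ i j))

  -- Only values at integers have to be transferred, because the final identity is tested at natural
  -- numbers.
  ι-charPoly-factors : ∀ {n} (K : Matrix ℤ n n) e {p f} → ℤ[x].charPoly (K ℤₘ.-ₘ (e ℤₘ.•ₘ ℤₘ.Iₘ)) ≡ p → f ≡ List.map ι p →
    ∀ x → eval (charPoly ((λ i j → ι (K i j)) ℚₘ.-ₘ (ι e ℚₘ.•ₘ ℚₘ.Iₘ))) (ι x) ≡ eval f (ι x)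
  ι-charPoly-factors K e refl refl x = trans (ι-charPoly K e x) (sym (ι-eval (ℤ[x].charPoly (K ℤₘ.-ₘ (e ℤₘ.•ₘ ℤₘ.Iₘ))) x))

  cancel-^ : ∀ {y y⁻¹ : ℚ} {p q} k → y⁻¹ ℚ.* y ≡ 1ℚ → y ^ℚ k ℚ.* p ≡ y ^ℚ k ℚ.* q → p ≡ q
  cancel-^ {p = p} {q} zero inv eq = trans (sym (ℚ.*-identityˡ p)) (trans eq (ℚ.*-identityˡ q))
  cancel-^ {y} {y⁻¹} {p} {q} (suc k) inv eq = cancel-^ {y} {y⁻¹} k inv (trans (sym (peel p)) (trans (cong (y⁻¹ ℚ.*_) eq) (peel q)))
    where
    peel : ∀ p → y⁻¹ ℚ.* (y ^ℚ suc k ℚ.* p) ≡ y ^ℚ k ℚ.* p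
    peel p = trans (sym (ℚ.*-assoc y⁻¹ (y ^ℚ suc k) p)) (cong (ℚ._* p)
      (trans (sym (ℚ.*-assoc y⁻¹ y (y ^ℚ k))) (trans (cong (ℚ._* y ^ℚ k) inv) (ℚ.*-identityˡ (y ^ℚ k)))))

  eval-linear : ∀ c x → eval (X - κ c) x ≡ x ℚ.+ ℚ.- (+ c / 1)
  eval-linear c x = trans (eval-+ x X (- κ c)) (cong₂ ℚ._+_ (eval-X x) (trans (eval-neg x (κ c)) (cong ℚ.-_ (eval-const x (+ c / 1)))))

  collect₁ : ∀ x {y} (p a b q : Poly) k i i′ j j′ {i″ j″} → i ℕ.+ i′ ≡ i″ → j ℕ.+ j′ ≡ j″ → eval p x ≡ y →
    y ^ℚ k ℚ.* (eval a x ^ℚ i ℚ.* (eval b x ^ℚ j ℚ.* eval (a ^ i′ * b ^ j′ * q) x)) ≡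
    eval (p ^ k * a ^ i″ * b ^ j″ * q) x
  collect₁ x p a b q k i i′ j j′ refl refl refl = begin
    eval p x ^ℚ k ℚ.* (eval a x ^ℚ i ℚ.* (eval b x ^ℚ j ℚ.* eval (a ^ i′ * b ^ j′ * q) x))
      ≡⟨ cong (λ z → eval p x ^ℚ k ℚ.* (eval a x ^ℚ i ℚ.* (eval b x ^ℚ j ℚ.* z)))
           (trans (eval-* x (a ^ i′ * b ^ j′) q) (cong (ℚ._* eval q x) (trans (eval-* x (a ^ i′) (b ^ j′)) (cong₂ ℚ._*_ (eval-^ x a i′) (eval-^ x b j′))))) ⟩
    eval p x ^ℚ k ℚ.* (eval a x ^ℚ i ℚ.* (eval b x ^ℚ j ℚ.* (eval a x ^ℚ i′ ℚ.* eval b x ^ℚ j′ ℚ.* eval q x)))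
      ≡⟨ solve 6 (λ p a b a′ b′ q → p :* (a :* (b :* (a′ :* b′ :* q))) := p :* (a :* a′) :* (b :* b′) :* q) refl
           (eval p x ^ℚ k) (eval a x ^ℚ i) (eval b x ^ℚ j) (eval a x ^ℚ i′) (eval b x ^ℚ j′) (eval q x) ⟩
    eval p x ^ℚ k ℚ.* (eval a x ^ℚ i ℚ.* eval a x ^ℚ i′) ℚ.* (eval b x ^ℚ j ℚ.* eval b x ^ℚ j′) ℚ.* eval q x
      ≡⟨ cong (ℚ._* eval q x) (cong₂ (λ z w → eval p x ^ℚ k ℚ.* z ℚ.* w) (Exp.^-homo-* (eval a x) i i′) (Exp.^-homo-* (eval b x) j j′)) ⟨
    eval p x ^ℚ k ℚ.* eval a x ^ℚ (i ℕ.+ i′) ℚ.* eval b x ^ℚ (j ℕ.+ j′) ℚ.* eval q x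
      ≡⟨ cong (ℚ._* eval q x) (cong₂ ℚ._*_ (cong₂ ℚ._*_ (eval-^ x p k) (eval-^ x a (i ℕ.+ i′))) (eval-^ x b (j ℕ.+ j′))) ⟨
    eval (p ^ k) x ℚ.* eval (a ^ (i ℕ.+ i′)) x ℚ.* eval (b ^ (j ℕ.+ j′)) x ℚ.* eval q x
      ≡⟨ trans (eval-* x (p ^ k * a ^ (i ℕ.+ i′) * b ^ (j ℕ.+ j′)) q) (cong (ℚ._* eval q x)
           (trans (eval-* x (p ^ k * a ^ (i ℕ.+ i′)) (b ^ (j ℕ.+ j′))) (cong (ℚ._* eval (b ^ (j ℕ.+ j′)) x) (eval-* x (p ^ k) (a ^ (i ℕ.+ i′)))))) ⟨
    eval (p ^ k * a ^ (i ℕ.+ i′) * b ^ (j ℕ.+ j′) * q) x ∎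
    where
    open ≡-Reasoning
    open +-*-Solver using (solve; _:*_; _:=_)

  collect₂ : ∀ x {y} (p a b c d q : Poly) k i j → eval p x ≡ y →
    y ^ℚ k ℚ.* (eval a x ^ℚ i ℚ.* (eval b x ^ℚ j ℚ.* eval (c * d * q) x)) ≡
    eval (p ^ k * a ^ i * b ^ j * c * d * q) x
  collect₂ x p a b c d q k i j refl = begin
    eval p x ^ℚ k ℚ.* (eval a x ^ℚ i ℚ.* (eval b x ^ℚ j ℚ.* eval (c * d * q) x))
      ≡⟨ cong₂ ℚ._*_ (sym (eval-^ x p k)) (cong₂ ℚ._*_ (sym (eval-^ x a i)) (cong₂ ℚ._*_ (sym (eval-^ x b j))
           (trans (eval-* x (c * d) q) (cong (ℚ._* eval q x) (eval-* x c d))))) ⟩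
    eval (p ^ k) x ℚ.* (eval (a ^ i) x ℚ.* (eval (b ^ j) x ℚ.* (eval c x ℚ.* eval d x ℚ.* eval q x)))
      ≡⟨ solve 6 (λ p a b c d q → p :* (a :* (b :* (c :* d :* q))) := p :* a :* b :* c :* d :* q) refl
           (eval (p ^ k) x) (eval (a ^ i) x) (eval (b ^ j) x) (eval c x) (eval d x) (eval q x) ⟩
    eval (p ^ k) x ℚ.* eval (a ^ i) x ℚ.* eval (b ^ j) x ℚ.* eval c x ℚ.* eval d x ℚ.* eval q x
      ≡⟨ trans (eval-* x (p ^ k * a ^ i * b ^ j * c * d) q) (cong (ℚ._* eval q x)
           (trans (eval-* x (p ^ k * a ^ i * b ^ j * c) d) (cong (ℚ._* eval d x)
           (trans (eval-* x (p ^ k * a ^ i * b ^ j) c) (cong (ℚ._* eval c x)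
           (trans (eval-* x (p ^ k * a ^ i) (b ^ j)) (cong (ℚ._* eval (b ^ j) x) (eval-* x (p ^ k) (a ^ i))))))))) ⟨
    eval (p ^ k * a ^ i * b ^ j * c * d * q) x ∎
    where
    open ≡-Reasoning
    open +-*-Solver using (solve; _:*_; _:=_)

  ι-inverse : ∀ k → ∃[ z ] z ℚ.* ι (+ suc k) ≡ 1ℚ
  ι-inverse k = 1/ ι (+ suc k) , ℚ.*-inverseˡ (ι (+ suc k))
    where instance _ = ℚ.≢-nonZero {ι (+ suc k)} λ eq → case ι-injective {+ suc k} {0ℤ} eq of λ ()

  nat : ℕ → ℚ
  nat k = ι (+ k)

  nat-separated : ∀ {j k} z → j ℕ.< k → (nat k ℚ.+ ℚ.- nat j) ℚ.* z ≡ 0ℚ → z ≡ 0ℚ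
  nat-separated {j} {k} z j<k eq with ℕ.m≤n⇒∃[o]m+o≡n j<k
  ... | d , refl = trans (sym (ℚ.*-identityˡ z)) (trans (cong (ℚ._* z) (sym (proj₂ (ι-inverse d))))
    (trans (ℚ.*-assoc (proj₁ (ι-inverse d)) (ι (+ suc d)) z)
      (trans (cong (proj₁ (ι-inverse d) ℚ.*_) (trans (cong (ℚ._* z) (sym difference)) eq)) (ℚ.*-zeroʳ (proj₁ (ι-inverse d))))))
    where
    difference : nat (suc j ℕ.+ d) ℚ.+ ℚ.- nat j ≡ ι (+ suc d)
    difference = trans (cong (nat (suc j ℕ.+ d) ℚ.+_) (sym (ι-neg (+ j)))) (trans (sym (ι-+ (+ (suc j ℕ.+ d)) (ℤ.- + j)))
      (cong ι (trans (cong (ℤ._- + j) (trans (cong +_ (sym (ℕ.+-suc j d))) (ℤ.pos-+ j (suc d)))) (cancel (+ j) (+ suc d)))))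
      where
      cancel : ∀ a b → a ℤ.+ b ℤ.- a ≡ b
      cancel = solve-∀

-- The characteristic polynomial of a family of 57 lines

module LinePolynomials where
  open import Data.Integer.Base using (+_)
  open import Data.List.Base using (List)
  open import Data.Vec.Base using (lookup)
  open import Relation.Binary.PropositionalEquality
  import Algebra.Properties.Semiring.Exp (CommutativeRing.semiring ℚ.+-*-commutativeRing) as Exp
  open import Algebra.Definitions.RawSemiring (RawRing.rawSemiring ℚ.+-*-rawRing) using () renaming (_^_ to _^ℚ_)
  open import Defs
  open Lists
  open Vertices
  open Lines
  open Spectra
  open Vectors
  open SylvesterReduction
  open IntegerDeterminants
  open RationalPolynomials
  open ℚ[x]
  open Evaluation ℚ.+-*-commutativeRing

  eval-X+5 : ∀ x → eval (X + κ 5) x ≡ x ℚ.+ ι (+ 5)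
  eval-X+5 x = trans (eval-+ x X (κ 5)) (cong₂ ℚ._+_ (eval-X x) (eval-const x (ι (+ 5))))

  shifted-inverse : ∀ k → ∃[ z ] z ℚ.* (nat k ℚ.+ ι (+ 5)) ≡ 1ℚ
  shifted-inverse k = proj₁ (ι-inverse (4 ℕ.+ k)) , trans (cong (proj₁ (ι-inverse (4 ℕ.+ k)) ℚ.*_)
    (trans (sym (ι-+ (+ k) (+ 5))) (cong (ι ∘ +_) (ℕ.+-comm k 5)))) (proj₂ (ι-inverse (4 ℕ.+ k)))

  -- At a natural number `x + 5` is invertible, so the power of it common to both sides of
  -- `charPoly-spectrum` can be cancelled. What remains is the exponent `r`, the excess of the
  -- number of vectors over the dimension.
  spectrum-factors : ∀ {a b c n} (E : Matrix ℚ (a ℕ.+ (b ℕ.+ c)) n) (F : Matrix ℚ n (a ℕ.+ (b ℕ.+ c))) (K : Matrix ℚ (a ℕ.+ (b ℕ.+ c)) (a ℕ.+ (b ℕ.+ c)))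
    (K₃ : Matrix ℤ c c) (G : Matrix ℚ n n) (e₁ e₂ : ℚ) r →
    (∀ i j → G i j ≡ (F ℚₘ.*ₘ E) i j) → (∀ i j → (E ℚₘ.*ₘ F) i j ≡ K i j) →
    (∀ (i j : Fin a) → K (i ↑ˡ (b ℕ.+ c)) (j ↑ˡ (b ℕ.+ c)) ≡ e₁ ℚ.* ℚₘ.Iₘ i j) → (∀ (i : Fin a) j → K (i ↑ˡ (b ℕ.+ c)) (a ↑ʳ j) ≡ 0ℚ) →
    (∀ (i j : Fin b) → K (a ↑ʳ (i ↑ˡ c)) (a ↑ʳ (j ↑ˡ c)) ≡ e₂ ℚ.* ℚₘ.Iₘ i j) → (∀ (i : Fin b) j → K (a ↑ʳ (i ↑ˡ c)) (a ↑ʳ (b ↑ʳ j)) ≡ 0ℚ) →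
    (∀ i j → K (a ↑ʳ (b ↑ʳ i)) (a ↑ʳ (b ↑ʳ j)) ≡ ι (K₃ i j)) →
    n ≡ (a ℕ.+ (b ℕ.+ c)) ℕ.+ r →
    ∀ {p f} → ℤ[x].charPoly (K₃ ℤₘ.-ₘ (+ 5 ℤₘ.•ₘ ℤₘ.Iₘ)) ≡ p → f ≡ List.map ι p →
    ∀ k → let y = nat k ℚ.+ ι (+ 5) in
    eval (charPoly (G ℚₘ.-ₘ (ι (+ 5) ℚₘ.•ₘ ℚₘ.Iₘ))) (nat k) ≡
      y ^ℚ r ℚ.* ((y ℚ.+ ℚ.- e₁) ^ℚ a ℚ.* ((y ℚ.+ ℚ.- e₂) ^ℚ b ℚ.* eval f (nat k)))
  spectrum-factors {a} {b} {c} E F K K₃ G e₁ e₂ r G≡FE EF≡K k₁₁ k₁₂ k₂₂ k₂₃ k₃₃ refl {f = f} char≡p f≡p k =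
    cancel-^ {y} {proj₁ (shifted-inverse k)} d (proj₂ (shifted-inverse k))
      (trans (charPoly-spectrum {a} {b} {c} E F K (λ i j → ι (K₃ i j)) G e₁ e₂ (ι (+ 5)) G≡FE EF≡K k₁₁ k₁₂ k₂₂ k₂₃ k₃₃ (nat k)
          (proj₁ (shifted-inverse k)) (proj₂ (shifted-inverse k)))
        (trans (cong₂ (λ z w → z ℚ.* (p ℚ.* (q ℚ.* w))) (Exp.^-homo-* y d r) (ι-charPoly-factors K₃ (+ 5) char≡p f≡p (+ k)))
          (ℚ.*-assoc (y ^ℚ d) (y ^ℚ r) (p ℚ.* (q ℚ.* eval f (nat k))))))
    where
    d = a ℕ.+ (b ℕ.+ c)
    y = nat k ℚ.+ ι (+ 5)
    p = (y ℚ.+ ℚ.- e₁) ^ℚ a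
    q = (y ℚ.+ ℚ.- e₂) ^ℚ b

  -- A polynomial given as an explicit argument is stored unfolded, and comparing it with the same polynomial in a type
  -- makes Agda expand the powers; passed through Named, it is inferred from a type instead.
  data Named (p : Poly) : Set where
    named : Named p

  ≋-factored₁ : ∀ {P p a b q : Poly} → Named p → Named a → Named b → Named q →
    (∀ k → eval p (nat k) ≡ nat k ℚ.+ ι (+ 5)) →
    (∀ k → let x = nat k in eval P x ≡ (x ℚ.+ ι (+ 5)) ^ℚ 39 ℚ.* (eval a x ^ℚ 6 ℚ.* (eval b x ^ℚ 6 ℚ.* eval (a ^ 2 * b ^ 2 * q) x))) →
    P ≋ p ^ 39 * a ^ 8 * b ^ 8 * q
  ≋-factored₁ {P} {p} {a} {b} {q} _ _ _ _ p≡ P≡ = eval-injective nat nat-separated P (p ^ 39 * a ^ 8 * b ^ 8 * q)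
    λ k → trans (P≡ k) (collect₁ (nat k) p a b q 39 6 2 6 2 refl refl (p≡ k))

  ≋-factored₂ : ∀ {P p a b c d q : Poly} → Named p → Named a → Named b → Named c → Named d → Named q →
    (∀ k → eval p (nat k) ≡ nat k ℚ.+ ι (+ 5)) →
    (∀ k → let x = nat k in eval P x ≡ (x ℚ.+ ι (+ 5)) ^ℚ 39 ℚ.* (eval a x ^ℚ 6 ℚ.* (eval b x ^ℚ 6 ℚ.* eval (c * d * q ^ 2) x))) →
    P ≋ p ^ 39 * a ^ 6 * b ^ 6 * c * d * q ^ 2
  ≋-factored₂ {P} {p} {a} {b} {c} {d} {q} _ _ _ _ _ _ p≡ P≡ =
    eval-injective nat nat-separated P (p ^ 39 * a ^ 6 * b ^ 6 * c * d * q ^ 2)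
    λ k → trans (P≡ k) (collect₂ (nat k) p a b c d (q ^ 2) 39 6 6 (p≡ k))

  x+5 : Named (X + κ 5)
  x+5 = named

  x-13 : Named (X - κ 13)
  x-13 = named

  x-9 : Named (X - κ 9)
  x-9 = named

  x-11 : Named (X - κ 11)
  x-11 = named

  x-12 : Named (X - κ 12)
  x-12 = named

  x²-19x+72 : Named (X ^ 2 - κ 19 * X + κ 72)
  x²-19x+72 = named

  x²-20x+87 : Named (X ^ 2 - κ 20 * X + κ 87)
  x²-20x+87 = named

  spectrum-twists : ∀ η r r′ → spectrum η r r′ ≡ spectrum (twists (η 0F) (η 1F) (η 2F)) r r′
  spectrum-twists η r r′ = refl

  to-factor : ∀ x c d → ι (+ 5) ℚ.+ ℚ.- (+ c / 1) ≡ ℚ.- (+ d / 1) → x ℚ.+ ι (+ 5) ℚ.+ ℚ.- (+ c / 1) ≡ eval (X - κ d) x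
  to-factor x c d eq = trans (ℚ.+-assoc x (ι (+ 5)) (ℚ.- (+ c / 1))) (trans (cong (x ℚ.+_) eq) (sym (eval-linear d x)))

  module _ {n} (w : Fin n → V 26) (s : Fin n → Bool) (l : Fin n → Line)
    (columns : ∀ i → w i ≡ ι (±1 (s i)) · lineVector (l i))
    (spec : Spectral (List.tabulate l)) where
    open Spectral spec

    private
      D : Matrix ℚ 26 n
      D k i = lookup (w i) k

      S : Matrix ℚ n n
      S = (½ ℚₘ.•ₘ ((D ᵀ) ℚₘ.*ₘ D)) ℚₘ.-ₘ (ι (+ 5) ℚₘ.•ₘ ℚₘ.Iₘ)

      a = twist 0F
      b = twist 1F
      c = twist 2F

      n≡57 : n ≡ 57
      n≡57 = trans (sym (List.length-tabulate l)) size

      open Blocks (K₁₈-blocks a b c)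

      -- The eigenvalues 18 and 14 of the second-moment matrix become the roots 13 and 9 after the
      -- shift by 5, and 39 is 57 - 18.
      evaluated : ∀ {p f} → ℤ[x].charPoly (K₆ a b c ℤₘ.-ₘ (+ 5 ℤₘ.•ₘ ℤₘ.Iₘ)) ≡ p → f ≡ List.map ι p → ∀ k → let x = nat k in
        eval (charPoly S) x ≡ (x ℚ.+ ι (+ 5)) ^ℚ 39 ℚ.* (eval (X - κ 13) x ^ℚ 6 ℚ.* (eval (X - κ 9) x ^ℚ 6 ℚ.* eval f x))
      evaluated {f = f} char≡p f≡p k = trans
        (spectrum-factors {6} {6} {6} (E w s l columns spec) (F w s l columns spec) (K₁₈ a b c) (K₆ a b c) (½ ℚₘ.•ₘ ((D ᵀ) ℚₘ.*ₘ D))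
          (+ 18 / 1) (+ 14 / 1) 39 (FE w s l columns spec)
          (λ r r′ → trans (EF w s l columns spec r r′) (cong (λ z → ι z ℚ.* 1/6) (spectrum-twists twist r r′)))
          k₁₁ k₁₂ k₂₂ k₂₃ k₃₃ n≡57 char≡p f≡p k)
        (cong₂ (λ z w → (nat k ℚ.+ ι (+ 5)) ^ℚ 39 ℚ.* (z ^ℚ 6 ℚ.* (w ^ℚ 6 ℚ.* eval f (nat k))))
          (to-factor (nat k) 18 13 refl) (to-factor (nat k) 14 9 refl))

      lines₁ : ℤ[x].charPoly (K₆ a b c ℤₘ.-ₘ (+ 5 ℤₘ.•ₘ ℤₘ.Iₘ)) ≡ coefficients₁ →
        charPoly S ≋ (X + κ 5) ^ 39 * (X - κ 13) ^ 8 * (X - κ 9) ^ 8 * (X ^ 2 - κ 19 * X + κ 72)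
      lines₁ eq = r
        where
        h = evaluated eq factors₁-coefficients
        r = ≋-factored₁ {charPoly S} x+5 x-13 x-9 x²-19x+72 (λ k → eval-X+5 (nat k)) h

      lines₂ : ℤ[x].charPoly (K₆ a b c ℤₘ.-ₘ (+ 5 ℤₘ.•ₘ ℤₘ.Iₘ)) ≡ coefficients₂ →
        charPoly S ≋ (X + κ 5) ^ 39 * (X - κ 13) ^ 6 * (X - κ 9) ^ 6 * (X - κ 11) * (X - κ 12) * (X ^ 2 - κ 20 * X + κ 87) ^ 2
      lines₂ eq = r
        where
        h = evaluated eq factors₂-coefficients
        r = ≋-factored₂ {charPoly S} x+5 x-13 x-9 x-11 x-12 x²-20x+87 (λ k → eval-X+5 (nat k)) h

    charPoly-lines :
        charPoly S ≋ (X + κ 5) ^ 39 * (X - κ 13) ^ 8 * (X - κ 9) ^ 8 * (X ^ 2 - κ 19 * X + κ 72)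
      ⊎ charPoly S ≋ (X + κ 5) ^ 39 * (X - κ 13) ^ 6 * (X - κ 9) ^ 6 * (X - κ 11) * (X - κ 12) * (X ^ 2 - κ 20 * X + κ 87) ^ 2
    charPoly-lines = Sum.map lines₁ lines₂ (K₆-charPoly a b c)

-- A normal form for the vectors of the lattice

module Gluing where
  open import Data.Fin.Base using (suc)
  open import Data.Integer.Base using (+_)
  open import Data.Nat.Base using (suc)
  open import Data.Vec.Base using ([]; _∷_; lookup; _++_; take; drop)
  open import Relation.Binary.PropositionalEquality
  open import Relation.Unary using (_∈_; _⊆_)
  open import Defs
  open Vertices
  open Vectors
  open SylvesterReduction using (1/6)

  total : ∀ {n} → Vec ℤ n → ℤ
  total = Vec.foldr′ ℤ._+_ (+ 0)

  -- The elements of the coset of A₅ containing k α₅ are these vectors with total p ≡ k.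
  coset : ∀ {n} → ℤ → Vec ℤ n → V n
  coset k p = Vec.map (λ z → ι (k ℤ.- + 6 ℤ.* z) ℚ.* 1/6) p

  halves : ℤ → V 2
  halves m = ι m ℚ.* ½ ∷ ι (ℤ.- m) ℚ.* ½ ∷ []

  coset-+ : ∀ {n} k k′ (p p′ : Vec ℤ n) → coset k p ⊹ coset k′ p′ ≡ coset (k ℤ.+ k′) (Vec.zipWith ℤ._+_ p p′)
  coset-+ k k′ []      []        = refl
  coset-+ k k′ (z ∷ p) (z′ ∷ p′) = cong₂ _∷_
    (trans (scaled-+ (k ℤ.- + 6 ℤ.* z) (k′ ℤ.- + 6 ℤ.* z′) 1/6) (cong (λ i → ι i ℚ.* 1/6) (regroup k k′ z z′))) (coset-+ k k′ p p′)
    where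
    regroup : ∀ k k′ z z′ → (k ℤ.- + 6 ℤ.* z) ℤ.+ (k′ ℤ.- + 6 ℤ.* z′) ≡ (k ℤ.+ k′) ℤ.- + 6 ℤ.* (z ℤ.+ z′)
    regroup = solve-∀

  ι-neg-* : ∀ x c → ℚ.- (ι x ℚ.* c) ≡ ι (ℤ.- x) ℚ.* c
  ι-neg-* x c = trans (ℚ.neg-distribˡ-* (ι x) c) (cong (ℚ._* c) (sym (ι-neg x)))

  coset-neg : ∀ {n} k (p : Vec ℤ n) → neg (coset k p) ≡ coset (ℤ.- k) (Vec.map ℤ.-_ p)
  coset-neg k []      = refl
  coset-neg k (z ∷ p) = cong₂ _∷_ (trans (ι-neg-* (k ℤ.- + 6 ℤ.* z) 1/6) (cong (λ i → ι i ℚ.* 1/6) (regroup k z))) (coset-neg k p)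
    where
    regroup : ∀ k z → ℤ.- (k ℤ.- + 6 ℤ.* z) ≡ ℤ.- k ℤ.- + 6 ℤ.* ℤ.- z
    regroup = solve-∀

  halves-+ : ∀ m m′ → halves m ⊹ halves m′ ≡ halves (m ℤ.+ m′)
  halves-+ m m′ = cong₂ (λ x y → x ∷ y ∷ []) (scaled-+ m m′ ½)
    (trans (scaled-+ (ℤ.- m) (ℤ.- m′) ½) (cong (λ i → ι i ℚ.* ½) (sym (ℤ.neg-distrib-+ m m′))))

  halves-neg : ∀ m → neg (halves m) ≡ halves (ℤ.- m)
  halves-neg m = cong₂ (λ x y → x ∷ y ∷ []) (ι-neg-* m ½) (ι-neg-* (ℤ.- m) ½)

  total-+ : ∀ {n} (p p′ : Vec ℤ n) → total (Vec.zipWith ℤ._+_ p p′) ≡ total p ℤ.+ total p′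
  total-+ []      []        = refl
  total-+ (z ∷ p) (z′ ∷ p′) = trans (cong (λ s → z ℤ.+ z′ ℤ.+ s) (total-+ p p′)) (regroup z z′ (total p) (total p′))
    where
    regroup : ∀ a b c d → a ℤ.+ b ℤ.+ (c ℤ.+ d) ≡ (a ℤ.+ c) ℤ.+ (b ℤ.+ d)
    regroup = solve-∀

  total-neg : ∀ {n} (p : Vec ℤ n) → total (Vec.map ℤ.-_ p) ≡ ℤ.- total p
  total-neg []      = refl
  total-neg (z ∷ p) = trans (cong (λ s → ℤ.- z ℤ.+ s) (total-neg p)) (sym (ℤ.neg-distrib-+ z (total p)))

  module _ (m : Fin 4 → ℤ) where
    halves₂ : V 4
    halves₂ = halves (m 2F) ++ halves (m 3F)

    halves₁ : V 6
    halves₁ = halves (m 1F) ++ halves₂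

    halves₀ : V 8
    halves₀ = halves (m 0F) ++ halves₁

  module _ (k : Fin 3 → ℤ) (p : Fin 3 → Vec ℤ 6) (m : Fin 4 → ℤ) where
    cosets₂ : V 14
    cosets₂ = coset (k 2F) (p 2F) ++ halves₀ m

    cosets₁ : V 20
    cosets₁ = coset (k 1F) (p 1F) ++ cosets₂

    assemble : V 26
    assemble = coset (k 0F) (p 0F) ++ cosets₁

  -- The A₅ components, in multiples of α₅, of the combination of `β₀`, `β₁`, `β₂`, `β₃` with
  -- coefficients `c`; `glue₁` gives its A₁ components in multiples of α₁.
  glue₅ : (Fin 4 → ℤ) → Fin 3 → ℤ
  glue₅ c t = c 0F ℤ.+ + 3 ℤ.* c (suc t)

  glue₁ : (Fin 4 → ℤ) → Fin 4 → ℤ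
  glue₁ c 0F = c 2F ℤ.+ c 3F
  glue₁ c 1F = c 1F ℤ.+ c 3F
  glue₁ c 2F = c 1F ℤ.+ c 2F
  glue₁ c 3F = c 0F ℤ.+ (c 1F ℤ.+ (c 2F ℤ.+ c 3F))

  -- A combination of the glue vectors plus a vector of `Λ`. The A₁ parts of the latter are absorbed
  -- by `y`, as `halves (2 y)` is (y, -y); in an A₅ block `p≡` says that the coordinates sum to
  -- zero.
  record Glued (u : V 26) : Set where
    constructor glued
    field
      c  : Fin 4 → ℤ
      p  : Fin 3 → Vec ℤ 6
      y  : Fin 4 → ℤ
      p≡ : ∀ t → total (p t) ≡ glue₅ c t
      u≡ : u ≡ assemble (glue₅ c) p (λ τ → + 2 ℤ.* y τ ℤ.+ glue₁ c τ)

  assemble-+ : ∀ k k′ p p′ m m′ → assemble k p m ⊹ assemble k′ p′ m′ ≡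
    assemble (λ t → k t ℤ.+ k′ t) (λ t → Vec.zipWith ℤ._+_ (p t) (p′ t)) (λ τ → m τ ℤ.+ m′ τ)
  assemble-+ k k′ p p′ m m′ =
    coset-step 0F (cosets₁ k p m) (cosets₁ k′ p′ m′) (coset-step 1F (cosets₂ k p m) (cosets₂ k′ p′ m′)
    (coset-step 2F (halves₀ m) (halves₀ m′) (halves-step 0F (halves₁ m) (halves₁ m′)
    (halves-step 1F (halves₂ m) (halves₂ m′) (halves-step 2F (halves (m 3F)) (halves (m′ 3F)) (halves-+ (m 3F) (m′ 3F)))))))
    where
    coset-step : ∀ t {n} (y y′ : V n) {z} → y ⊹ y′ ≡ z → (coset (k t) (p t) ++ y) ⊹ (coset (k′ t) (p′ t) ++ y′) ≡
      coset (k t ℤ.+ k′ t) (Vec.zipWith ℤ._+_ (p t) (p′ t)) ++ z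
    coset-step t y y′ eq = trans (Vec.zipWith-++ ℚ._+_ (coset (k t) (p t)) y (coset (k′ t) (p′ t)) y′)
      (cong₂ _++_ (coset-+ (k t) (k′ t) (p t) (p′ t)) eq)
    halves-step : ∀ τ {n} (y y′ : V n) {z} → y ⊹ y′ ≡ z → (halves (m τ) ++ y) ⊹ (halves (m′ τ) ++ y′) ≡ halves (m τ ℤ.+ m′ τ) ++ z
    halves-step τ y y′ eq = trans (Vec.zipWith-++ ℚ._+_ (halves (m τ)) y (halves (m′ τ)) y′) (cong₂ _++_ (halves-+ (m τ) (m′ τ)) eq)

  assemble-neg : ∀ k p m → neg (assemble k p m) ≡ assemble (λ t → ℤ.- k t) (λ t → Vec.map ℤ.-_ (p t)) (λ τ → ℤ.- m τ)
  assemble-neg k p m =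
    coset-step 0F (cosets₁ k p m) (coset-step 1F (cosets₂ k p m) (coset-step 2F (halves₀ m)
    (halves-step 0F (halves₁ m) (halves-step 1F (halves₂ m) (halves-step 2F (halves (m 3F)) (halves-neg (m 3F)))))))
    where
    coset-step : ∀ t {n} (y : V n) {z} → neg y ≡ z → neg (coset (k t) (p t) ++ y) ≡ coset (ℤ.- k t) (Vec.map ℤ.-_ (p t)) ++ z
    coset-step t y eq = trans (Vec.map-++ (λ q → ℚ.- q) (coset (k t) (p t)) y) (cong₂ _++_ (coset-neg (k t) (p t)) eq)
    halves-step : ∀ τ {n} (y : V n) {z} → neg y ≡ z → neg (halves (m τ) ++ y) ≡ halves (ℤ.- m τ) ++ z
    halves-step τ y eq = trans (Vec.map-++ (λ q → ℚ.- q) (halves (m τ)) y) (cong₂ _++_ (halves-neg (m τ)) eq)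

  assemble-cong : ∀ {k k′ m m′} p → (∀ t → k t ≡ k′ t) → (∀ τ → m τ ≡ m′ τ) → assemble k p m ≡ assemble k′ p m′
  assemble-cong p k≡ m≡ =
    cong₂ _++_ (cong (λ k → coset k (p 0F)) (k≡ 0F)) (cong₂ _++_ (cong (λ k → coset k (p 1F)) (k≡ 1F)) (cong₂ _++_ (cong (λ k → coset k (p 2F)) (k≡ 2F))
    (cong₂ _++_ (cong halves (m≡ 0F)) (cong₂ _++_ (cong halves (m≡ 1F)) (cong₂ _++_ (cong halves (m≡ 2F)) (cong halves (m≡ 3F)))))))

  glued-+ : ∀ {u v} → Glued u → Glued v → Glued (u ⊹ v)
  glued-+ (glued c p y p≡ u≡) (glued c′ p′ y′ p′≡ v≡) = record
    { c  = λ i → c i ℤ.+ c′ i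
    ; p  = λ t → Vec.zipWith ℤ._+_ (p t) (p′ t)
    ; y  = λ τ → y τ ℤ.+ y′ τ
    ; p≡ = λ t → trans (total-+ (p t) (p′ t)) (trans (cong₂ ℤ._+_ (p≡ t) (p′≡ t)) (add₅ (c 0F) (c (suc t)) (c′ 0F) (c′ (suc t))))
    ; u≡ = trans (cong₂ _⊹_ u≡ v≡) (trans (assemble-+ (glue₅ c) (glue₅ c′) p p′ (λ τ → + 2 ℤ.* y τ ℤ.+ glue₁ c τ) (λ τ → + 2 ℤ.* y′ τ ℤ.+ glue₁ c′ τ))
        (assemble-cong (λ t → Vec.zipWith ℤ._+_ (p t) (p′ t)) (λ t → add₅ (c 0F) (c (suc t)) (c′ 0F) (c′ (suc t))) add₁))
    }
    where
    add₅ : ∀ a b a′ b′ → a ℤ.+ + 3 ℤ.* b ℤ.+ (a′ ℤ.+ + 3 ℤ.* b′) ≡ a ℤ.+ a′ ℤ.+ + 3 ℤ.* (b ℤ.+ b′)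
    add₅ = solve-∀
    two : ∀ y y′ a b a′ b′ → + 2 ℤ.* y ℤ.+ (a ℤ.+ b) ℤ.+ (+ 2 ℤ.* y′ ℤ.+ (a′ ℤ.+ b′)) ≡ + 2 ℤ.* (y ℤ.+ y′) ℤ.+ (a ℤ.+ a′ ℤ.+ (b ℤ.+ b′))
    two = solve-∀
    four : ∀ y y′ a b e d a′ b′ e′ d′ → + 2 ℤ.* y ℤ.+ (a ℤ.+ (b ℤ.+ (e ℤ.+ d))) ℤ.+ (+ 2 ℤ.* y′ ℤ.+ (a′ ℤ.+ (b′ ℤ.+ (e′ ℤ.+ d′)))) ≡
      + 2 ℤ.* (y ℤ.+ y′) ℤ.+ (a ℤ.+ a′ ℤ.+ (b ℤ.+ b′ ℤ.+ (e ℤ.+ e′ ℤ.+ (d ℤ.+ d′))))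
    four = solve-∀
    add₁ : ∀ τ → + 2 ℤ.* y τ ℤ.+ glue₁ c τ ℤ.+ (+ 2 ℤ.* y′ τ ℤ.+ glue₁ c′ τ) ≡ + 2 ℤ.* (y τ ℤ.+ y′ τ) ℤ.+ glue₁ (λ i → c i ℤ.+ c′ i) τ
    add₁ 0F = two (y 0F) (y′ 0F) (c 2F) (c 3F) (c′ 2F) (c′ 3F)
    add₁ 1F = two (y 1F) (y′ 1F) (c 1F) (c 3F) (c′ 1F) (c′ 3F)
    add₁ 2F = two (y 2F) (y′ 2F) (c 1F) (c 2F) (c′ 1F) (c′ 2F)
    add₁ 3F = four (y 3F) (y′ 3F) (c 0F) (c 1F) (c 2F) (c 3F) (c′ 0F) (c′ 1F) (c′ 2F) (c′ 3F)

  glued-neg : ∀ {u} → Glued u → Glued (neg u)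
  glued-neg (glued c p y p≡ u≡) = record
    { c  = λ i → ℤ.- c i
    ; p  = λ t → Vec.map ℤ.-_ (p t)
    ; y  = λ τ → ℤ.- y τ
    ; p≡ = λ t → trans (total-neg (p t)) (trans (cong ℤ.-_ (p≡ t)) (neg₅ (c 0F) (c (suc t))))
    ; u≡ = trans (cong neg u≡) (trans (assemble-neg (glue₅ c) p (λ τ → + 2 ℤ.* y τ ℤ.+ glue₁ c τ))
        (assemble-cong (λ t → Vec.map ℤ.-_ (p t)) (λ t → neg₅ (c 0F) (c (suc t))) neg₁))
    }
    where
    neg₅ : ∀ a b → ℤ.- (a ℤ.+ + 3 ℤ.* b) ≡ ℤ.- a ℤ.+ + 3 ℤ.* ℤ.- b
    neg₅ = solve-∀
    two : ∀ y a b → ℤ.- (+ 2 ℤ.* y ℤ.+ (a ℤ.+ b)) ≡ + 2 ℤ.* ℤ.- y ℤ.+ (ℤ.- a ℤ.+ ℤ.- b)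
    two = solve-∀
    four : ∀ y a b e d → ℤ.- (+ 2 ℤ.* y ℤ.+ (a ℤ.+ (b ℤ.+ (e ℤ.+ d)))) ≡ + 2 ℤ.* ℤ.- y ℤ.+ (ℤ.- a ℤ.+ (ℤ.- b ℤ.+ (ℤ.- e ℤ.+ ℤ.- d)))
    four = solve-∀
    neg₁ : ∀ τ → ℤ.- (+ 2 ℤ.* y τ ℤ.+ glue₁ c τ) ≡ + 2 ℤ.* ℤ.- y τ ℤ.+ glue₁ (λ i → ℤ.- c i) τ
    neg₁ 0F = two (y 0F) (c 2F) (c 3F)
    neg₁ 1F = two (y 1F) (c 1F) (c 3F)
    neg₁ 2F = two (y 2F) (c 1F) (c 2F)
    neg₁ 3F = four (y 3F) (c 0F) (c 1F) (c 2F) (c 3F)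

  module _ where
    private
      0⁶ 1⁶ 3⁶ : Vec ℤ 6
      0⁶ = Vec.replicate 6 0ℤ
      1⁶ = Vec.replicate 5 0ℤ Vec.∷ʳ 1ℤ
      3⁶ = Vec.replicate 5 0ℤ Vec.∷ʳ + 3

    glued-0 : Glued 𝟎
    glued-0 = glued (λ _ → 0ℤ) (λ _ → 0⁶) (λ _ → 0ℤ) (λ _ → refl) refl

    glued-β₀ : Glued β₀
    glued-β₀ = glued (lookup (1ℤ ∷ 0ℤ ∷ 0ℤ ∷ 0ℤ ∷ [])) (λ _ → 1⁶) (λ _ → 0ℤ) (λ { 0F → refl ; 1F → refl ; 2F → refl }) refl

    glued-β₁ : Glued β₁
    glued-β₁ = glued (lookup (0ℤ ∷ 1ℤ ∷ 0ℤ ∷ 0ℤ ∷ [])) (lookup (3⁶ ∷ 0⁶ ∷ 0⁶ ∷ [])) (λ _ → 0ℤ) (λ { 0F → refl ; 1F → refl ; 2F → refl }) refl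

    glued-β₂ : Glued β₂
    glued-β₂ = glued (lookup (0ℤ ∷ 0ℤ ∷ 1ℤ ∷ 0ℤ ∷ [])) (lookup (0⁶ ∷ 3⁶ ∷ 0⁶ ∷ [])) (λ _ → 0ℤ) (λ { 0F → refl ; 1F → refl ; 2F → refl }) refl

    glued-β₃ : Glued β₃
    glued-β₃ = glued (lookup (0ℤ ∷ 0ℤ ∷ 0ℤ ∷ 1ℤ ∷ [])) (lookup (0⁶ ∷ 0⁶ ∷ 3⁶ ∷ [])) (λ _ → 0ℤ) (λ { 0F → refl ; 1F → refl ; 2F → refl }) refl

  A₅-coset : ∀ {x} → x ∈ A 5 → ∃[ p ] x ≡ coset 0ℤ p × total p ≡ 0ℤ
  A₅-coset (z , refl , z≡0) = Vec.map ℤ.-_ z , trans (Vec.map-cong integral z) (Vec.map-∘ _ ℤ.-_ z) , trans (total-neg z) (cong ℤ.-_ z≡0)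
    where
    integral : ∀ i → i / 1 ≡ ι (0ℤ ℤ.- + 6 ℤ.* ℤ.- i) ℚ.* 1/6
    integral i = sym (trans (cong (λ j → ι j ℚ.* 1/6) (simplify i)) (trans (cong (ℚ._* 1/6) (ι-* i (+ 6)))
      (trans (ℚ.*-assoc (ι i) (ι (+ 6)) 1/6) (ℚ.*-identityʳ (ι i)))))
      where
      simplify : ∀ i → 0ℤ ℤ.- + 6 ℤ.* ℤ.- i ≡ i ℤ.* + 6
      simplify = solve-∀

  A₁-halves : ∀ {x} → x ∈ A 1 → ∃[ y ] x ≡ halves (+ 2 ℤ.* y ℤ.+ 0ℤ)
  A₁-halves (i ∷ j ∷ [] , refl , i+j≡0) = i , cong₂ (λ x y → x ∷ y ∷ []) (half i)
    (trans (cong ι j≡-i) (trans (half (ℤ.- i)) (cong (λ k → ι k ℚ.* ½) (move i))))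
    where
    half : ∀ i → ι i ≡ ι (+ 2 ℤ.* i ℤ.+ 0ℤ) ℚ.* ½
    half i = sym (trans (cong (λ k → ι k ℚ.* ½) (swap i)) (trans (cong (ℚ._* ½) (ι-* i (+ 2)))
      (trans (ℚ.*-assoc (ι i) (ι (+ 2)) ½) (ℚ.*-identityʳ (ι i)))))
      where
      swap : ∀ i → + 2 ℤ.* i ℤ.+ 0ℤ ≡ i ℤ.* + 2
      swap = solve-∀
    move : ∀ i → + 2 ℤ.* ℤ.- i ℤ.+ 0ℤ ≡ ℤ.- (+ 2 ℤ.* i ℤ.+ 0ℤ)
    move = solve-∀
    j≡-i : j ≡ ℤ.- i
    j≡-i = trans (solve′ i j) (trans (cong (λ s → s ℤ.- i) i+j≡0) (ℤ.+-identityˡ (ℤ.- i)))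
      where
      solve′ : ∀ i j → j ≡ i ℤ.+ (j ℤ.+ 0ℤ) ℤ.- i
      solve′ = solve-∀

  glued-Λ : ∀ {x} → x ∈ Λ → Glued x
  glued-Λ {x} (a₁ , a₂ , a₃ , b₀ , b₁ , b₂ , b₃) = record
    { c  = λ _ → 0ℤ
    ; p  = λ { 0F → proj₁ (A₅-coset a₁) ; 1F → proj₁ (A₅-coset a₂) ; 2F → proj₁ (A₅-coset a₃) }
    ; y  = λ { 0F → proj₁ (A₁-halves b₀) ; 1F → proj₁ (A₁-halves b₁) ; 2F → proj₁ (A₁-halves b₂) ; 3F → proj₁ (A₁-halves b₃) }
    ; p≡ = λ { 0F → proj₂ (proj₂ (A₅-coset a₁)) ; 1F → proj₂ (proj₂ (A₅-coset a₂)) ; 2F → proj₂ (proj₂ (A₅-coset a₃)) }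
    ; u≡ = split 6 x (proj₁ (proj₂ (A₅-coset a₁))) (split 6 _ (proj₁ (proj₂ (A₅-coset a₂))) (split 6 _ (proj₁ (proj₂ (A₅-coset a₃)))
        (split 2 _ (proj₂ (A₁-halves b₀)) (split 2 _ (proj₂ (A₁-halves b₁)) (split 2 _ (proj₂ (A₁-halves b₂)) (proj₂ (A₁-halves b₃)))))))
    }
    where
    split : ∀ m {n} (x : V (m ℕ.+ n)) {y z} → take m x ≡ y → drop m x ≡ z → x ≡ y ++ z
    split m x refl refl = sym (Vec.take++drop≡id m x)

  L⇒glued : L ⊆ Glued
  L⇒glued (gen (inj₁ x∈Λ))                             = glued-Λ x∈Λ
  L⇒glued (gen (inj₂ (inj₁ refl)))                     = glued-β₀
  L⇒glued (gen (inj₂ (inj₂ (inj₁ refl))))              = glued-β₁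
  L⇒glued (gen (inj₂ (inj₂ (inj₂ (inj₁ refl)))))       = glued-β₂
  L⇒glued (gen (inj₂ (inj₂ (inj₂ (inj₂ refl)))))       = glued-β₃
  L⇒glued 0-cl                                         = glued-0
  L⇒glued (+-cl x∈L y∈L)                               = glued-+ (L⇒glued x∈L) (L⇒glued y∈L)
  L⇒glued (neg-cl x∈L)                                 = glued-neg (L⇒glued x∈L)

-- Norms in the cosets of the root lattice, and the minimality of norm 3

module Minimality where
  open import Data.Fin.Base using (zero; suc)
  open import Data.Fin.Properties using (all?)
  open import Data.Integer.Base using (+_)
  open import Data.Nat.Base using (zero; suc)
  open import Data.Vec.Base using ([]; _∷_; lookup; _++_)
  open import Relation.Binary.PropositionalEquality
  open import Algebra.Properties.Semiring.Sum ℤ.+-*-semiring using () renaming (sum to sumℤ)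
  open import Defs
  open Vertices
  open Lines
  open Vectors
  open SylvesterReduction using (1/6)
  open Gluing

  1/36 : ℚ
  1/36 = + 1 / 36

  squares : ∀ {n} → ℤ → Vec ℤ n → ℤ
  squares k p = total (Vec.map (λ z → (k ℤ.- + 6 ℤ.* z) ℤ.* (k ℤ.- + 6 ℤ.* z)) p)

  coset-norm : ∀ {n} k (p : Vec ℤ n) → ⟪ coset k p , coset k p ⟫ ≡ ι (squares k p) ℚ.* 1/36
  coset-norm k []      = refl
  coset-norm k (z ∷ p) = trans (cong₂ ℚ._+_ (scaled-* w w 1/6 1/6) (coset-norm k p)) (scaled-+ (w ℤ.* w) (squares k p) 1/36)
    where w = k ℤ.- + 6 ℤ.* z

  halves-norm : ∀ m → ⟪ halves m , halves m ⟫ ≡ ι (+ 18 ℤ.* (m ℤ.* m)) ℚ.* 1/36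
  halves-norm m = begin
    ι m ℚ.* ½ ℚ.* (ι m ℚ.* ½) ℚ.+ (ι (ℤ.- m) ℚ.* ½ ℚ.* (ι (ℤ.- m) ℚ.* ½) ℚ.+ 0ℚ)
      ≡⟨ cong₂ ℚ._+_ (scaled-* m m ½ ½) (trans (ℚ.+-identityʳ _) (scaled-* (ℤ.- m) (ℤ.- m) ½ ½)) ⟩
    ι (m ℤ.* m) ℚ.* (+ 1 / 4) ℚ.+ ι (ℤ.- m ℤ.* ℤ.- m) ℚ.* (+ 1 / 4)
      ≡⟨ scaled-+ (m ℤ.* m) (ℤ.- m ℤ.* ℤ.- m) (+ 1 / 4) ⟩
    ι (m ℤ.* m ℤ.+ ℤ.- m ℤ.* ℤ.- m) ℚ.* (ι (+ 9) ℚ.* 1/36)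
      ≡⟨ ℚ.*-assoc (ι (m ℤ.* m ℤ.+ ℤ.- m ℤ.* ℤ.- m)) (ι (+ 9)) 1/36 ⟨
    ι (m ℤ.* m ℤ.+ ℤ.- m ℤ.* ℤ.- m) ℚ.* ι (+ 9) ℚ.* 1/36
      ≡⟨ cong (ℚ._* 1/36) (trans (sym (ι-* (m ℤ.* m ℤ.+ ℤ.- m ℤ.* ℤ.- m) (+ 9))) (cong ι (regroup m))) ⟩
    ι (+ 18 ℤ.* (m ℤ.* m)) ℚ.* 1/36 ∎
    where
    open ≡-Reasoning
    regroup : ∀ m → (m ℤ.* m ℤ.+ ℤ.- m ℤ.* ℤ.- m) ℤ.* + 9 ≡ + 18 ℤ.* (m ℤ.* m)
    regroup = solve-∀

  module _ (k : Fin 3 → ℤ) (p : Fin 3 → Vec ℤ 6) (m : Fin 4 → ℤ) where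
    private
      split : ∀ {m n} (x x′ : V m) (y y′ : V n) {a b} → ⟪ x , x′ ⟫ ≡ a → ⟪ y , y′ ⟫ ≡ b → ⟪ x ++ y , x′ ++ y′ ⟫ ≡ a ℚ.+ b
      split x x′ y y′ refl refl = ⟪++⟫ x x′ y y′

      n₆ = + 18 ℤ.* (m 3F ℤ.* m 3F)
      n₅ = + 18 ℤ.* (m 2F ℤ.* m 2F) ℤ.+ n₆
      n₄ = + 18 ℤ.* (m 1F ℤ.* m 1F) ℤ.+ n₅
      n₃ = + 18 ℤ.* (m 0F ℤ.* m 0F) ℤ.+ n₄
      n₂ = squares (k 2F) (p 2F) ℤ.+ n₃
      n₁ = squares (k 1F) (p 1F) ℤ.+ n₂

    assemble-norm : ⟪ assemble k p m , assemble k p m ⟫ ≡ ι (squares (k 0F) (p 0F) ℤ.+ n₁) ℚ.* 1/36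
    assemble-norm = coset-add 0F (cosets₁ k p m) n₁ (coset-add 1F (cosets₂ k p m) n₂ (coset-add 2F (halves₀ m) n₃
      (halves-add 0F (halves₁ m) n₄ (halves-add 1F (halves₂ m) n₅ (halves-add 2F (halves (m 3F)) n₆ (halves-norm (m 3F)))))))
      where
      coset-add : ∀ t {n} (y : V n) b → ⟪ y , y ⟫ ≡ ι b ℚ.* 1/36 →
        ⟪ coset (k t) (p t) ++ y , coset (k t) (p t) ++ y ⟫ ≡ ι (squares (k t) (p t) ℤ.+ b) ℚ.* 1/36
      coset-add t y b eq = trans (split (coset (k t) (p t)) (coset (k t) (p t)) y y (coset-norm (k t) (p t)) eq)
        (scaled-+ (squares (k t) (p t)) b 1/36)
      halves-add : ∀ τ {n} (y : V n) b → ⟪ y , y ⟫ ≡ ι b ℚ.* 1/36 →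
        ⟪ halves (m τ) ++ y , halves (m τ) ++ y ⟫ ≡ ι (+ 18 ℤ.* (m τ ℤ.* m τ) ℤ.+ b) ℚ.* 1/36
      halves-add τ y b eq = trans (split (halves (m τ)) (halves (m τ)) y y (halves-norm (m τ)) eq)
        (scaled-+ (+ 18 ℤ.* (m τ ℤ.* m τ)) b 1/36)

    assemble-root : ⟪ assemble k p m , ρ ⟫ ≡ ι (m 3F)
    assemble-root =
      trans (skip (coset (k 0F) (p 0F)) (cosets₁ k p m) ρ₁) (trans (skip (coset (k 1F) (p 1F)) (cosets₂ k p m) ρ₂)
      (trans (skip (coset (k 2F) (p 2F)) (halves₀ m) ρ₃) (trans (skip (halves (m 0F)) (halves₁ m) ρ₄)
      (trans (skip (halves (m 1F)) (halves₂ m) ρ₅) (trans (skip (halves (m 2F)) (halves (m 3F)) ρ₆) last)))))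
      where
      ρ₆ : V 2
      ρ₆ = ι 1ℤ ∷ ι -1ℤ ∷ []
      ρ₅ : V 4
      ρ₅ = 𝟎 {2} ++ ρ₆
      ρ₄ : V 6
      ρ₄ = 𝟎 {2} ++ ρ₅
      ρ₃ : V 8
      ρ₃ = 𝟎 {2} ++ ρ₄
      ρ₂ : V 14
      ρ₂ = 𝟎 {6} ++ ρ₃
      ρ₁ : V 20
      ρ₁ = 𝟎 {6} ++ ρ₂
      orthogonal : ∀ {n} (x : V n) → ⟪ x , 𝟎 ⟫ ≡ 0ℚ
      orthogonal []      = refl
      orthogonal (a ∷ x) = trans (cong₂ ℚ._+_ (ℚ.*-zeroʳ a) (orthogonal x)) refl
      skip : ∀ {m n} (x : V m) (y y′ : V n) → ⟪ x ++ y , 𝟎 {m} ++ y′ ⟫ ≡ ⟪ y , y′ ⟫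
      skip x y y′ = trans (split x 𝟎 y y′ (orthogonal x) refl) (ℚ.+-identityˡ _)
      last : ⟪ halves (m 3F) , ι 1ℤ ∷ ι -1ℤ ∷ [] ⟫ ≡ ι (m 3F)
      last = begin
        ι (m 3F) ℚ.* ½ ℚ.* ι 1ℤ ℚ.+ (ι (ℤ.- m 3F) ℚ.* ½ ℚ.* ι -1ℤ ℚ.+ 0ℚ)
          ≡⟨ cong₂ ℚ._+_ (ℚ.*-assoc (ι (m 3F)) ½ (ι 1ℤ)) (trans (ℚ.+-identityʳ _) (trans (ℚ.*-assoc (ι (ℤ.- m 3F)) ½ (ι -1ℤ))
               (trans (cong (ℚ._* (ℚ.- ½)) (ι-neg (m 3F))) (trans (sym (ℚ.neg-distribˡ-* (ι (m 3F)) (ℚ.- ½))) (ℚ.neg-distribʳ-* (ι (m 3F)) (ℚ.- ½)))))) ⟩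
        ι (m 3F) ℚ.* ½ ℚ.+ ι (m 3F) ℚ.* ½
          ≡⟨ ℚ.*-distribˡ-+ (ι (m 3F)) ½ ½ ⟨
        ι (m 3F) ℚ.* 1ℚ
          ≡⟨ ℚ.*-identityʳ (ι (m 3F)) ⟩
        ι (m 3F) ∎
        where open ≡-Reasoning

  shift : ∀ {n} → ℤ → Vec ℤ n → Vec ℤ n
  shift a = Vec.map (λ z → z ℤ.- a)

  -- A class matters only modulo 6: changing its representative by a multiple of 6 translates the
  -- integral part.
  coset-shift : ∀ {n} r a (p : Vec ℤ n) → coset (r ℤ.+ a ℤ.* + 6) p ≡ coset r (shift a p)
  coset-shift r a p = trans (Vec.map-cong (λ z → cong (λ i → ι i ℚ.* 1/6) (regroup r a z)) p) (Vec.map-∘ _ (λ z → z ℤ.- a) p)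
    where
    regroup : ∀ r a z → r ℤ.+ a ℤ.* + 6 ℤ.- + 6 ℤ.* z ≡ r ℤ.- + 6 ℤ.* (z ℤ.- a)
    regroup = solve-∀

  total-shift : ∀ {n} a (p : Vec ℤ n) → total (shift a p) ≡ total p ℤ.- a ℤ.* + n
  total-shift a []      = solve′ a
    where
    solve′ : ∀ a → 0ℤ ≡ 0ℤ ℤ.- a ℤ.* 0ℤ
    solve′ = solve-∀
  total-shift {suc n} a (z ∷ p) = trans (cong (λ s → z ℤ.- a ℤ.+ s) (total-shift a p)) (regroup z a (total p) (+ n))
    where
    regroup : ∀ z a s n → z ℤ.- a ℤ.+ (s ℤ.- a ℤ.* n) ≡ z ℤ.+ s ℤ.- a ℤ.* (1ℤ ℤ.+ n)
    regroup = solve-∀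

  -- z² - z as a natural number.
  excess : ℤ → ℕ
  excess (+ n)    = n ℕ.* (n ℕ.∸ 1)
  excess -[1+ n ] = suc n ℕ.* suc (suc n)

  square-excess : ∀ z → z ℤ.* z ≡ z ℤ.+ + excess z
  square-excess (+ zero)  = refl
  square-excess (+ suc n) = trans (sym (ℤ.pos-* (suc n) (suc n))) (cong +_ (cong (λ s → suc n ℕ.+ s) (ℕ.*-comm n (suc n))))
  square-excess -[1+ n ]  = trans (ℤ.pos-* (suc n) (suc n)) (trans (lemma (+ suc n))
    (cong (λ i → -[1+ n ] ℤ.+ i) (sym (ℤ.pos-* (suc n) (suc (suc n))))))
    where
    lemma : ∀ i → i ℤ.* i ≡ ℤ.- i ℤ.+ i ℤ.* (1ℤ ℤ.+ i)
    lemma = solve-∀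

  excess-0 : ∀ z → excess z ≡ 0 → z ≡ 0ℤ ⊎ z ≡ 1ℤ
  excess-0 (+ 0)           _ = inj₁ refl
  excess-0 (+ 1)           _ = inj₂ refl

  excesses : ∀ {n} → Vec ℤ n → ℕ
  excesses = Vec.foldr′ (λ z s → excess z ℕ.+ s) 0

  -- Expand the squares and write z² as z plus its excess. When `total p` equals `k` and there are
  -- six entries, this is 6 k (6 - k) plus 36 times the excess, so the natural number `excesses p`
  -- measures the distance from the least norm of the coset.
  squares-excess : ∀ {n} k (p : Vec ℤ n) → squares k p ≡
    + n ℤ.* (k ℤ.* k) ℤ.- + 12 ℤ.* k ℤ.* total p ℤ.+ + 36 ℤ.* (total p ℤ.+ + excesses p)
  squares-excess k []      = lemma k
    where
    lemma : ∀ k → 0ℤ ≡ 0ℤ ℤ.* (k ℤ.* k) ℤ.- + 12 ℤ.* k ℤ.* 0ℤ ℤ.+ + 36 ℤ.* (0ℤ ℤ.+ 0ℤ)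
    lemma = solve-∀
  squares-excess {suc n} k (z ∷ p) = begin
    (k ℤ.- + 6 ℤ.* z) ℤ.* (k ℤ.- + 6 ℤ.* z) ℤ.+ squares k p
      ≡⟨ cong₂ ℤ._+_ (expand k z) (squares-excess k p) ⟩
    (k ℤ.* k ℤ.- + 12 ℤ.* k ℤ.* z ℤ.+ + 36 ℤ.* (z ℤ.* z)) ℤ.+ (+ n ℤ.* (k ℤ.* k) ℤ.- + 12 ℤ.* k ℤ.* total p ℤ.+ + 36 ℤ.* (total p ℤ.+ + excesses p))
      ≡⟨ cong (λ s → (k ℤ.* k ℤ.- + 12 ℤ.* k ℤ.* z ℤ.+ + 36 ℤ.* s) ℤ.+ (+ n ℤ.* (k ℤ.* k) ℤ.- + 12 ℤ.* k ℤ.* total p ℤ.+ + 36 ℤ.* (total p ℤ.+ + excesses p))) (square-excess z) ⟩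
    (k ℤ.* k ℤ.- + 12 ℤ.* k ℤ.* z ℤ.+ + 36 ℤ.* (z ℤ.+ + excess z)) ℤ.+ (+ n ℤ.* (k ℤ.* k) ℤ.- + 12 ℤ.* k ℤ.* total p ℤ.+ + 36 ℤ.* (total p ℤ.+ + excesses p))
      ≡⟨ regroup k z (+ excess z) (+ n) (total p) (+ excesses p) ⟩
    (1ℤ ℤ.+ + n) ℤ.* (k ℤ.* k) ℤ.- + 12 ℤ.* k ℤ.* (z ℤ.+ total p) ℤ.+ + 36 ℤ.* (z ℤ.+ total p ℤ.+ (+ excess z ℤ.+ + excesses p))
      ≡⟨ cong (λ s → (1ℤ ℤ.+ + n) ℤ.* (k ℤ.* k) ℤ.- + 12 ℤ.* k ℤ.* (z ℤ.+ total p) ℤ.+ + 36 ℤ.* (z ℤ.+ total p ℤ.+ s)) (sym (ℤ.pos-+ (excess z) (excesses p))) ⟩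
    + suc n ℤ.* (k ℤ.* k) ℤ.- + 12 ℤ.* k ℤ.* (z ℤ.+ total p) ℤ.+ + 36 ℤ.* (z ℤ.+ total p ℤ.+ + (excess z ℕ.+ excesses p)) ∎
    where
    open ≡-Reasoning
    expand : ∀ k z → (k ℤ.- + 6 ℤ.* z) ℤ.* (k ℤ.- + 6 ℤ.* z) ≡ k ℤ.* k ℤ.- + 12 ℤ.* k ℤ.* z ℤ.+ + 36 ℤ.* (z ℤ.* z)
    expand = solve-∀
    regroup : ∀ k z x n s y → (k ℤ.* k ℤ.- + 12 ℤ.* k ℤ.* z ℤ.+ + 36 ℤ.* (z ℤ.+ x)) ℤ.+ (n ℤ.* (k ℤ.* k) ℤ.- + 12 ℤ.* k ℤ.* s ℤ.+ + 36 ℤ.* (s ℤ.+ y)) ≡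
      (1ℤ ℤ.+ n) ℤ.* (k ℤ.* k) ℤ.- + 12 ℤ.* k ℤ.* (z ℤ.+ s) ℤ.+ + 36 ℤ.* (z ℤ.+ s ℤ.+ (x ℤ.+ y))
    regroup = solve-∀

  -- Zero excess forces every entry to be 0 or 1, so the shortest vectors of an A₅ coset correspond
  -- to subsets.
  excesses-0 : ∀ {n} (p : Vec ℤ n) → excesses p ≡ 0 → ∃[ S ] p ≡ Vec.map side S × total p ≡ + ∣ S ∣
  excesses-0 []      _  = [] , refl , refl
  excesses-0 (z ∷ p) eq with excess-0 z (ℕ.m+n≡0⇒m≡0 (excess z) eq) | excesses-0 p (ℕ.m+n≡0⇒n≡0 (excess z) eq)
  ... | inj₁ refl | S , refl , s≡ = false ∷ S , refl , trans (ℤ.+-identityˡ _) s≡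
  ... | inj₂ refl | S , refl , s≡ = true ∷ S , refl , cong (λ s → 1ℤ ℤ.+ s) s≡

  -- For m = 2 y + d with d ∈ {0, 1}, this is (m² - d) / 4.
  excess₂ : Fin 2 → ℤ → ℕ
  excess₂ 0F y = ℤ.∣ y ∣ ℕ.* ℤ.∣ y ∣
  excess₂ 1F y = excess (ℤ.- y)

  abs-square : ∀ z → z ℤ.* z ≡ + (ℤ.∣ z ∣ ℕ.* ℤ.∣ z ∣)
  abs-square (+ n)    = sym (ℤ.pos-* n n)
  abs-square -[1+ n ] = refl

  square-excess₂ : ∀ d y → let m = + 2 ℤ.* y ℤ.+ + toℕ d in m ℤ.* m ≡ + toℕ d ℤ.+ + 4 ℤ.* + excess₂ d y
  square-excess₂ 0F y = trans (expand y) (cong (λ s → 0ℤ ℤ.+ + 4 ℤ.* s) (abs-square y))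
    where
    expand : ∀ y → (+ 2 ℤ.* y ℤ.+ 0ℤ) ℤ.* (+ 2 ℤ.* y ℤ.+ 0ℤ) ≡ 0ℤ ℤ.+ + 4 ℤ.* (y ℤ.* y)
    expand = solve-∀
  square-excess₂ 1F y = trans (expand y) (cong (λ s → 1ℤ ℤ.+ + 4 ℤ.* s)
    (trans (cong (λ s → y ℤ.+ s) (square-excess (ℤ.- y))) (cancel y (+ excess (ℤ.- y)))))
    where
    cancel : ∀ y e → y ℤ.+ (ℤ.- y ℤ.+ e) ≡ e
    cancel = solve-∀
    expand : ∀ y → (+ 2 ℤ.* y ℤ.+ 1ℤ) ℤ.* (+ 2 ℤ.* y ℤ.+ 1ℤ) ≡ 1ℤ ℤ.+ + 4 ℤ.* (y ℤ.+ ℤ.- y ℤ.* ℤ.- y)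
    expand = solve-∀

  -- The residue of c₀ + 3 c modulo 6, for the residues e of c₀ modulo 6 and d of c modulo 2.
  class : Fin 6 → Fin 2 → Fin 6
  class e d = (toℕ e ℕ.+ 3 ℕ.* toℕ d) ℕ.mod 6

  parity : Fin 2 → Fin 2 → Fin 2
  parity d d′ = (toℕ d ℕ.+ toℕ d′) ℕ.mod 2

  -- The residue of the coefficient of `β₀` modulo 6 and of the other three coefficients modulo 2;
  -- they determine the coset modulo `Λ`.
  Residues : Set
  Residues = Fin 6 × Fin 2 × Fin 2 × Fin 2

  classes : Residues → Fin 3 → Fin 6
  classes (e , d₁ , d₂ , d₃) = lookup (class e d₁ ∷ class e d₂ ∷ class e d₃ ∷ [])

  parities : Residues → Fin 3 → Fin 2
  parities (e , d₁ , d₂ , d₃) = lookup (parity d₂ d₃ ∷ parity d₁ d₃ ∷ parity d₁ d₂ ∷ [])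

  sumℕ : (Fin 3 → ℕ) → ℕ
  sumℕ f = f 0F ℕ.+ (f 1F ℕ.+ f 2F)

  -- A sixth of 36 times the least norm in the coset, without the last block.
  base : Residues → ℕ
  base r = sumℕ (λ t → toℕ (classes r t) ℕ.* (6 ℕ.∸ toℕ (classes r t))) ℕ.+ 3 ℕ.* sumℕ (λ τ → toℕ (parities r τ))

  -- The sum of the four glue coefficients has the parity of the inner product with `ρ`, which is 1
  -- for the vectors in question.
  Odd : Residues → Set
  Odd (e , d₁ , d₂ , d₃) = (toℕ e ℕ.+ (toℕ d₁ ℕ.+ (toℕ d₂ ℕ.+ toℕ d₃))) ℕ.% 2 ≡ 1

  data Kind (r : Residues) : Set where
    small : (∀ t → classes r t ≡ 1F) → (∀ τ → parities r τ ≡ 0F) → Kind r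
    large : (∀ t → classes r t ≡ 5F) → (∀ τ → parities r τ ≡ 0F) → Kind r
    half  : ∀ t → classes r t ≡ 3F → (∀ s → s ≢ t → classes r s ≡ 0F) → parities r t ≡ 0F → (∀ s → s ≢ t → parities r s ≡ 1F) → Kind r

  -- Decided on the 48 residues. The value 15 is norm 3, as 36 * 3 = 6 * 15 + 18, where 18 comes
  -- from the last A₁ block. Equality arises as 5 + 5 + 5 from three classes 1 or three classes 5,
  -- or as 9 + 3 + 3 from one class 3 and two odd A₁ blocks.
  base-minimal : ∀ r → Odd r → 15 ℕ.≤ base r × (base r ≡ 15 → Kind r)
  base-minimal (e , d₁ , d₂ , d₃) odd = proj₁ (check e d₁ d₂ d₃ odd) , kind ∘ proj₂ (check e d₁ d₂ d₃ odd)
    where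
    open import Relation.Nullary.Decidable using (¬?)
    Half : Residues → Fin 3 → Set
    Half r t = classes r t ≡ 3F × (∀ s → s ≢ t → classes r s ≡ 0F) × parities r t ≡ 0F × (∀ s → s ≢ t → parities r s ≡ 1F)
    Kind′ : Residues → Set
    Kind′ r = ((∀ t → classes r t ≡ 1F) × (∀ τ → parities r τ ≡ 0F)) ⊎ ((∀ t → classes r t ≡ 5F) × (∀ τ → parities r τ ≡ 0F)) ⊎
      ∃[ t ] Half r t
    kind : ∀ {r} → Kind′ r → Kind r
    kind (inj₁ (p , q))                         = small p q
    kind (inj₂ (inj₁ (p , q)))                  = large p q
    kind (inj₂ (inj₂ (t , p , q , p′ , q′)))    = half t p q p′ q′
    half? : ∀ r t → Dec (Half r t)
    half? r t = (classes r t Fin.≟ 3F) ×-dec all? (λ s → ¬? (s Fin.≟ t) →-dec (classes r s Fin.≟ 0F)) ×-dec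
      (parities r t Fin.≟ 0F) ×-dec all? (λ s → ¬? (s Fin.≟ t) →-dec (parities r s Fin.≟ 1F))
    kind? : ∀ r → Dec (Kind′ r)
    kind? r = (all? (λ t → classes r t Fin.≟ 1F) ×-dec all? (λ τ → parities r τ Fin.≟ 0F)) ⊎-dec
      (all? (λ t → classes r t Fin.≟ 5F) ×-dec all? (λ τ → parities r τ Fin.≟ 0F)) ⊎-dec Fin.any? (half? r)
    check : ∀ e d₁ d₂ d₃ → let r = e , d₁ , d₂ , d₃ in Odd r → 15 ℕ.≤ base r × (base r ≡ 15 → Kind′ r)
    check = toWitness {a? = all? λ e → all? λ d₁ → all? λ d₂ → all? λ d₃ → let r = e , d₁ , d₂ , d₃ in
      (_ ℕ.≟ 1) →-dec (15 ℕ.≤? base r ×-dec ((base r ℕ.≟ 15) →-dec kind? r))} tt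

-- Reduction of the glue coefficients to residues

module Reduction where
  open import Data.Fin.Base using (suc)
  open import Data.Integer.Base using (+_)
  open import Data.Nat.Base using (suc)
  open import Data.Vec.Base using (_++_)
  open import Relation.Binary.PropositionalEquality
  open import Defs
  open Vertices
  open Lines
  open Vectors
  open SylvesterReduction using (1/6)
  open Gluing
  open Minimality

  residueClass : Residues → Fin 3 → ℤ
  residueClass r t = + toℕ (classes r t)

  oddities : Residues → (Fin 3 → ℤ) → Fin 4 → ℤ
  oddities r y 0F = + 2 ℤ.* y 0F ℤ.+ + toℕ (parities r 0F)
  oddities r y 1F = + 2 ℤ.* y 1F ℤ.+ + toℕ (parities r 1F)
  oddities r y 2F = + 2 ℤ.* y 2F ℤ.+ + toℕ (parities r 2F)
  oddities r y 3F = 1ℤ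

  -- The normal form with classes from 0 to 5 and parities 0 or 1. The last A₁ component is 1, being
  -- the inner product with `ρ`.
  record Reduced (u : V 26) : Set where
    field
      r   : Residues
      odd : Odd r
      p   : Fin 3 → Vec ℤ 6
      y   : Fin 3 → ℤ
      p≡  : ∀ t → total (p t) ≡ residueClass r t
      u≡  : u ≡ assemble (residueClass r) p (oddities r y)

  toℕ-mod : ∀ m n .{{_ : ℕ.NonZero n}} → + m ≡ + toℕ (m ℕ.mod n) ℤ.+ + (m ℕ./ n) ℤ.* + n
  toℕ-mod m n = trans (cong +_ (trans (ℕ.m≡m%n+[m/n]*n m n) (cong (ℕ._+ m ℕ./ n ℕ.* n) (sym (toℕ-fromℕ< (ℕ.m%n<n m n))))))
    (trans (ℤ.pos-+ (toℕ (m ℕ.mod n)) (m ℕ./ n ℕ.* n)) (cong (λ i → + toℕ (m ℕ.mod n) ℤ.+ i) (ℤ.pos-* (m ℕ./ n) n)))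

  _mod′_ : ℤ → ∀ n .{{_ : ℕ.NonZero n}} → Fin n
  i mod′ n = fromℕ< (ℤ.n%ℕd<d i n)

  mod′-≡ : ∀ i n .{{_ : ℕ.NonZero n}} → i ≡ + toℕ (i mod′ n) ℤ.+ i ℤ./ℕ n ℤ.* + n
  mod′-≡ i n = trans (ℤ.a≡a%ℕn+[a/ℕn]*n i n) (cong (λ m → + m ℤ.+ i ℤ./ℕ n ℤ.* + n) (sym (toℕ-fromℕ< (ℤ.n%ℕd<d i n))))

  2*≢1 : ∀ z → + 2 ℤ.* z ≢ 1ℤ
  2*≢1 z eq = contradiction (trans (sym (ℤ.abs-* (+ 2) z)) (cong ℤ.∣_∣ eq)) (even≢1 ℤ.∣ z ∣)
    where
    even≢1 : ∀ n → 2 ℕ.* n ≢ 1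
    even≢1 (suc n) eq with () ← ℕ.suc-injective (trans (sym (ℕ.+-suc (suc n) (n ℕ.+ 0))) eq)

  module _ {u : V 26} (u-glued : Glued u) (u-root : ⟪ u , ρ ⟫ ≡ 1ℚ) where
    open Glued u-glued

    private
      e : Fin 6
      e = c 0F mod′ 6

      a : ℤ
      a = c 0F ℤ./ℕ 6

      d : Fin 3 → Fin 2
      d t = c (suc t) mod′ 2

      b : Fin 3 → ℤ
      b t = c (suc t) ℤ./ℕ 2

      r : Residues
      r = e , d 0F , d 1F , d 2F

      m : Fin 4 → ℤ
      m τ = + 2 ℤ.* y τ ℤ.+ glue₁ c τ

      -- The multiple of 6 split off from `glue₅ c t`: the carry of `e + 3 d`, the quotient of the
      -- coefficient of `β₀` by 6, and the quotient by 2 of the other coefficient, which enters with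
      -- the factor 3.
      quotient : Fin 3 → ℤ
      quotient t = + ((toℕ e ℕ.+ 3 ℕ.* toℕ (d t)) ℕ./ 6) ℤ.+ a ℤ.+ b t

      glue₅-≡ : ∀ t → glue₅ c t ≡ + toℕ (class e (d t)) ℤ.+ quotient t ℤ.* + 6
      glue₅-≡ t = begin
        c 0F ℤ.+ + 3 ℤ.* c (suc t)
          ≡⟨ cong₂ (λ i j → i ℤ.+ + 3 ℤ.* j) (mod′-≡ (c 0F) 6) (mod′-≡ (c (suc t)) 2) ⟩
        (+ toℕ e ℤ.+ a ℤ.* + 6) ℤ.+ + 3 ℤ.* (+ toℕ (d t) ℤ.+ b t ℤ.* + 2)
          ≡⟨ collect (+ toℕ e) a (+ toℕ (d t)) (b t) ⟩
        (+ toℕ e ℤ.+ + 3 ℤ.* + toℕ (d t)) ℤ.+ (a ℤ.+ b t) ℤ.* + 6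
          ≡⟨ cong (λ i → i ℤ.+ (a ℤ.+ b t) ℤ.* + 6) (trans (sym (trans (ℤ.pos-+ (toℕ e) (3 ℕ.* toℕ (d t))) (cong (λ i → + toℕ e ℤ.+ i) (ℤ.pos-* 3 (toℕ (d t))))))
               (toℕ-mod (toℕ e ℕ.+ 3 ℕ.* toℕ (d t)) 6)) ⟩
        (+ toℕ (class e (d t)) ℤ.+ q ℤ.* + 6) ℤ.+ (a ℤ.+ b t) ℤ.* + 6
          ≡⟨ recollect (+ toℕ (class e (d t))) q a (b t) ⟩
        + toℕ (class e (d t)) ℤ.+ quotient t ℤ.* + 6 ∎
        where
        open ≡-Reasoning
        q = + ((toℕ e ℕ.+ 3 ℕ.* toℕ (d t)) ℕ./ 6)
        collect : ∀ e a d b → (e ℤ.+ a ℤ.* + 6) ℤ.+ + 3 ℤ.* (d ℤ.+ b ℤ.* + 2) ≡ (e ℤ.+ + 3 ℤ.* d) ℤ.+ (a ℤ.+ b) ℤ.* + 6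
        collect = solve-∀
        recollect : ∀ k q a b → (k ℤ.+ q ℤ.* + 6) ℤ.+ (a ℤ.+ b) ℤ.* + 6 ≡ k ℤ.+ (q ℤ.+ a ℤ.+ b) ℤ.* + 6
        recollect = solve-∀

      class≡ : ∀ t → class e (d t) ≡ classes r t
      class≡ 0F = refl
      class≡ 1F = refl
      class≡ 2F = refl

      k≡ : ∀ t → glue₅ c t ≡ residueClass r t ℤ.+ quotient t ℤ.* + 6
      k≡ t = trans (glue₅-≡ t) (cong (λ k → + toℕ k ℤ.+ quotient t ℤ.* + 6) (class≡ t))

      carry : Fin 3 → Fin 3 → ℤ
      carry s t = b s ℤ.+ b t ℤ.+ + ((toℕ (d s) ℕ.+ toℕ (d t)) ℕ./ 2)

      pair≡ : ∀ y s t → + 2 ℤ.* y ℤ.+ (c (suc s) ℤ.+ c (suc t)) ≡ + 2 ℤ.* (y ℤ.+ carry s t) ℤ.+ + toℕ (parity (d s) (d t))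
      pair≡ y s t = begin
        + 2 ℤ.* y ℤ.+ (c (suc s) ℤ.+ c (suc t))
          ≡⟨ cong₂ (λ i j → + 2 ℤ.* y ℤ.+ (i ℤ.+ j)) (mod′-≡ (c (suc s)) 2) (mod′-≡ (c (suc t)) 2) ⟩
        + 2 ℤ.* y ℤ.+ ((+ toℕ (d s) ℤ.+ b s ℤ.* + 2) ℤ.+ (+ toℕ (d t) ℤ.+ b t ℤ.* + 2))
          ≡⟨ collect y (+ toℕ (d s)) (b s) (+ toℕ (d t)) (b t) ⟩
        + 2 ℤ.* (y ℤ.+ (b s ℤ.+ b t)) ℤ.+ (+ toℕ (d s) ℤ.+ + toℕ (d t))
          ≡⟨ cong (λ i → + 2 ℤ.* (y ℤ.+ (b s ℤ.+ b t)) ℤ.+ i) (trans (sym (ℤ.pos-+ (toℕ (d s)) (toℕ (d t)))) (toℕ-mod (toℕ (d s) ℕ.+ toℕ (d t)) 2)) ⟩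
        + 2 ℤ.* (y ℤ.+ (b s ℤ.+ b t)) ℤ.+ (+ toℕ (parity (d s) (d t)) ℤ.+ h ℤ.* + 2)
          ≡⟨ recollect y (b s) (b t) (+ toℕ (parity (d s) (d t))) h ⟩
        + 2 ℤ.* (y ℤ.+ carry s t) ℤ.+ + toℕ (parity (d s) (d t)) ∎
        where
        open ≡-Reasoning
        h = + ((toℕ (d s) ℕ.+ toℕ (d t)) ℕ./ 2)
        collect : ∀ y d b d′ b′ → + 2 ℤ.* y ℤ.+ ((d ℤ.+ b ℤ.* + 2) ℤ.+ (d′ ℤ.+ b′ ℤ.* + 2)) ≡ + 2 ℤ.* (y ℤ.+ (b ℤ.+ b′)) ℤ.+ (d ℤ.+ d′)
        collect = solve-∀
        recollect : ∀ y b b′ p h → + 2 ℤ.* (y ℤ.+ (b ℤ.+ b′)) ℤ.+ (p ℤ.+ h ℤ.* + 2) ≡ + 2 ℤ.* (y ℤ.+ (b ℤ.+ b′ ℤ.+ h)) ℤ.+ p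
        recollect = solve-∀

      m₃≡1 : m 3F ≡ 1ℤ
      m₃≡1 = ι-injective (trans (sym (assemble-root (glue₅ c) p m)) (trans (cong (λ v → ⟪ v , ρ ⟫) (sym u≡)) u-root))

      digits : ℕ
      digits = toℕ e ℕ.+ (toℕ (d 0F) ℕ.+ (toℕ (d 1F) ℕ.+ toℕ (d 2F)))

      odd : Odd r
      odd with digits ℕ.mod 2 in eq
      ... | 1F = trans (sym (toℕ-fromℕ< (ℕ.m%n<n digits 2))) (cong toℕ eq)
      ... | 0F = contradiction (trans (sym m₃≡) m₃≡1) (2*≢1 z)
        where
        z = y 3F ℤ.+ a ℤ.* + 3 ℤ.+ b 0F ℤ.+ b 1F ℤ.+ b 2F ℤ.+ + (digits ℕ./ 2)
        digits≡ : + digits ≡ + toℕ e ℤ.+ (+ toℕ (d 0F) ℤ.+ (+ toℕ (d 1F) ℤ.+ + toℕ (d 2F)))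
        digits≡ = trans (ℤ.pos-+ (toℕ e) _) (cong (λ i → + toℕ e ℤ.+ i) (trans (ℤ.pos-+ (toℕ (d 0F)) _) (cong (λ i → + toℕ (d 0F) ℤ.+ i) (ℤ.pos-+ (toℕ (d 1F)) (toℕ (d 2F))))))
        collect : ∀ y e a d₀ b₀ d₁ b₁ d₂ b₂ → + 2 ℤ.* y ℤ.+ ((e ℤ.+ a ℤ.* + 6) ℤ.+ ((d₀ ℤ.+ b₀ ℤ.* + 2) ℤ.+ ((d₁ ℤ.+ b₁ ℤ.* + 2) ℤ.+ (d₂ ℤ.+ b₂ ℤ.* + 2)))) ≡
          (e ℤ.+ (d₀ ℤ.+ (d₁ ℤ.+ d₂))) ℤ.+ + 2 ℤ.* (y ℤ.+ a ℤ.* + 3 ℤ.+ b₀ ℤ.+ b₁ ℤ.+ b₂)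
        collect = solve-∀
        recollect : ∀ h w → 0ℤ ℤ.+ h ℤ.* + 2 ℤ.+ + 2 ℤ.* w ≡ + 2 ℤ.* (w ℤ.+ h)
        recollect = solve-∀
        m₃≡ : m 3F ≡ + 2 ℤ.* z
        m₃≡ = trans (cong (λ i → + 2 ℤ.* y 3F ℤ.+ i) (cong₂ ℤ._+_ (mod′-≡ (c 0F) 6) (cong₂ ℤ._+_ (mod′-≡ (c 1F) 2) (cong₂ ℤ._+_ (mod′-≡ (c 2F) 2) (mod′-≡ (c 3F) 2)))))
          (trans (collect (y 3F) (+ toℕ e) a (+ toℕ (d 0F)) (b 0F) (+ toℕ (d 1F)) (b 1F) (+ toℕ (d 2F)) (b 2F))
            (trans (cong (λ i → i ℤ.+ + 2 ℤ.* (y 3F ℤ.+ a ℤ.* + 3 ℤ.+ b 0F ℤ.+ b 1F ℤ.+ b 2F))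
                (trans (sym digits≡) (trans (toℕ-mod digits 2) (cong (λ i → + toℕ i ℤ.+ + (digits ℕ./ 2) ℤ.* + 2) eq))))
              (recollect (+ (digits ℕ./ 2)) (y 3F ℤ.+ a ℤ.* + 3 ℤ.+ b 0F ℤ.+ b 1F ℤ.+ b 2F))))

      y′ : Fin 3 → ℤ
      y′ 0F = y 0F ℤ.+ carry 1F 2F
      y′ 1F = y 1F ℤ.+ carry 0F 2F
      y′ 2F = y 2F ℤ.+ carry 0F 1F

      m≡ : ∀ τ → m τ ≡ oddities r y′ τ
      m≡ 0F = pair≡ (y 0F) 1F 2F
      m≡ 1F = pair≡ (y 1F) 0F 2F
      m≡ 2F = pair≡ (y 2F) 0F 1F
      m≡ 3F = m₃≡1

    reduce : Reduced u
    reduce = record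
      { r   = r
      ; odd = odd
      ; p   = λ t → shift (quotient t) (p t)
      ; y   = y′
      ; p≡  = λ t → trans (total-shift (quotient t) (p t)) (trans (cong (λ i → i ℤ.- quotient t ℤ.* + 6) (trans (p≡ t) (k≡ t)))
          (cancel (residueClass r t) (quotient t ℤ.* + 6)))
      ; u≡  = trans u≡ (trans (assemble-cong p k≡ m≡) assemble-shift)
      }
      where
      cancel : ∀ k q → k ℤ.+ q ℤ.- q ≡ k
      cancel = solve-∀
      assemble-shift : assemble (λ t → residueClass r t ℤ.+ quotient t ℤ.* + 6) p (oddities r y′) ≡
        assemble (residueClass r) (λ t → shift (quotient t) (p t)) (oddities r y′)
      assemble-shift = cong₂ _++_ (coset-shift (residueClass r 0F) (quotient 0F) (p 0F))
        (cong₂ _++_ (coset-shift (residueClass r 1F) (quotient 1F) (p 1F))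
        (cong (_++ halves₀ (oddities r y′)) (coset-shift (residueClass r 2F) (quotient 2F) (p 2F))))

-- The doubled vectors of norm 3

module Doubling where
  open import Data.Fin.Base using (suc)
  open import Data.Fin.Properties using (all?)
  open import Data.Integer.Base using (+_)
  open import Data.Nat.Base using (suc)
  open import Data.Nat.Tactic.RingSolver using () renaming (solve-∀ to solveℕ-∀)
  open import Data.Vec.Base using ([]; _∷_; _++_)
  open import Relation.Binary.PropositionalEquality
  open import Algebra.Properties.CommutativeSemigroup (CommutativeMonoid.commutativeSemigroup ℚ.*-1-commutativeMonoid) using (x∙yz≈y∙xz)
  open import Defs
  open Vertices
  open Lines
  open Vectors
  open SylvesterReduction using (1/6)
  open Gluing
  open Minimality
  open Reduction

  -- Doubling in the notation of vector; the last block of ρ is cancelled by m 3F ≡ 1.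
  module _ (S : Fin 3 → Subset 6) (m : Fin 4 → ℤ) (m₃≡1 : m 3F ≡ 1ℤ) where
    private
      2· : ∀ {n} → V n → V n
      2· x = (+ 2 / 1) · x

      cosetOf : Fin 3 → V 6
      cosetOf t = coset (+ ∣ S t ∣) (Vec.map side (S t))

      signsOf : Fin 3 → V 2
      signsOf τ = signs (ℤ.- m (inject₁ τ))

      join : ∀ {k n} (x x₀ x′ : V k) (y y₀ y′ : V n) → 2· x ⊖ x₀ ≡ ι -1ℤ · x′ → 2· y ⊖ y₀ ≡ ι -1ℤ · y′ →
        2· (x ++ y) ⊖ (x₀ ++ y₀) ≡ ι -1ℤ · (x′ ++ y′)
      join x x₀ x′ y y₀ y′ p q = trans (cong₂ _⊹_ (Vec.map-++ _ x y) (Vec.map-++ _ x₀ y₀))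
        (trans (Vec.zipWith-++ ℚ._+_ (2· x) (2· y) (neg x₀) (neg y₀)) (trans (cong₂ _++_ p q) (sym (Vec.map-++ _ x′ y′))))

      ⊖𝟎 : ∀ {n} (x : V n) → x ⊖ 𝟎 ≡ x
      ⊖𝟎 []      = refl
      ⊖𝟎 (a ∷ x) = cong₂ _∷_ (ℚ.+-identityʳ a) (⊖𝟎 x)

      2ι½ : ∀ x → (+ 2 / 1) ℚ.* (ι x ℚ.* ½) ≡ ι -1ℤ ℚ.* ι (ℤ.- x)
      2ι½ x = trans (trans (x∙yz≈y∙xz (+ 2 / 1) (ι x) ½) (ℚ.*-identityʳ (ι x)))
        (trans (cong ι (lemma x)) (ι-* -1ℤ (ℤ.- x)))
        where
        lemma : ∀ x → x ≡ -1ℤ ℤ.* ℤ.- x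
        lemma = solve-∀

      coset-double : ∀ t → 2· (cosetOf t) ⊖ 𝟎 ≡ ι -1ℤ · shape (S t)
      coset-double t = trans (⊖𝟎 (2· (cosetOf t))) (trans (sym (Vec.map-∘ _ _ (Vec.map side (S t))))
        (trans (sym (Vec.map-∘ _ side (S t))) (trans (Vec.map-cong entries (S t)) (Vec.map-∘ _ _ (S t)))))
        where
        k = + ∣ S t ∣
        entries : ∀ s → (+ 2 / 1) ℚ.* (ι (k ℤ.- + 6 ℤ.* side s) ℚ.* 1/6) ≡ ι -1ℤ ℚ.* (ι (+ 6 ℤ.* side s ℤ.- k) ℚ.* ⅓)
        entries s = trans (x∙yz≈y∙xz (+ 2 / 1) (ι (k ℤ.- + 6 ℤ.* side s)) 1/6)
          (trans (cong (λ i → ι i ℚ.* ⅓) (lemma k (side s))) (trans (cong (ℚ._* ⅓) (ι-* -1ℤ (+ 6 ℤ.* side s ℤ.- k)))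
            (ℚ.*-assoc (ι -1ℤ) (ι (+ 6 ℤ.* side s ℤ.- k)) ⅓)))
          where
          lemma : ∀ k s → k ℤ.- + 6 ℤ.* s ≡ -1ℤ ℤ.* (+ 6 ℤ.* s ℤ.- k)
          lemma = solve-∀

      halves-double : ∀ τ → 2· (halves (m (inject₁ τ))) ⊖ 𝟎 ≡ ι -1ℤ · signsOf τ
      halves-double τ = trans (⊖𝟎 (2· (halves (m (inject₁ τ))))) (cong₂ (λ x y → x ∷ y ∷ []) (2ι½ (m (inject₁ τ))) (2ι½ (ℤ.- m (inject₁ τ))))

      ρ₀ : V 2
      ρ₀ = ι 1ℤ ∷ ι -1ℤ ∷ []

      last-double : 2· (halves (m 3F)) ⊖ ρ₀ ≡ ι -1ℤ · 𝟎
      last-double = cong (λ i → 2· (halves i) ⊖ ρ₀) m₃≡1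

    double : (+ 2 / 1) · (cosetOf 0F ++ cosetOf 1F ++ cosetOf 2F ++ halves₀ m) ⊖ ρ ≡ ι -1ℤ · vector S (λ τ → ℤ.- m (inject₁ τ)) 𝟎
    double =
      join (cosetOf 0F) 𝟎 (shape (S 0F)) (cosetOf 1F ++ cosetOf 2F ++ halves₀ m) (𝟎 {6} ++ 𝟎 {6} ++ 𝟎 {2} ++ 𝟎 {2} ++ 𝟎 {2} ++ ρ₀) (shape (S 1F) ++ shape (S 2F) ++ signsOf 0F ++ signsOf 1F ++ signsOf 2F ++ 𝟎) (coset-double 0F)
      (join (cosetOf 1F) 𝟎 (shape (S 1F)) (cosetOf 2F ++ halves₀ m) (𝟎 {6} ++ 𝟎 {2} ++ 𝟎 {2} ++ 𝟎 {2} ++ ρ₀) (shape (S 2F) ++ signsOf 0F ++ signsOf 1F ++ signsOf 2F ++ 𝟎) (coset-double 1F)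
      (join (cosetOf 2F) 𝟎 (shape (S 2F)) (halves₀ m) (𝟎 {2} ++ 𝟎 {2} ++ 𝟎 {2} ++ ρ₀) (signsOf 0F ++ signsOf 1F ++ signsOf 2F ++ 𝟎) (coset-double 2F)
      (join (halves (m 0F)) 𝟎 (signsOf 0F) (halves₁ m) (𝟎 {2} ++ 𝟎 {2} ++ ρ₀) (signsOf 1F ++ signsOf 2F ++ 𝟎) (halves-double 0F)
      (join (halves (m 1F)) 𝟎 (signsOf 1F) (halves₂ m) (𝟎 {2} ++ ρ₀) (signsOf 2F ++ 𝟎) (halves-double 1F)
      (join (halves (m 2F)) 𝟎 (signsOf 2F) (halves (m 3F)) ρ₀ 𝟎 (halves-double 2F) last-double)))))

  module _ {u : V 26} (u-reduced : Reduced u) (u-norm : ⟪ u , u ⟫ ≡ + 3 / 1) where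
    open Reduced u-reduced

    private
      weightOf : Fin 6 → ℕ
      weightOf k = toℕ k ℕ.* (6 ℕ.∸ toℕ k)

      -- The amount by which the norm exceeds the least one in the coset, in the units of `base`: an
      -- A₅ excess counts 36 / 6 and an A₁ excess 18 * 4 / 6.
      slack : ℕ
      slack = 6 ℕ.* sumℕ (λ t → excesses (p t)) ℕ.+ 12 ℕ.* sumℕ (λ τ → excess₂ (parities r τ) (y τ))

      squares≡ : ∀ t → squares (residueClass r t) (p t) ≡ + 6 ℤ.* + weightOf (classes r t) ℤ.+ + 36 ℤ.* + excesses (p t)
      squares≡ t = trans (squares-excess (residueClass r t) (p t))
        (trans (cong (λ s → + 6 ℤ.* (residueClass r t ℤ.* residueClass r t) ℤ.- + 12 ℤ.* residueClass r t ℤ.* s ℤ.+ + 36 ℤ.* (s ℤ.+ + excesses (p t))) (p≡ t))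
          (trans (expand (residueClass r t) (+ excesses (p t))) (cong (λ s → s ℤ.+ + 36 ℤ.* + excesses (p t)) (values (classes r t)))))
        where
        expand : ∀ k x → + 6 ℤ.* (k ℤ.* k) ℤ.- + 12 ℤ.* k ℤ.* k ℤ.+ + 36 ℤ.* (k ℤ.+ x) ≡ (+ 36 ℤ.* k ℤ.- + 6 ℤ.* (k ℤ.* k)) ℤ.+ + 36 ℤ.* x
        expand = solve-∀
        values : ∀ (k : Fin 6) → + 36 ℤ.* + toℕ k ℤ.- + 6 ℤ.* (+ toℕ k ℤ.* + toℕ k) ≡ + 6 ℤ.* + weightOf k
        values = toWitness {a? = all? λ k → _ ℤ.≟ _} tt

      36·norm : ℤ
      36·norm = squares (residueClass r 0F) (p 0F) ℤ.+ (squares (residueClass r 1F) (p 1F) ℤ.+ (squares (residueClass r 2F) (p 2F) ℤ.+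
        (+ 18 ℤ.* (oddities r y 0F ℤ.* oddities r y 0F) ℤ.+ (+ 18 ℤ.* (oddities r y 1F ℤ.* oddities r y 1F) ℤ.+ (+ 18 ℤ.* (oddities r y 2F ℤ.* oddities r y 2F) ℤ.+ + 18)))))

      integral-norm : 36·norm ≡ + 108
      integral-norm = ι-injective (begin
        ι 36·norm                          ≡⟨ ℚ.*-identityʳ (ι 36·norm) ⟨
        ι 36·norm ℚ.* 1ℚ                   ≡⟨ ℚ.*-assoc (ι 36·norm) 1/36 (+ 36 / 1) ⟨
        ι 36·norm ℚ.* 1/36 ℚ.* (+ 36 / 1)  ≡⟨ cong (ℚ._* (+ 36 / 1)) (trans (sym (assemble-norm (residueClass r) p (oddities r y))) (trans (cong₂ ⟪_,_⟫ (sym u≡) (sym u≡)) u-norm)) ⟩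
        (+ 3 / 1) ℚ.* (+ 36 / 1)           ∎)
        where open ≡-Reasoning

      squares-ℕ : ∀ t → squares (residueClass r t) (p t) ≡ + (6 ℕ.* weightOf (classes r t) ℕ.+ 36 ℕ.* excesses (p t))
      squares-ℕ t = trans (squares≡ t) (sym (cong₂ ℤ._+_ (ℤ.pos-* 6 (weightOf (classes r t))) (ℤ.pos-* 36 (excesses (p t)))))

      oddity-ℕ : ∀ d y → let m = + 2 ℤ.* y ℤ.+ + toℕ d in + 18 ℤ.* (m ℤ.* m) ≡ + (18 ℕ.* (toℕ d ℕ.+ 4 ℕ.* excess₂ d y))
      oddity-ℕ d y = trans (cong (λ s → + 18 ℤ.* s) (trans (square-excess₂ d y) (cong (λ s → + toℕ d ℤ.+ s) (sym (ℤ.pos-* 4 (excess₂ d y))))))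
        (sym (ℤ.pos-* 18 (toℕ d ℕ.+ 4 ℕ.* excess₂ d y)))

      -- 36 times the norm is 6 (base + slack) + 18, the 18 coming from the last block, and it
      -- equals 108. Together with `base-minimal` this leaves no slack.
      base+slack : base r ℕ.+ slack ≡ 15
      base+slack = ℕ.*-cancelˡ-≡ (base r ℕ.+ slack) 15 6 (ℕ.+-cancelʳ-≡ 18 (6 ℕ.* (base r ℕ.+ slack)) 90
        (trans (regroup (weightOf (classes r 0F)) (weightOf (classes r 1F)) (weightOf (classes r 2F))
            (toℕ (parities r 0F)) (toℕ (parities r 1F)) (toℕ (parities r 2F))
            (excesses (p 0F)) (excesses (p 1F)) (excesses (p 2F))
            (excess₂ (parities r 0F) (y 0F)) (excess₂ (parities r 1F) (y 1F)) (excess₂ (parities r 2F) (y 2F)))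
          (ℤ.+-injective (trans (sym natural) integral-norm))))
        where
        natural : _ ≡ _
        natural = cong₂ ℤ._+_ (squares-ℕ 0F) (cong₂ ℤ._+_ (squares-ℕ 1F) (cong₂ ℤ._+_ (squares-ℕ 2F)
          (cong₂ ℤ._+_ (oddity-ℕ (parities r 0F) (y 0F)) (cong₂ ℤ._+_ (oddity-ℕ (parities r 1F) (y 1F))
            (cong (ℤ._+ + 18) (oddity-ℕ (parities r 2F) (y 2F)))))))
        regroup : ∀ a b c d e f x y z u v w → 6 ℕ.* (a ℕ.+ (b ℕ.+ c) ℕ.+ 3 ℕ.* (d ℕ.+ (e ℕ.+ f)) ℕ.+ (6 ℕ.* (x ℕ.+ (y ℕ.+ z)) ℕ.+ 12 ℕ.* (u ℕ.+ (v ℕ.+ w)))) ℕ.+ 18 ≡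
          (6 ℕ.* a ℕ.+ 36 ℕ.* x) ℕ.+ ((6 ℕ.* b ℕ.+ 36 ℕ.* y) ℕ.+ ((6 ℕ.* c ℕ.+ 36 ℕ.* z) ℕ.+
            (18 ℕ.* (d ℕ.+ 4 ℕ.* u) ℕ.+ (18 ℕ.* (e ℕ.+ 4 ℕ.* v) ℕ.+ (18 ℕ.* (f ℕ.+ 4 ℕ.* w) ℕ.+ 18)))))
        regroup = solveℕ-∀

      slack≡0 : slack ≡ 0
      slack≡0 = ℕ.n≤0⇒n≡0 (ℕ.+-cancelˡ-≤ 15 slack 0 (ℕ.≤-trans (ℕ.+-monoˡ-≤ slack (proj₁ (base-minimal r odd))) (ℕ.≤-reflexive base+slack)))

      zero-terms : ∀ k f → suc k ℕ.* sumℕ f ≡ 0 → ∀ t → f t ≡ 0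
      zero-terms k f eq = terms
        where
        f≡0 : sumℕ f ≡ 0
        f≡0 = ℕ.m+n≡0⇒m≡0 (sumℕ f) eq
        terms : ∀ t → f t ≡ 0
        terms 0F = ℕ.m+n≡0⇒m≡0 (f 0F) f≡0
        terms 1F = ℕ.m+n≡0⇒m≡0 (f 1F) (ℕ.m+n≡0⇒n≡0 (f 0F) f≡0)
        terms 2F = ℕ.m+n≡0⇒n≡0 (f 1F) (ℕ.m+n≡0⇒n≡0 (f 0F) f≡0)

    kind : Kind r
    kind = proj₂ (base-minimal r odd) (trans (sym (ℕ.+-identityʳ (base r))) (trans (cong (base r ℕ.+_) (sym slack≡0)) base+slack))

    indicator : ∀ t → ∃[ S ] p t ≡ Vec.map side S × total (p t) ≡ + ∣ S ∣
    indicator t = excesses-0 (p t) (zero-terms 5 (λ t → excesses (p t)) (ℕ.m+n≡0⇒m≡0 _ slack≡0) t)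

    support : Fin 3 → Subset 6
    support t = proj₁ (indicator t)

    support-size : ∀ t → ∣ support t ∣ ≡ toℕ (classes r t)
    support-size t = ℤ.+-injective (trans (sym (proj₂ (proj₂ (indicator t)))) (p≡ t))

    oddity : Fin 3 → ℤ
    oddity τ = + 2 ℤ.* y τ ℤ.+ + toℕ (parities r τ)

    oddity-even : ∀ τ → parities r τ ≡ 0F → oddity τ ≡ 0ℤ
    oddity-even τ = even (parities r τ) (y τ) (zero-terms 11 (λ τ → excess₂ (parities r τ) (y τ)) (ℕ.m+n≡0⇒n≡0 (6 ℕ.* sumℕ (λ t → excesses (p t))) slack≡0) τ)
      where
      even : ∀ d y → excess₂ d y ≡ 0 → d ≡ 0F → + 2 ℤ.* y ℤ.+ + toℕ d ≡ 0ℤ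
      even .0F (+ 0) _ refl = refl

    oddity-odd : ∀ τ → parities r τ ≡ 1F → ∃[ σ ] oddity τ ≡ ±1 σ
    oddity-odd τ = odd′ (parities r τ) (y τ) (zero-terms 11 (λ τ → excess₂ (parities r τ) (y τ)) (ℕ.m+n≡0⇒n≡0 (6 ℕ.* sumℕ (λ t → excesses (p t))) slack≡0) τ)
      where
      odd′ : ∀ d y → excess₂ d y ≡ 0 → d ≡ 1F → ∃[ σ ] + 2 ℤ.* y ℤ.+ + toℕ d ≡ ±1 σ
      odd′ .1F (+ 0)    _ refl = true , refl
      odd′ .1F -[1+ 0 ] _ refl = false , refl

    double-reduced : (+ 2 / 1) · u ⊖ ρ ≡ ι -1ℤ · vector support (λ τ → ℤ.- oddities r y (inject₁ τ)) 𝟎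
    double-reduced = trans (cong (λ v → (+ 2 / 1) · v ⊖ ρ) (trans u≡ (cong₂ _++_ (coset≡ 0F) (cong₂ _++_ (coset≡ 1F) (cong (_++ halves₀ (oddities r y)) (coset≡ 2F))))))
      (double support (oddities r y) refl)
      where
      coset≡ : ∀ t → coset (residueClass r t) (p t) ≡ coset (+ ∣ support t ∣) (Vec.map side (support t))
      coset≡ t = cong₂ coset (cong +_ (sym (support-size t))) (proj₁ (proj₂ (indicator t)))

-- Every doubled vector is a point or a quad up to sign

module Classification where
  open import Data.Bool.Base using (not)
  open import Data.Fin.Base using (zero; suc)
  open import Data.Fin.Subset using (⊥; ∁)
  open import Data.Integer.Base using (+_)
  open import Data.List.Membership.Propositional using () renaming (_∈_ to _∈ₗ_)
  open import Data.List.Relation.Unary.Any using (there)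
  open import Data.Nat.Base using (zero; suc)
  open import Data.Vec.Base using ([]; _∷_; lookup; _++_)
  open import Relation.Binary.PropositionalEquality
  open import Relation.Unary using (_∈_)
  open import Defs
  open Vertices
  open Lines
  open Vectors
  open SylvesterReduction using (1/6)
  open Gluing
  open Minimality
  open Reduction
  open Doubling

  size-0 : ∀ {n} (S : Subset n) → ∣ S ∣ ≡ 0 → S ≡ ⊥
  size-0 []          _  = refl
  size-0 (false ∷ S) eq = cong (false ∷_) (size-0 S eq)

  size-1 : ∀ {n} (S : Subset n) → ∣ S ∣ ≡ 1 → ∃[ i ] S ≡ ⁅ i ⁆
  size-1 (true  ∷ S) eq = zero , cong (true ∷_) (size-0 S (ℕ.suc-injective eq))
  size-1 (false ∷ S) eq with i , refl ← size-1 S eq = suc i , refl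

  ∈-subsets : ∀ {n} (S : Subset n) → S ∈ₗ subsets n ∣ S ∣
  ∈-subsets []          = here refl
  ∈-subsets (true  ∷ S) = ∈-++⁺ˡ (∈-map⁺ (true ∷_) (∈-subsets S))
  ∈-subsets (false ∷ S) with ∣ S ∣ | ∈-subsets S
  ... | zero  | S∈ = ∈-map⁺ (false ∷_) S∈
  ... | suc k | S∈ = ∈-++⁺ʳ _ (∈-map⁺ (false ∷_) S∈)

  ∈-vertices : ∀ σ S → ∣ S ∣ ≡ 3 → (σ , S) ∈ₗ vertices
  ∈-vertices σ S eq = ∈-cartesianProduct⁺ (signs∈ σ) (subst (λ k → S ∈ₗ subsets 6 k) eq (∈-subsets S))
    where
    open import Data.List.Base using (_∷_; [])
    signs∈ : ∀ σ → σ ∈ₗ (true ∷ false ∷ [])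
    signs∈ true  = here refl
    signs∈ false = there (here refl)

  ∣∁∣ : ∀ {n} (S : Subset n) → + ∣ ∁ S ∣ ≡ + n ℤ.- + ∣ S ∣
  ∣∁∣ []          = refl
  ∣∁∣ {suc n} (true ∷ S) = trans (∣∁∣ S) (lemma (+ n) (+ ∣ S ∣))
    where
    lemma : ∀ n s → n ℤ.- s ≡ 1ℤ ℤ.+ n ℤ.- (1ℤ ℤ.+ s)
    lemma = solve-∀
  ∣∁∣ {suc n} (false ∷ S) = trans (cong (λ i → 1ℤ ℤ.+ i) (∣∁∣ S)) (sym (ℤ.+-assoc 1ℤ (+ n) (ℤ.- + ∣ S ∣)))

  -- The indicators of `S` and of its complement add up to the all-one vector, which projects to 0.
  shape-∁ : ∀ S → ι -1ℤ · shape S ≡ ι 1ℤ · shape (∁ S)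
  shape-∁ S = trans (sym (Vec.map-∘ _ _ S)) (trans (Vec.map-cong entries S)
    (trans (Vec.map-∘ _ not S) (Vec.map-∘ (ι 1ℤ ℚ.*_) (λ s → ι (+ 6 ℤ.* side s ℤ.- + ∣ ∁ S ∣) ℚ.* ⅓) (∁ S))))
    where
    integral : ∀ s → ℤ.- (+ 6 ℤ.* side s ℤ.- + ∣ S ∣) ≡ + 6 ℤ.* side (not s) ℤ.- + ∣ ∁ S ∣
    integral true  = trans (lemma (+ ∣ S ∣)) (cong (λ i → + 0 ℤ.- i) (sym (∣∁∣ S)))
      where
      lemma : ∀ s → ℤ.- (+ 6 ℤ.- s) ≡ + 0 ℤ.- (+ 6 ℤ.- s)
      lemma = solve-∀
    integral false = trans (lemma (+ ∣ S ∣)) (cong (λ i → + 6 ℤ.- i) (sym (∣∁∣ S)))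
      where
      lemma : ∀ s → ℤ.- (+ 0 ℤ.- s) ≡ + 6 ℤ.- (+ 6 ℤ.- s)
      lemma = solve-∀
    entries : ∀ s → ι -1ℤ ℚ.* (ι (+ 6 ℤ.* side s ℤ.- + ∣ S ∣) ℚ.* ⅓) ≡ ι 1ℤ ℚ.* (ι (+ 6 ℤ.* side (not s) ℤ.- + ∣ ∁ S ∣) ℚ.* ⅓)
    entries s = trans (sym (ℚ.*-assoc (ι -1ℤ) (ι w) ⅓)) (trans (cong (ℚ._* ⅓) (trans (sym (ι-* -1ℤ w)) (cong ι (trans (ℤ.-1*i≡-i w) (integral s)))))
      (sym (ℚ.*-identityˡ _)))
      where w = + 6 ℤ.* side s ℤ.- + ∣ S ∣

  signs-neg : ∀ m → ι -1ℤ · signs m ≡ ι 1ℤ · signs (ℤ.- m)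
  signs-neg m = cong₂ (λ x y → x ∷ y ∷ []) (negate m) (negate (ℤ.- m))
    where
    negate : ∀ m → ι -1ℤ ℚ.* ι m ≡ ι 1ℤ ℚ.* ι (ℤ.- m)
    negate m = trans (sym (ι-* -1ℤ m)) (trans (cong ι (ℤ.-1*i≡-i m)) (sym (ℚ.*-identityˡ (ι (ℤ.- m)))))

  ·-vector : ∀ c c′ S S′ m m′ → (∀ t → c · shape (S t) ≡ c′ · shape (S′ t)) → (∀ τ → c · signs (m τ) ≡ c′ · signs (m′ τ)) →
    c · 𝟎 {2} ≡ c′ · 𝟎 → c · vector S m 𝟎 ≡ c′ · vector S′ m′ 𝟎
  ·-vector c c′ S S′ m m′ shapes≡ signs≡ 𝟎≡ =
    join (shape (S 0F)) (shape (S′ 0F)) (shape (S 1F) ++ shape (S 2F) ++ signs (m 0F) ++ signs (m 1F) ++ signs (m 2F) ++ 𝟎)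
      (shape (S′ 1F) ++ shape (S′ 2F) ++ signs (m′ 0F) ++ signs (m′ 1F) ++ signs (m′ 2F) ++ 𝟎) (shapes≡ 0F)
    (join (shape (S 1F)) (shape (S′ 1F)) (shape (S 2F) ++ signs (m 0F) ++ signs (m 1F) ++ signs (m 2F) ++ 𝟎)
      (shape (S′ 2F) ++ signs (m′ 0F) ++ signs (m′ 1F) ++ signs (m′ 2F) ++ 𝟎) (shapes≡ 1F)
    (join (shape (S 2F)) (shape (S′ 2F)) (signs (m 0F) ++ signs (m 1F) ++ signs (m 2F) ++ 𝟎)
      (signs (m′ 0F) ++ signs (m′ 1F) ++ signs (m′ 2F) ++ 𝟎) (shapes≡ 2F)
    (join (signs (m 0F)) (signs (m′ 0F)) (signs (m 1F) ++ signs (m 2F) ++ 𝟎) (signs (m′ 1F) ++ signs (m′ 2F) ++ 𝟎) (signs≡ 0F)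
    (join (signs (m 1F)) (signs (m′ 1F)) (signs (m 2F) ++ 𝟎) (signs (m′ 2F) ++ 𝟎) (signs≡ 1F)
    (join (signs (m 2F)) (signs (m′ 2F)) 𝟎 𝟎 (signs≡ 2F) 𝟎≡)))))
    where
    join : ∀ {k n} (x x′ : V k) (y y′ : V n) → c · x ≡ c′ · x′ → c · y ≡ c′ · y′ → c · (x ++ y) ≡ c′ · (x′ ++ y′)
    join x x′ y y′ p q = trans (Vec.map-++ _ x y) (trans (cong₂ _++_ p q) (sym (Vec.map-++ _ x′ y′)))

  OnLine : V 26 → Set
  OnLine v = ∃[ s ] ∃[ l ] IsLine l × v ≡ ι (±1 s) · lineVector l

  vector-flip : ∀ S m → ι -1ℤ · vector S m 𝟎 ≡ ι 1ℤ · vector (∁ ∘ S) (λ τ → ℤ.- m τ) 𝟎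
  vector-flip S m = ·-vector (ι -1ℤ) (ι 1ℤ) S (∁ ∘ S) m (λ τ → ℤ.- m τ) (shape-∁ ∘ S) (signs-neg ∘ m) refl

  onPoint : ∀ s S m → (∀ t → ∣ S t ∣ ≡ 1) → (∀ τ → m τ ≡ 0ℤ) → OnLine (ι (±1 s) · vector S m 𝟎)
  onPoint s S m size m≡0 = s , l , point (i 0F) (i 1F) (i 2F) ,
    ·-vector (ι (±1 s)) (ι (±1 s)) S (part l) m (charge l) (λ t → cong (λ S → ι (±1 s) · shape S) (part≡ t)) (λ τ → cong (λ m → ι (±1 s) · signs m) (m≡0 τ)) refl
    where
    i : Fin 3 → Fin 6
    i t = proj₁ (size-1 (S t) (size t))
    l : Line
    l = point (i 0F) (i 1F) (i 2F)
    part≡ : ∀ t → S t ≡ part l t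
    part≡ 0F = proj₂ (size-1 (S 0F) (size 0F))
    part≡ 1F = proj₂ (size-1 (S 1F) (size 1F))
    part≡ 2F = proj₂ (size-1 (S 2F) (size 2F))

  first second : Fin 3 → Fin 3
  first  = lookup (1F ∷ 0F ∷ 0F ∷ [])
  second = lookup (2F ∷ 2F ∷ 1F ∷ [])

  onQuad : ∀ s t S m σ → ∣ S t ∣ ≡ 3 → (∀ t′ → t′ ≢ t → shape (S t′) ≡ shape ⊥) →
    m t ≡ 0ℤ → m (first t) ≡ 1ℤ → m (second t) ≡ ±1 σ → OnLine (ι (±1 s) · vector S m 𝟎)
  onQuad s t S m σ size empty m₀ m₁ m₂ = s , quad t (σ , S t) , quad t (∈-vertices σ (S t) size) ,
    ·-vector (ι (±1 s)) (ι (±1 s)) S (part (quad t (σ , S t))) m (charge (quad t (σ , S t))) (λ t′ → cong (ι (±1 s) ·_) (shape≡ t′)) (λ τ → cong (λ m → ι (±1 s) · signs m) (charge≡ t τ m₀ m₁ m₂)) refl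
    where
    shape≡ : ∀ t′ → shape (S t′) ≡ shape (part (quad t (σ , S t)) t′)
    shape≡ t′ with t Fin.≟ t′
    ... | yes refl = refl
    ... | no t≢t′  = empty t′ (t≢t′ ∘ sym)
    charge≡ : ∀ t τ → m t ≡ 0ℤ → m (first t) ≡ 1ℤ → m (second t) ≡ ±1 σ → m τ ≡ charge (quad t (σ , S t)) τ
    charge≡ 0F 0F m₀ m₁ m₂ = m₀
    charge≡ 0F 1F m₀ m₁ m₂ = m₁
    charge≡ 0F 2F m₀ m₁ m₂ = m₂
    charge≡ 1F 0F m₀ m₁ m₂ = m₁
    charge≡ 1F 1F m₀ m₁ m₂ = m₀
    charge≡ 1F 2F m₀ m₁ m₂ = m₂
    charge≡ 2F 0F m₀ m₁ m₂ = m₁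
    charge≡ 2F 1F m₀ m₁ m₂ = m₂
    charge≡ 2F 2F m₀ m₁ m₂ = m₀

  first≢ : ∀ t → first t ≢ t
  first≢ 0F ()
  first≢ 1F ()
  first≢ 2F ()

  second≢ : ∀ t → second t ≢ t
  second≢ 0F ()
  second≢ 1F ()
  second≢ 2F ()

  ∣∁∣≡ : ∀ (S : Subset 6) {k l} → ∣ S ∣ ≡ k → + 6 ℤ.- + k ≡ + l → ∣ ∁ S ∣ ≡ l
  ∣∁∣≡ S refl eq = ℤ.+-injective (trans (∣∁∣ S) eq)

  -- Classes 1 give singletons and hence a point. Classes 5 give complements of singletons, so the
  -- vector is negated, which complements all supports. A class 3 gives a quad; there `pick` negates
  -- if necessary, so that the first of the two nonzero charges becomes 1 as `charge` requires.
  -- Complementing the empty supports of the other blocks is harmless, since the empty and the full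
  -- set both have shape zero.
  onLine : ∀ {u} → u ∈ L → ⟪ u , ρ ⟫ ≡ 1ℚ → ⟪ u , u ⟫ ≡ + 3 / 1 → OnLine ((+ 2 / 1) · u ⊖ ρ)
  onLine {u} u∈L u-root u-norm = subst OnLine (sym (double-reduced R u-norm)) (cases (kind R u-norm))
    where
    R : Reduced u
    R = reduce (L⇒glued u∈L) u-root
    open Reduced R
    S : Fin 3 → Subset 6
    S = support R u-norm
    m : Fin 3 → ℤ
    m τ = ℤ.- oddities r y (inject₁ τ)
    size : ∀ t {k} → classes r t ≡ k → ∣ S t ∣ ≡ toℕ k
    size t eq = trans (support-size R u-norm t) (cong toℕ eq)
    oddities≡ : ∀ τ → oddities r y (inject₁ τ) ≡ oddity R u-norm τ
    oddities≡ 0F = refl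
    oddities≡ 1F = refl
    oddities≡ 2F = refl
    even : ∀ τ → parities r τ ≡ 0F → oddities r y (inject₁ τ) ≡ 0ℤ
    even τ eq = trans (oddities≡ τ) (oddity-even R u-norm τ eq)
    odd′ : ∀ τ → parities r τ ≡ 1F → ∃[ σ ] oddities r y (inject₁ τ) ≡ ±1 σ
    odd′ τ eq = proj₁ (oddity-odd R u-norm τ eq) , trans (oddities≡ τ) (proj₂ (oddity-odd R u-norm τ eq))
    -±1 : ∀ σ → ℤ.- ±1 σ ≡ ±1 (not σ)
    -±1 true  = refl
    -±1 false = refl
    cases : Kind r → OnLine (ι -1ℤ · vector S m 𝟎)
    cases (small k≡ p≡) = onPoint false S m (λ t → size t (k≡ t)) (λ τ → cong ℤ.-_ (even τ (p≡ τ)))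
    cases (large k≡ p≡) = subst OnLine (sym (vector-flip S m)) (onPoint true (∁ ∘ S) (λ τ → ℤ.- m τ)
      (λ t → ∣∁∣≡ (S t) (size t (k≡ t)) refl) (λ τ → cong (λ i → ℤ.- (ℤ.- i)) (even τ (p≡ τ))))
    cases (half t k≡ k≢ p≡ p≢) = pick (proj₁ o₁) (proj₂ o₁)
      where
      o₁ = odd′ (first t) (p≢ (first t) (first≢ t))
      o₂ = odd′ (second t) (p≢ (second t) (second≢ t))
      empty : ∀ t′ → t′ ≢ t → S t′ ≡ ⊥
      empty t′ t′≢t = size-0 (S t′) (size t′ (k≢ t′ t′≢t))
      pick : ∀ σ → oddities r y (inject₁ (first t)) ≡ ±1 σ → OnLine (ι -1ℤ · vector S m 𝟎)
      pick false eq = onQuad false t S m (not (proj₁ o₂)) (size t k≡) (λ t′ t′≢t → cong shape (empty t′ t′≢t))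
        (cong ℤ.-_ (even t p≡)) (cong ℤ.-_ eq) (trans (cong ℤ.-_ (proj₂ o₂)) (-±1 (proj₁ o₂)))
      pick true eq = subst OnLine (sym (vector-flip S m)) (onQuad true t (∁ ∘ S) (λ τ → ℤ.- m τ) (proj₁ o₂)
        (∣∁∣≡ (S t) (size t k≡) refl) (λ t′ t′≢t → cong (shape ∘ ∁) (empty t′ t′≢t))
        (cong (λ i → ℤ.- (ℤ.- i)) (even t p≡)) (cong (λ i → ℤ.- (ℤ.- i)) eq) (trans (ℤ.neg-involutive _) (proj₂ o₂)))

-- An affine equiangular set with 57 members

module Existence where
  open import Data.Fin.Base using (zero; suc)
  open import Data.Integer.Base using (+_)
  open import Data.Nat.Base using (zero; suc)
  open import Data.Vec.Base using ([]; _∷_; lookup)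
  open import Relation.Binary.PropositionalEquality
  open import Relation.Unary using (_∈_)
  open import Defs
  open Vertices
  open Lines
  open Vectors
  open Gluing
  open Minimality
  open import Data.List.Base using (List; length)
  open import Data.Rational.Solver using (module +-*-Solver)
  open import Relation.Unary using (_⊆_)
  open SylvesterReduction
  open import Data.List.Relation.Unary.AllPairs using (allPairs?)
  open import Data.List.Membership.Propositional.Properties using (∈-lookup)

  polarization : ∀ {n} (x y r : V n) → ⟪ (+ 2 / 1) · x ⊖ r , (+ 2 / 1) · y ⊖ r ⟫ ≡
    (+ 4 / 1) ℚ.* ⟪ x , y ⟫ ℚ.+ ⟪ r , r ⟫ ℚ.- (+ 2 / 1) ℚ.* (⟪ x , r ⟫ ℚ.+ ⟪ y , r ⟫)
  polarization []      []      []      = refl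
  polarization (a ∷ x) (b ∷ y) (c ∷ r) = trans
    (cong (λ z → ((+ 2 / 1) ℚ.* a ℚ.- c) ℚ.* ((+ 2 / 1) ℚ.* b ℚ.- c) ℚ.+ z) (polarization x y r))
    (expand a b c ⟪ x , y ⟫ ⟪ r , r ⟫ ⟪ x , r ⟫ ⟪ y , r ⟫)
    where
    open +-*-Solver
    expand : ∀ a b c xy rr xr yr →
      ((+ 2 / 1) ℚ.* a ℚ.- c) ℚ.* ((+ 2 / 1) ℚ.* b ℚ.- c) ℚ.+ ((+ 4 / 1) ℚ.* xy ℚ.+ rr ℚ.- (+ 2 / 1) ℚ.* (xr ℚ.+ yr)) ≡
      (+ 4 / 1) ℚ.* (a ℚ.* b ℚ.+ xy) ℚ.+ (c ℚ.* c ℚ.+ rr) ℚ.- (+ 2 / 1) ℚ.* (a ℚ.* c ℚ.+ xr ℚ.+ (b ℚ.* c ℚ.+ yr))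
    expand = solve 7 (λ a b c xy rr xr yr →
      (con (+ 2 / 1) :* a :- c) :* (con (+ 2 / 1) :* b :- c) :+ (con (+ 4 / 1) :* xy :+ rr :- con (+ 2 / 1) :* (xr :+ yr)) :=
      con (+ 4 / 1) :* (a :* b :+ xy) :+ (c :* c :+ rr) :- con (+ 2 / 1) :* (a :* c :+ xr :+ (b :* c :+ yr))) refl

  root-polarization : ∀ {u v} → ⟪ u , ρ ⟫ ≡ 1ℚ → ⟪ v , ρ ⟫ ≡ 1ℚ →
    ⟪ (+ 2 / 1) · u ⊖ ρ , (+ 2 / 1) · v ⊖ ρ ⟫ ≡ (+ 4 / 1) ℚ.* ⟪ u , v ⟫ ℚ.- (+ 2 / 1)
  root-polarization {u} {v} pu pv = trans (polarization u v ρ)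
    (trans (cong₂ (λ a b → (+ 4 / 1) ℚ.* ⟪ u , v ⟫ ℚ.+ (+ 2 / 1) ℚ.- (+ 2 / 1) ℚ.* (a ℚ.+ b)) pu pv)
      (ℚ.+-assoc ((+ 4 / 1) ℚ.* ⟪ u , v ⟫) (+ 2 / 1) (ℚ.- (+ 4 / 1))))

  quarter : ∀ {x y} → (+ 4 / 1) ℚ.* x ℚ.- (+ 2 / 1) ≡ y → x ≡ (y ℚ.+ (+ 2 / 1)) ℚ.* (+ 1 / 4)
  quarter {x} refl = solve 1 (λ x → x := (con (+ 4 / 1) :* x :- con (+ 2 / 1) :+ con (+ 2 / 1)) :* con (+ 1 / 4)) refl x
    where open +-*-Solver

  -- The vector `u` with `2u - ρ` equal to minus the line vector. The minus sign places the chosen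
  -- points in the coset of `β₀`, and the chosen quads of the three blocks in the cosets of `β₁`,
  -- `β₂` and `β₃`.
  halved : Line → V 26
  halved l = ½ · (ρ ⊖ lineVector l)

  halved-double : ∀ l → (+ 2 / 1) · halved l ⊖ ρ ≡ ι -1ℤ · lineVector l
  halved-double l = general ρ (lineVector l)
    where
    open +-*-Solver
    general : ∀ {n} (r v : V n) → (+ 2 / 1) · (½ · (r ⊖ v)) ⊖ r ≡ ι -1ℤ · v
    general []      []      = refl
    general (a ∷ r) (b ∷ v) = cong₂ _∷_
      (solve 2 (λ a b → con (+ 2 / 1) :* (con ½ :* (a :+ :- b)) :+ :- a := con (ι -1ℤ) :* b) refl a b) (general r v)

  -- The translation used in both directions: inner products 0 and 1 of the vectors correspond to
  -- Gram entries -6 and 6 of the signed lines.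
  adjacent⇒⟪⟫ : ∀ s s′ {l l′ u v} → ⟪ u , ρ ⟫ ≡ 1ℚ → ⟪ v , ρ ⟫ ≡ 1ℚ →
    (+ 2 / 1) · u ⊖ ρ ≡ ι (±1 s) · lineVector l → (+ 2 / 1) · v ⊖ ρ ≡ ι (±1 s′) · lineVector l′ →
    (+ 4 / 1) ℚ.* ⟪ u , v ⟫ ℚ.- (+ 2 / 1) ≡ ι (±1 s ℤ.* ±1 s′ ℤ.* gram l l′) ℚ.* ⅓
  adjacent⇒⟪⟫ s s′ {l} {l′} {u} {v} pu pv ul vl = trans (sym (root-polarization {u} {v} pu pv))
    (trans (⟪⟫-scaled (ι (±1 s)) (ι (±1 s′)) ul vl) (trans (cong₂ ℚ._*_ (sym (ι-* (±1 s) (±1 s′))) (line-⟪⟫ l l′))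
      (trans (sym (ℚ.*-assoc (ι (±1 s ℤ.* ±1 s′)) (ι (gram l l′)) ⅓)) (cong (ℚ._* ⅓) (sym (ι-* (±1 s ℤ.* ±1 s′) (gram l l′)))))))

  clique : List Vertex
  clique =
    (true  , true  ∷ true  ∷ true  ∷ false ∷ false ∷ false ∷ []) List.∷
    (false , true  ∷ true  ∷ false ∷ true  ∷ false ∷ false ∷ []) List.∷
    (false , false ∷ false ∷ true  ∷ true  ∷ false ∷ true  ∷ []) List.∷
    (true  , false ∷ false ∷ true  ∷ true  ∷ true  ∷ false ∷ []) List.∷
    (false , false ∷ true  ∷ false ∷ false ∷ true  ∷ true  ∷ []) List.∷
    (false , true  ∷ false ∷ true  ∷ false ∷ true  ∷ false ∷ []) List.∷
    (true  , true  ∷ false ∷ false ∷ true  ∷ false ∷ true  ∷ []) List.∷ List.[]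

  -- The points form the addition table of the integers modulo 6, a Latin square, and the same
  -- 7-clique is taken over each of the three blocks.
  lines : List Line
  lines = List.map (λ (i , j) → point i j ((toℕ i ℕ.+ toℕ j) ℕ.mod 6)) pairs
    List.++ List.concatMap (λ t → List.map (quad t) clique) (allFin 3)

  -- Membership in A n, decided on the numerators of the coordinates.
  Integral : ∀ {n} → V n → Set
  Integral x = x ≡ Vec.map (_/ 1) (Vec.map ℚ.↥_ x) × Vec.foldr′ ℤ._+_ (+ 0) (Vec.map ℚ.↥_ x) ≡ + 0

  integral? : ∀ {n} (x : V n) → Dec (Integral x)
  integral? x = Vec.≡-dec ℚ._≟_ _ _ ×-dec (_ ℤ.≟ _)

  Integral⊕ : ∀ m {n} → (V n → Set) → V (m ℕ.+ n) → Set
  Integral⊕ m P x = Integral (Vec.take m x) × P (Vec.drop m x)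

  InΛ : V 26 → Set
  InΛ = Integral⊕ 6 (Integral⊕ 6 (Integral⊕ 6 (Integral⊕ 2 (Integral⊕ 2 (Integral⊕ 2 Integral)))))

  inΛ? : ∀ x → Dec (InΛ x)
  inΛ? x = integral? _ ×-dec integral? _ ×-dec integral? _ ×-dec integral? _ ×-dec integral? _ ×-dec integral? _ ×-dec integral? _

  inΛ : ∀ {x} → InΛ x → x ∈ Λ
  inΛ (a , b , c , d , e , f , g) = A′ a , A′ b , A′ c , A′ d , A′ e , A′ f , A′ g
    where
    A′ : ∀ {n} {x : V (suc n)} → Integral x → x ∈ A n
    A′ (p , q) = _ , p , q

  glueVector : Line → V 26
  glueVector (point _ _ _) = β₀
  glueVector (quad t _)    = lookup (β₁ ∷ β₂ ∷ β₃ ∷ []) t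

  glueVector∈L : ∀ l → glueVector l ∈ L
  glueVector∈L (point _ _ _) = gen (inj₂ (inj₁ refl))
  glueVector∈L (quad 0F _)   = gen (inj₂ (inj₂ (inj₁ refl)))
  glueVector∈L (quad 1F _)   = gen (inj₂ (inj₂ (inj₂ (inj₁ refl))))
  glueVector∈L (quad 2F _)   = gen (inj₂ (inj₂ (inj₂ (inj₂ refl))))

  lines-adjacent : AllPairs Adjacent lines
  lines-adjacent = toWitness {a? = allPairs? (λ l l′ → gram l l′ ℤ.≟ + 6 ⊎-dec gram l l′ ℤ.≟ ℤ.- + 6) lines} tt

  lines-norm : All (λ l → gram l l ≡ + 30) lines
  lines-norm = toWitness {a? = All.all? (λ l → gram l l ℤ.≟ + 30) lines} tt

  lines-root : All (λ l → ⟪ halved l , ρ ⟫ ≡ 1ℚ) lines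
  lines-root = toWitness {a? = All.all? (λ l → ⟪ halved l , ρ ⟫ ℚ.≟ 1ℚ) lines} tt

  lines-Λ : All (λ l → InΛ (halved l ⊖ glueVector l)) lines
  lines-Λ = toWitness {a? = All.all? (λ l → inΛ? (halved l ⊖ glueVector l)) lines} tt

  ⟪⟫-comm : ∀ {n} (x y : V n) → ⟪ x , y ⟫ ≡ ⟪ y , x ⟫
  ⟪⟫-comm []      []      = refl
  ⟪⟫-comm (a ∷ x) (b ∷ y) = cong₂ ℚ._+_ (ℚ.*-comm a b) (⟪⟫-comm x y)

  pairwise : ∀ {a r} {A : Set a} {R : A → A → Set r} → (∀ {x y} → R x y → R y x) → ∀ {xs} → AllPairs R xs →
    ∀ i j → i ≡ j ⊎ R (List.lookup xs i) (List.lookup xs j)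
  pairwise sym (_ AllPairs.∷ _)  zero    zero    = inj₁ refl
  pairwise sym (r AllPairs.∷ _)  zero    (suc j) = inj₂ (All.lookup r (∈-lookup j))
  pairwise sym (r AllPairs.∷ _)  (suc i) zero    = inj₂ (sym (All.lookup r (∈-lookup i)))
  pairwise sym (_ AllPairs.∷ rs) (suc i) (suc j) = Sum.map (cong suc) (λ r → r) (pairwise sym rs i j)

  gram-comm : ∀ l l′ → gram l l′ ≡ gram l′ l
  gram-comm l l′ = ι-injective (trans (times-3 (gram l l′)) (trans (cong (ℚ._* ι (+ 3)) (trans (sym (line-⟪⟫ l l′))
    (trans (⟪⟫-comm (lineVector l) (lineVector l′)) (line-⟪⟫ l′ l)))) (sym (times-3 (gram l′ l)))))
    where
    times-3 : ∀ z → ι z ≡ ι z ℚ.* ⅓ ℚ.* ι (+ 3)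
    times-3 z = trans (sym (ℚ.*-identityʳ (ι z))) (sym (ℚ.*-assoc (ι z) ⅓ (ι (+ 3))))

  halved-⟪⟫ : ∀ {l l′ g} → ⟪ halved l , ρ ⟫ ≡ 1ℚ → ⟪ halved l′ , ρ ⟫ ≡ 1ℚ → gram l l′ ≡ g →
    ⟪ halved l , halved l′ ⟫ ≡ (ι (1ℤ ℤ.* g) ℚ.* ⅓ ℚ.+ (+ 2 / 1)) ℚ.* (+ 1 / 4)
  halved-⟪⟫ {l} {l′} l-root l′-root refl = quarter (adjacent⇒⟪⟫ false false {l} {l′} {halved l} {halved l′} l-root l′-root
    (halved-double l) (halved-double l′))

  lookup-all : ∀ {a p} {A : Set a} (P : A → Set p) {xs} → All P xs → ∀ i → P (List.lookup xs i)
  lookup-all P ps i = All.lookup ps (∈-lookup i)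

  Adjacent-sym : ∀ {l l′} → Adjacent l l′ → Adjacent l′ l
  Adjacent-sym {l} {l′} = Sum.map (λ eq → trans (gram-comm l′ l) eq) (λ eq → trans (gram-comm l′ l) eq)

  module Family (ls : List Line) (ls-adjacent : AllPairs Adjacent ls) (ls-norm : All (λ l → gram l l ≡ + 30) ls)
    (ls-root : All (λ l → ⟪ halved l , ρ ⟫ ≡ 1ℚ) ls) (ls-Λ : All (λ l → InΛ (halved l ⊖ glueVector l)) ls) where

    Ω : Pred (V 26) 0ℓ
    Ω x = ∃[ i ] x ≡ halved (List.lookup ls i)

    Ω-root : ∀ i → ⟪ halved (List.lookup ls i) , ρ ⟫ ≡ 1ℚ
    Ω-root = lookup-all (λ l → ⟪ halved l , ρ ⟫ ≡ 1ℚ) ls-root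

    Ω-norm : ∀ i → ⟪ halved (List.lookup ls i) , halved (List.lookup ls i) ⟫ ≡ + 3 / 1
    Ω-norm i = halved-⟪⟫ {List.lookup ls i} {List.lookup ls i} (Ω-root i) (Ω-root i) (lookup-all (λ l → gram l l ≡ + 30) ls-norm i)

    Ω-distinct : ∀ i j → i ≡ j ⊎ (⟪ halved (List.lookup ls i) , halved (List.lookup ls j) ⟫ ≡ 0ℚ ⊎ ⟪ halved (List.lookup ls i) , halved (List.lookup ls j) ⟫ ≡ 1ℚ)
    Ω-distinct i j = Sum.map₂ (Sum.[ (λ eq → inj₂ (halved-⟪⟫ {List.lookup ls i} {List.lookup ls j} (Ω-root i) (Ω-root j) eq))
                                   , (λ eq → inj₁ (halved-⟪⟫ {List.lookup ls i} {List.lookup ls j} (Ω-root i) (Ω-root j) eq)) ]′)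
      (pairwise (λ {l} {l′} → Adjacent-sym {l} {l′}) ls-adjacent i j)

    Ω-affineEquiangular : AffineEquiangular ρ Ω
    Ω-affineEquiangular = record { root = root ; norm = norm ; distinct = distinct }
      where
      root : ∀ {u} → u ∈ Ω → ⟪ u , ρ ⟫ ≡ 1ℚ
      root (i , refl) = Ω-root i
      norm : ∀ {u} → u ∈ Ω → ⟪ u , u ⟫ ≡ + 3 / 1
      norm (i , refl) = Ω-norm i
      distinct : ∀ {u v} → u ∈ Ω → v ∈ Ω → u ≢ v → ⟪ u , v ⟫ ≡ 0ℚ ⊎ ⟪ u , v ⟫ ≡ 1ℚ
      distinct (i , refl) (j , refl) u≢v = Sum.fromInj₂ (λ i≡j → contradiction (cong (λ k → halved (List.lookup ls k)) i≡j) u≢v) (Ω-distinct i j)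

    -- Equal vectors have inner product 3, which excludes the values 0 and 1 left for different
    -- indices.
    Ω-injective : ∀ {i j} → halved (List.lookup ls i) ≡ halved (List.lookup ls j) → i ≡ j
    Ω-injective {i} {j} eq = Sum.[ (λ i≡j → i≡j) , Sum.[ absurd 0ℚ (λ ()) , absurd 1ℚ (λ ()) ]′ ]′ (Ω-distinct i j)
      where
      absurd : ∀ q → + 3 / 1 ≢ q → ⟪ halved (List.lookup ls i) , halved (List.lookup ls j) ⟫ ≡ q → i ≡ j
      absurd q 3≢q h = contradiction (trans (sym (Ω-norm i)) (trans (cong (λ v → ⟪ halved (List.lookup ls i) , v ⟫) eq) h)) 3≢q

    Ω-size : AtLeast (length ls) Ω
    Ω-size = (λ i → halved (List.lookup ls i)) , Ω-injective , λ i → i , refl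

    Ω⊆L : Ω ⊆ L
    Ω⊆L (i , refl) = subst (_∈ L) (cancel (halved (List.lookup ls i)) (glueVector (List.lookup ls i)))
      (+-cl (gen (inj₁ (inΛ {halved (List.lookup ls i) ⊖ glueVector (List.lookup ls i)} (lookup-all (λ l → InΛ (halved l ⊖ glueVector l)) ls-Λ i)))) (glueVector∈L (List.lookup ls i)))
      where
      open +-*-Solver
      cancel : ∀ {n} (x b : V n) → (x ⊖ b) ⊹ b ≡ x
      cancel []      []      = refl
      cancel (x ∷ v) (b ∷ w) = cong₂ _∷_ (solve 2 (λ x b → x :+ :- b :+ b := x) refl x b) (cancel v w)

  open Family lines lines-adjacent lines-norm lines-root lines-Λ public using (Ω; Ω-affineEquiangular; Ω⊆L; Ω-size)

-- The lines of a maximum set, and the theorem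

open import Data.Integer.Base using (+_)
open import Function.Bundles using (module Equivalence)
open import Relation.Binary.PropositionalEquality
open import Relation.Unary using (_∈_)
open import Defs
open Vertices
open Lines
open Spectra
open Vectors
open LinePolynomials
open Classification
open Existence
open ℚ[x]

-- For q equal to 0 or 1 the number 3 (4 q - 2) is -6 or 6. The signs of the two lines can at most
-- exchange these values, and `Adjacent` admits both.
gram-adjacent : ∀ s s′ {l l′ q} → q ≡ 0ℚ ⊎ q ≡ 1ℚ →
  (+ 4 / 1) ℚ.* q ℚ.- (+ 2 / 1) ≡ ι (±1 s ℤ.* ±1 s′ ℤ.* gram l l′) ℚ.* ⅓ → Adjacent l l′
gram-adjacent s s′ {l} {l′} {q} q∈ eq = signed s s′ {gram l l′} (Sum.map (λ p → scaled p) (λ p → scaled p) q∈)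
  where
  scaled : ∀ {q′} → q ≡ q′ → ι (±1 s ℤ.* ±1 s′ ℤ.* gram l l′) ≡ ((+ 4 / 1) ℚ.* q′ ℚ.- (+ 2 / 1)) ℚ.* (+ 3 / 1)
  scaled refl = trans (sym (trans (ℚ.*-assoc (ι z) ⅓ (+ 3 / 1)) (ℚ.*-identityʳ (ι z)))) (cong (ℚ._* (+ 3 / 1)) (sym eq))
    where z = ±1 s ℤ.* ±1 s′ ℤ.* gram l l′
  signed : ∀ s s′ {g} → ι (±1 s ℤ.* ±1 s′ ℤ.* g) ≡ ι (ℤ.- + 6) ⊎ ι (±1 s ℤ.* ±1 s′ ℤ.* g) ≡ ι (+ 6) → g ≡ + 6 ⊎ g ≡ ℤ.- + 6
  signed s s′ {g} h = unsign (±1 s ℤ.* ±1 s′) (product s s′) (Sum.map (ι-injective {±1 s ℤ.* ±1 s′ ℤ.* g} { ℤ.- + 6}) (ι-injective {±1 s ℤ.* ±1 s′ ℤ.* g} {+ 6}) h)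
    where
    product : ∀ s s′ → ±1 s ℤ.* ±1 s′ ≡ 1ℤ ⊎ ±1 s ℤ.* ±1 s′ ≡ -1ℤ
    product true  true  = inj₁ refl
    product true  false = inj₂ refl
    product false true  = inj₂ refl
    product false false = inj₁ refl
    unsign : ∀ e → e ≡ 1ℤ ⊎ e ≡ -1ℤ → e ℤ.* g ≡ ℤ.- + 6 ⊎ e ℤ.* g ≡ + 6 → g ≡ + 6 ⊎ g ≡ ℤ.- + 6
    unsign _ (inj₁ refl) p = Sum.swap (Sum.map (trans (sym (ℤ.*-identityˡ g))) (trans (sym (ℤ.*-identityˡ g))) p)
    unsign _ (inj₂ refl) p = Sum.map negated negated p
      where
      negated : ∀ {x} → -1ℤ ℤ.* g ≡ x → g ≡ ℤ.- x
      negated eq = trans (sym (ℤ.neg-involutive g)) (cong ℤ.-_ (trans (sym (ℤ.-1*i≡-i g)) eq))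

module _ {ω : Pred (V 26) 0ℓ} (maximum : MaximumIn L ρ ω) {n} {u : Fin n → V 26} (enumerates : Enumerates u ω) where
  open MaximumIn maximum renaming (maximum to largest)
  open AffineEquiangular affineEquiangular
  open Enumerates enumerates

  u∈ω : ∀ i → u i ∈ ω
  u∈ω i = Equivalence.from (image (u i)) (i , refl)

  -- Maximality against `Ω` yields 57 distinct members of `ω`, and their positions in the
  -- enumeration are distinct.
  57≤n : 57 ℕ.≤ n
  57≤n = enough (largest Ω Ω-affineEquiangular Ω⊆L 57 Ω-size)
    where
    enough : ∀ {k} → AtLeast k ω → k ℕ.≤ n
    enough (v , v-injective , v∈ω) = Fin.injective⇒≤ {f = index} λ {i} {j} eq →
      v-injective (trans (sym (proj₂ (preimage i))) (trans (cong u eq) (proj₂ (preimage j))))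
      where
      preimage : ∀ i → ∃[ j ] u j ≡ v i
      preimage i = Equivalence.to (image (v i)) (v∈ω i)
      index = λ i → proj₁ (preimage i)

  sign : Fin n → Bool
  sign i = proj₁ (onLine (inside (u∈ω i)) (root (u∈ω i)) (norm (u∈ω i)))

  lineOf : Fin n → Line
  lineOf i = proj₁ (proj₂ (onLine (inside (u∈ω i)) (root (u∈ω i)) (norm (u∈ω i))))

  isLine : ∀ i → IsLine (lineOf i)
  isLine i = proj₁ (proj₂ (proj₂ (onLine (inside (u∈ω i)) (root (u∈ω i)) (norm (u∈ω i)))))

  column : ∀ i → (+ 2 / 1) · u i ⊖ ρ ≡ ι (±1 (sign i)) · lineVector (lineOf i)
  column i = proj₂ (proj₂ (proj₂ (onLine (inside (u∈ω i)) (root (u∈ω i)) (norm (u∈ω i)))))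

  adjacentLines : ∀ {i j} → i ≢ j → Adjacent (lineOf i) (lineOf j)
  adjacentLines {i} {j} i≢j = gram-adjacent (sign i) (sign j) {lineOf i} {lineOf j} {⟪ u i , u j ⟫} (distinct (u∈ω i) (u∈ω j) (λ eq → i≢j (injective eq)))
    (adjacent⇒⟪⟫ (sign i) (sign j) {lineOf i} {lineOf j} {u i} {u j} (root (u∈ω i)) (root (u∈ω j)) (column i) (column j))

  spectralLines : Spectral (List.tabulate lineOf)
  spectralLines = spectral (All.tabulate⁺ isLine) (AllPairs.tabulate⁺ adjacentLines)
    (subst (57 ℕ.≤_) (sym (List.length-tabulate lineOf)) 57≤n)

corollary6p3 :
  ∀ (ω : Pred (V 26) 0ℓ) → MaximumIn L ρ ω →
  ∀ (n : ℕ) (u : Fin n → V 26) → Enumerates u ω →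
    charPoly (seidel ρ u)
      ≋ (X + κ 5) ^ 39 * (X - κ 13) ^ 8 * (X - κ 9) ^ 8
        * (X ^ 2 - κ 19 * X + κ 72)
  ⊎ charPoly (seidel ρ u)
      ≋ (X + κ 5) ^ 39 * (X - κ 13) ^ 6 * (X - κ 9) ^ 6
        * (X - κ 11) * (X - κ 12) * (X ^ 2 - κ 20 * X + κ 87) ^ 2
-- The columns of the matrix in `seidel` are the vectors `2u - ρ`, so its Seidel matrix is that of
-- the signed lines by computation.
corollary6p3 ω maximum n u enumerates = charPoly-lines (λ i → (+ 2 / 1) · u i ⊖ ρ) (sign maximum enumerates) (lineOf maximum enumerates)
  (column maximum enumerates) (spectralLines maximum enumerates)
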